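{- Let $\mathscr{A}$ be the Coxeter arrangement of type $A_3$ in $V=\mathbb{K}^3$ and let $m:\mathscr{A}\to\mathbb{Z}_{\ge 0}$ be a multiplicity such that $(\mathscr{A},m+\mathbf{1})$ is supersolvable, with respect to a supersolvable filtration $\mathscr{A}_1\subset\mathscr{A}_2\subset\mathscr{A}_3=\mathscr{A}$; that is, for all $H'\in\mathscr{A}_3\setminus\mathscr{A}_2$ and $H''\in\mathscr{A}_2$, with $X=H'\cap H''$, either $\mathscr{A}_X=\{H',H''\}$ or $$(m+\mathbf{1})(H'')\ \ge\ \Bigl(\sum_{H\in\mathscr{A}_3\setminus\mathscr{A}_2,\ X\subset H}(m+\mathbf{1})(H)\Bigr)-1 .\qquad(*)$$ Then there exists an $m$-universal derivation $\theta\in D(\mathscr{A},m+\mathbf{1})$ if and only if all of the inequalities $(*)$ (one for each pair $H'\in\mathscr{A}_3\setminus\mathscr{A}_2$, $H''\in\mathscr{A}_2$ with $\mathscr{A}_X\neq\{H',H''\}$) are equalities.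
   Context: $\mathbb{K}$ is a field of characteristic zero, $S=\mathbb{K}[x,y,z]$ is the coordinate ring of $V=\mathbb{K}^3$, $\mathrm{Der}_S=S\partial_x\oplus S\partial_y\oplus S\partial_z$. The (essential) Coxeter arrangement of type $A_3$ is, up to linear change of coordinates, the set of six planes in $\mathbb{K}^3$ defined by $xyz(x-y)(y-z)(x-z)=0$ (equivalently, the essentialization of the braid arrangement $\{\ker(x_i-x_j)\}_{1\le i<j\le 4}$). For each $H\in\mathscr{A}$ fix a linear form $\alpha_H$ with $\ker\alpha_H=H$. A multiplicity is a map $m:\mathscr{A}\to\mathbb{Z}_{\ge 0}$; $\mathbf{1}$ is the multiplicity with constant value $1$. $\mathscr{A}_X=\{H\in\mathscr{A}\mid X\subset H\}$. A supersolvable filtration of an arrangement $\mathscr{A}$ of rank $r$ is a chain of subarrangements $\mathscr{A}_1\subset\mathscr{A}_2\subset\cdots\subset\mathscr{A}_r=\mathscr{A}$ with $\mathrm{rank}(\mathscr{A}_i)=i$ such that for each $i\ge 2$ and any distinct $H,H'\in\mathscr{A}_i$ there is $H''\in\mathscr{A}_{i-1}$ with $H\cap H'\subset H''$. $D(\mathscr{A},m)=\{\theta\in\mathrm{Der}_S\mid\theta(\alpha_H)\in S\alpha_H^{m(H)}\ \forall H\in\mathscr{A}\}$. A nonzero derivation $\theta$ is homogeneous of degree $k$ if every nonzero $\theta(\alpha)$, for $\alpha$ a linear form, is a homogeneous polynomial of degree $k$. For $\varphi\in\mathrm{Der}_S$ and $\theta=f_1\partial_x+f_2\partial_y+f_3\partial_z$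 put $\nabla_\varphi\theta=\varphi(f_1)\partial_x+\varphi(f_2)\partial_y+\varphi(f_3)\partial_z$. A homogeneous $\theta\in D(\mathscr{A},m+\mathbf{1})$ is $m$-universal if $\mathrm{Der}_S\to D(\mathscr{A},m)$, $\varphi\mapsto\nabla_\varphi\theta$, is an isomorphism of $S$-modules. -}

module Defs where

open import Algebra.Bundles using (CommutativeRing; module Semiring)
open import Algebra.Bundles.Raw using (RawRing)
import Algebra.Definitions.RawSemiring as RawSemiringDefs
open import Algebra.Module.Bundles.Raw using (RawLeftModule)
open import Algebra.Module.Morphism.Structures using (IsLeftModuleMonomorphism)
open import Data.Bool.Base using (if_then_else_)
open import Data.Fin.Base using (Fin)
open import Data.Fin.Subset using (Subset; _∈_; _⊆_; ⊤; ⁅_⁆; _∪_; _∩_; _─_)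
open import Data.List.Base as List using (List; []; _∷_; _++_)
open import Data.Nat.Base as ℕ using (ℕ; suc; pred; _∸_; _≤_)
import Data.Nat.Properties as ℕ
open import Data.Product.Base using (∃-syntax; Σ-syntax; _×_; _,_)
open import Data.Sum.Base using (_⊎_)
open import Data.Vec.Base as Vec using (Vec; []; _∷_; _[_]%=_)
import Data.Vec.Properties as Vec
open import Data.Vec.Functional using (Vector)
open import Function.Bundles using (_⇔_)
open import Level using (Level; _⊔_) renaming (suc to lsuc)
open import Relation.Binary.PropositionalEquality using (_≡_; _≢_)
open import Relation.Nullary using (¬_; does)
open import Relation.Unary as Pred using (Pred; _≐_; _⊢_)

-- The library's HeytingField carries an apartness relation as extra data.
-- Here a field is just a nonzero commutative ring whose nonzero elements are
-- invertible; decidability of equality is not required.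
record Field c ℓ : Set (lsuc (c ⊔ ℓ)) where
  field
    commutativeRing : CommutativeRing c ℓ
  open CommutativeRing commutativeRing public
  field
    1≉0     : 1# ≉ 0#
    inverse : ∀ x → x ≉ 0# → ∃[ y ] x * y ≈ 1#

module _ {c ℓ : Level} (K : Field c ℓ) where

  open Field K
  open RawSemiringDefs (Semiring.rawSemiring semiring)
    using (sum) renaming (_×_ to _·_)

  CharacteristicZero : Set ℓ
  CharacteristicZero = ∀ n → suc n · 1# ≉ 0#

  Space : ℕ → Set c
  Space d = Vector Carrier d

  _≈ⱽ_ : ∀ {d} → Space d → Space d → Set ℓ
  v ≈ⱽ w = ∀ i → v i ≈ w i

  combination : ∀ {d k} → Vector Carrier k → Vector (Space d) k → Space d
  combination a b i = sum λ j → a j * b j i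

  record IsBasis {d k} (W : Pred (Space d) ℓ) (b : Vector (Space d) k) :
         Set (c ⊔ ℓ) where
    field
      member      : ∀ j → W (b j)
      independent : ∀ a → (∀ i → combination a b i ≈ 0#) → ∀ j → a j ≈ 0#
      spanning    : ∀ v → W v → ∃[ a ] v ≈ⱽ combination a b

  Monomial : ℕ → Set
  Monomial d = Vec ℕ d

  coordinate : ∀ {d} → Fin d → Monomial d
  coordinate {d} i = Vec.replicate d 0 [ i ]%= suc

  -- A polynomial is a formal sum of terms in which monomials may be repeated
  -- and coefficients may vanish; equality compares collected coefficients.
  Poly : ℕ → Set c
  Poly d = List (Monomial d × Carrier)

  coeff : ∀ {d} → Poly d → Monomial d → Carrier
  coeff []            e = 0#
  coeff ((e′ , a) ∷ p) e =
    if does (Vec.≡-dec ℕ._≟_ e′ e) then a + coeff p e else coeff p e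

  _≈ᴾ_ : ∀ {d} → Poly d → Poly d → Set ℓ
  p ≈ᴾ q = ∀ e → coeff p e ≈ coeff q e

  _*ᵀ_ : ∀ {d} → Monomial d × Carrier → Monomial d × Carrier → Monomial d × Carrier
  (e , a) *ᵀ (f , b) = Vec.zipWith ℕ._+_ e f , a * b

  polyRing : ℕ → RawRing c ℓ
  polyRing d = record
    { Carrier = Poly d
    ; _≈_     = _≈ᴾ_
    ; _+_     = _++_
    ; _*_     = List.cartesianProductWith _*ᵀ_
    ; -_      = List.map λ (e , a) → e , - a
    ; 0#      = []
    ; 1#      = (Vec.replicate d 0 , 1#) ∷ []
    }

  -- When the exponent is 0, `pred` is harmless as the new coefficient is 0.
  ∂ : ∀ {d} → Fin d → Poly d → Poly d
  ∂ i = List.map λ (e , a) → (e [ i ]%= pred) , Vec.lookup e i · a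

  -- With this definition the zero polynomial is homogeneous of every degree.
  HomogeneousPoly : ∀ {d} → ℕ → Poly d → Set ℓ
  HomogeneousPoly k p = ∀ e → Vec.sum e ≢ k → coeff p e ≈ 0#

  LinearForm : ℕ → Set c
  LinearForm d = Vector Carrier d

  eval : ∀ {d} → LinearForm d → Space d → Carrier
  eval α v = sum λ i → α i * v i

  toPoly : ∀ {d} → LinearForm d → Poly d
  toPoly α = List.tabulate λ i → coordinate i , α i

  ker : ∀ {d} → LinearForm d → Pred (Space d) ℓ
  ker α v = eval α v ≈ 0#

  -- θ stands for the derivation Σᵢ θ i ∂ᵢ.
  Der : ℕ → Set c
  Der d = Vector (Poly d) d

  derModule : (d : ℕ) → RawLeftModule (Poly d) c ℓ
  derModule d = record
    { Carrierᴹ = Der d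
    ; _≈ᴹ_     = λ θ η → ∀ i → θ i ≈ᴾ η i
    ; _+ᴹ_     = λ θ η i → θ i S.+ η i
    ; _*ₗ_     = λ f θ i → f S.* θ i
    ; 0ᴹ       = λ i → S.0#
    ; -ᴹ_      = λ θ i → S.- θ i
    }
    where module S = RawRing (polyRing d)

  apply : ∀ {d} → Der d → Poly d → Poly d
  apply {d} θ f = S.sum λ i → θ i S.* ∂ i f
    where module S where
            open RawRing (polyRing d) public
            open RawSemiringDefs rawSemiring public using (sum)

  ∇ : ∀ {d} → Der d → Der d → Der d
  ∇ φ θ i = apply φ (θ i)

  HomogeneousDer : ∀ {d} → Der d → Set (c ⊔ ℓ)
  HomogeneousDer {d} θ =
    ¬ (θ ≈ᴹ 0ᴹ) ×
    (∃[ k ] ∀ (α : LinearForm d) →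
      ¬ (apply θ (toPoly α) ≈ᴾ []) → HomogeneousPoly k (apply θ (toPoly α)))
    where open RawLeftModule (derModule d)

  -- n pairwise distinct hyperplanes through the origin of Kᵈ, each with a
  -- chosen defining form. The hyperplanes are referred to by their index.
  record Arrangement (d n : ℕ) : Set (c ⊔ ℓ) where
    field
      form     : Fin n → LinearForm d
      nonzero  : ∀ H → ¬ (form H ≈ⱽ λ _ → 0#)
      distinct : ∀ {H H′} → H ≢ H′ → ¬ (ker (form H) ≐ ker (form H′))

    hyperplane : Fin n → Pred (Space d) ℓ
    hyperplane H = ker (form H)

    centre : Subset n → Pred (Space d) ℓ
    centre B v = ∀ H → H ∈ B → hyperplane H v

  open Arrangement

  HasRank : ∀ {d n} → Arrangement d n → Subset n → ℕ → Set (c ⊔ ℓ)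
  HasRank {d} A B r =
    ∃[ k ] k ℕ.+ r ≡ d × Σ[ b ∈ Vector (Space d) k ] IsBasis (centre A B) b

  ModularStep : ∀ {d n} → Arrangement d n → Subset n → Subset n → Set (c ⊔ ℓ)
  ModularStep A B C =
    ∀ {H H′} → H ∈ C → H′ ∈ C → H ≢ H′ →
    ∃[ H″ ] H″ ∈ B ×
      (hyperplane A H Pred.∩ hyperplane A H′) Pred.⊆ hyperplane A H″

  record IsSupersolvableFiltration {d n} (A : Arrangement d n)
         (A₁ A₂ A₃ : Subset n) : Set (c ⊔ ℓ) where
    field
      A₁⊆A₂    : A₁ ⊆ A₂
      A₂⊆A₃    : A₂ ⊆ A₃
      A₃≡A     : A₃ ≡ ⊤
      rank₁    : HasRank A A₁ 1
      rank₂    : HasRank A A₂ 2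
      rank₃    : HasRank A A₃ 3
      modular₂ : ModularStep A A₁ A₂
      modular₃ : ModularStep A A₂ A₃

  -- L is the localization A_X at X = H′ ∩ H″. Containment of subspaces is not
  -- decidable over K, so A_X is described by its members, not computed.
  IsLocalization : ∀ {d n} → Arrangement d n → (H′ H″ : Fin n) → Subset n →
                   Set (c ⊔ ℓ)
  IsLocalization A H′ H″ L =
    ∀ H → H ∈ L ⇔
      ((hyperplane A H′ Pred.∩ hyperplane A H″) Pred.⊆ hyperplane A H)

  Multiplicity : ℕ → Set
  Multiplicity n = Fin n → ℕ

  total : ∀ {n} → Multiplicity n → Subset n → ℕ
  total μ B =
    Vec.sum (Vec.zipWith (λ inB k → if inB then k else 0) B (Vec.tabulate μ))

  -- Σ μ(H) − 1 over H ∈ A₃ ∖ A₂ with X ⊆ H, where L = A_X. Below, H′ is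
  -- such an H, so the truncated subtraction is exact as soon as μ(H′) ≥ 1.
  bound : ∀ {n} → Multiplicity n → (A₂ A₃ L : Subset n) → ℕ
  bound μ A₂ A₃ L = total μ ((A₃ ─ A₂) ∩ L) ∸ 1

  SupersolvableInequalities :
    ∀ {d n} → Arrangement d n → Multiplicity n → (A₂ A₃ : Subset n) →
    Set (c ⊔ ℓ)
  SupersolvableInequalities A μ A₂ A₃ =
    ∀ {H′ H″} → H′ ∈ A₃ ─ A₂ → H″ ∈ A₂ →
    ∀ L → IsLocalization A H′ H″ L →
    L ≡ ⁅ H′ ⁆ ∪ ⁅ H″ ⁆ ⊎ bound μ A₂ A₃ L ≤ μ H″

  SupersolvableEqualities :
    ∀ {d n} → Arrangement d n → Multiplicity n → (A₂ A₃ : Subset n) →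
    Set (c ⊔ ℓ)
  SupersolvableEqualities A μ A₂ A₃ =
    ∀ {H′ H″} → H′ ∈ A₃ ─ A₂ → H″ ∈ A₂ →
    ∀ L → IsLocalization A H′ H″ L →
    L ≢ ⁅ H′ ⁆ ∪ ⁅ H″ ⁆ → μ H″ ≡ bound μ A₂ A₃ L

  D : ∀ {d n} → Arrangement d n → Multiplicity n → Pred (Der d) (c ⊔ ℓ)
  D {d} A m θ = ∀ H → toPoly (form A H) ^ m H ∣ apply θ (toPoly (form A H))
    where open RawSemiringDefs (RawRing.rawSemiring (polyRing d)) using (_^_; _∣_)

  -- The last three fields say that φ ↦ ∇ φ θ is an isomorphism of S-modules
  -- from Der onto the submodule D A m of Der.
  record IsUniversal {d n} (A : Arrangement d n) (m : Multiplicity n)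
         (θ : Der d) : Set (c ⊔ ℓ) where
    open RawLeftModule (derModule d) using (_≈ᴹ_)
    field
      homogeneous  : HomogeneousDer θ
      logarithmic  : D A (λ H → m H ℕ.+ 1) θ
      into         : ∀ φ → D A m (∇ φ θ)
      monomorphism : IsLeftModuleMonomorphism (derModule d) (derModule d)
                       (λ φ → ∇ φ θ)
      onto         : ∀ η → D A m η → ∃[ φ ] ∇ φ θ ≈ᴹ η

  -- x, y, z, x - y, y - z, x - z
  A₃-form : Fin 6 → LinearForm 3
  A₃-form H = Vec.lookup (Vec.lookup rows H)
    where
    rows : Vec (Vec Carrier 3) 6
    rows = (1# ∷ 0#   ∷ 0#   ∷ [])
         ∷ (0# ∷ 1#   ∷ 0#   ∷ [])
         ∷ (0# ∷ 0#   ∷ 1#   ∷ [])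
         ∷ (1# ∷ - 1# ∷ 0#   ∷ [])
         ∷ (0# ∷ 1#   ∷ - 1# ∷ [])
         ∷ (1# ∷ 0#   ∷ - 1# ∷ [])
         ∷ []

  -- The linear map whose matrix has the given rows.
  linearMap : ∀ {d k} → Vector (LinearForm d) k → Space d → Space k
  linearMap g v i = eval (g i) v

  -- Only the planes are prescribed: their defining forms in A are arbitrary.
  record IsCoxeterA₃ (A : Arrangement 3 6) : Set (c ⊔ ℓ) where
    field
      g g⁻¹    : Vector (LinearForm 3) 3
      inverseˡ : ∀ v → linearMap g⁻¹ (linearMap g v) ≈ⱽ v
      inverseʳ : ∀ v → linearMap g (linearMap g⁻¹ v) ≈ⱽ v
      planes   : ∀ H → hyperplane A H ≐ (linearMap g ⊢ ker (A₃-form H))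

{-# OPTIONS --safe #-}
module Submission where

-- The planes of the Coxeter arrangement of type A₃ are the edges of the complete graph on four
-- vertices: in suitable coordinates they are the planes u_x = u_y, where u_0 = 0. A modular coatom A₂
-- consists of the edges of the triangle avoiding some vertex (modular-coatom). In coordinates centred
-- at this vertex, the planes outside A₂ are x_k = 0, with multiplicities a_k, and those of A₂ are
-- x_i = x_j, with multiplicities m_ij. The inequalities then read m_ij ≥ a_i + a_j, one for each pair
-- i ≠ j.
--
-- If m_ij = a_i + a_j for all i ≠ j, the universal derivation θ is given by the integrals
--   θ(x_i) = ∫ ∏ₖ (t − x_k)^(a_k) dt  from 0 to x_i.
-- The difference θ(x_i) − θ(x_j) is, up to a nonzero constant and modulo a higher power of
-- x_i − x_j, the product of (x_i − x_j)^(a_i + a_j + 1) and of powers of the remaining differences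
-- (difference-leads), and likewise for θ(x_i) and powers of x_i. So θ is logarithmic for m + 1, and its
-- derivatives are logarithmic for m. That the partial derivatives of θ form a basis of D(A, m) is
-- shown by adding the linear factors of the integrand one at a time. Adding t − x_k changes the
-- partial derivatives by an explicit matrix (ψ-contiguity and Euler's formula, combined in
-- act-transfer). The matrix is injective, and its image contains every vector tangent to the planes
-- through the k-th vertex (transfer-onto); the leading terms show that only such vectors are needed
-- (tangent). Hence the partial derivatives remain a basis (partials-independent, partials-span).
--
-- Conversely, suppose that m_ij > a_i + a_j and that θ is logarithmic for m + 1. Comparing θ(x_i),
-- θ(x_j) and their difference shows that θ(x_i) vanishes to order at least a_i + a_j + 2 along the
-- line x_i = x_j = 0 (flat-value). Hence every combination of the derivatives of θ(x_i) vanishes there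
-- to order at least a_i + a_j + 1. But D(A, m) contains a derivation with value
-- g x_i^(a_i) x_j^(a_j) on x_i, where g does not vanish identically on the line, and this value only
-- vanishes to order a_i + a_j (obstruction, necessity).
--
-- Two lemmas on derivations replace unique factorization and need no decidable equality: a linear
-- form β can be cancelled modulo any ideal stable under a locally nilpotent derivation δ with δ β = 1
-- (cancel-mod), and if α divides f and αⁿ divides δ f, where δ α = 1, then αⁿ⁺¹ divides f (integrate).

open import Defs
open import Algebra.Bundles using (CommutativeRing)
open import Algebra.Bundles.Raw using (RawRing)
import Algebra.Definitions.RawSemiring as RawSemiringDefs
open import Algebra.Module.Morphism.Structures using (IsLeftModuleMonomorphism)
import Algebra.Properties.CommutativeSemigroup as CommutativeSemigroupProperties
import Algebra.Properties.CommutativeSemiring.Exp as CommutativeSemiringExp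
import Algebra.Properties.Ring as RingProperties
import Algebra.Properties.Semiring.Divisibility as SemiringDivisibility
import Algebra.Properties.Semiring.Exp as SemiringExp
import Algebra.Properties.Semiring.Mult as SemiringMult
import Algebra.Properties.Semiring.Mult.TCOptimised as SemiringMultTCOptimised
import Algebra.Properties.Semiring.Sum as SemiringSum
import Algebra.Solver.Ring as RingSolver
open import Algebra.Solver.Ring.AlmostCommutativeRing
  using (fromCommutativeRing; _-Raw-AlmostCommutative⟶_)
open import Algebra.Structures using (IsCommutativeRing)
open import Data.Bool.Base using (Bool; true; false; not; _∨_; if_then_else_; T)
import Data.Bool.Properties as Bool
open import Data.Fin.Base using (Fin; zero; suc)
open import Data.Fin.Patterns using (0F; 1F; 2F; 3F; 4F; 5F)
import Data.Fin.Properties as Fin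
open import Data.Fin.Subset using (Subset; _∈_; _⊆_; ⊤; ⊥; ⁅_⁆; _∪_; _∩_; _─_)
open import Data.Fin.Subset.Properties using (_∈?_; _⊆?_; anySubset?; ⊆-antisym; ∈⊤)
import Data.Integer.Base as ℤ
import Data.Integer.Properties as ℤ
open import Data.List.Base as List using (List; []; _∷_; _++_; length; replicate)
open import Data.Maybe.Base using (Maybe; just; nothing; maybe′; is-just)
import Data.Maybe.Properties as Maybe
open import Data.Nat.Base as ℕ using (ℕ; zero; suc; pred)
import Data.Nat.Properties as ℕ
open import Data.Product.Base using (∃; ∃-syntax; _,_; _×_; proj₁; proj₂)
open import Data.Product.Properties using (≡-dec)
import Data.Sign.Base as Sign
open import Data.Sum.Base using (_⊎_; inj₁; inj₂)
open import Data.Vec.Base as Vec using (Vec; []; _∷_; _[_]%=_)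
open import Data.Vec.Functional using (Vector)
open import Data.Vec.N-ary using (N-ary; Eq; curryⁿ; curryⁿ-cong)
import Data.Vec.Properties as Vec
open import Function.Base using (_∘_; case_of_)
open import Function.Bundles using (_⇔_; mk⇔; module Equivalence)
open import Level using (Level; _⊔_)
import Relation.Binary.Reasoning.Setoid as SetoidReasoning
import Relation.Binary.Reflection as Reflection
open import Relation.Binary.PropositionalEquality as ≡ using (_≡_; _≢_)
open import Relation.Nullary using (¬_; Dec; yes; no; does; contradiction)
open import Relation.Nullary.Decidable
  using (from-yes; ¬?; _×-dec_; _⊎-dec_; _→-dec_; decidable-stable; dec-true)
open Equivalence using (to; from)

-- A ring solver with integer coefficients

module IntegerSolver {c ℓ : Level} (R : CommutativeRing c ℓ) where

  open CommutativeRing R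
  open SemiringMultTCOptimised semiring
    using (1+×; ×-homo-+; ×1-homo-*) renaming (_×_ to _·_)
  open RingProperties ring
    using (-‿distribˡ-*; -‿distribʳ-*; -0#≈0#; -‿involutive; -‿+-comm)
  open SetoidReasoning setoid

  -- The ring homomorphism from the integers.
  fromℤ : ℤ.ℤ → Carrier
  fromℤ (ℤ.+ n)      = n · 1#
  fromℤ ℤ.-[1+ n ]   = - (suc n · 1#)

  private
    ⊖-homo : ∀ m n → fromℤ (m ℤ.⊖ n) ≈ m · 1# - n · 1#
    ⊖-homo m zero = begin
      m · 1#  ≈⟨ +-identityʳ _ ⟨
      m · 1# + 0#  ≈⟨ +-congˡ -0#≈0# ⟨
      m · 1# - 0#  ∎
    ⊖-homo zero (suc n) = sym (+-identityˡ _)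
    ⊖-homo (suc m) (suc n) = begin
      fromℤ (suc m ℤ.⊖ suc n)  ≡⟨ ≡.cong fromℤ (ℤ.[1+m]⊖[1+n]≡m⊖n m n) ⟩
      fromℤ (m ℤ.⊖ n)  ≈⟨ ⊖-homo m n ⟩
      a - b  ≈⟨ +-identityˡ _ ⟨
      0# + (a - b)  ≈⟨ +-congʳ (-‿inverseʳ 1#) ⟨
      (1# - 1#) + (a - b)  ≈⟨ +-assoc _ _ _ ⟩
      1# + (- 1# + (a - b))  ≈⟨ +-congˡ (+-assoc _ _ _) ⟨
      1# + ((- 1# + a) - b)  ≈⟨ +-congˡ (+-congʳ (+-comm _ _)) ⟩
      1# + ((a - 1#) - b)  ≈⟨ +-congˡ (+-assoc _ _ _) ⟩
      1# + (a + (- 1# - b))  ≈⟨ +-assoc _ _ _ ⟨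
      (1# + a) + (- 1# - b)  ≈⟨ +-congˡ (-‿+-comm 1# b) ⟩
      (1# + a) - (1# + b)  ≈⟨ +-cong (1+× m 1#) (-‿cong (1+× n 1#)) ⟨
      suc m · 1# - suc n · 1#  ∎
      where
      a = m · 1#
      b = n · 1#

    +-homo : ∀ i j → fromℤ (i ℤ.+ j) ≈ fromℤ i + fromℤ j
    +-homo (ℤ.+ m)    (ℤ.+ n)    = ×-homo-+ 1# m n
    +-homo (ℤ.+ m)    ℤ.-[1+ n ] = ⊖-homo m (suc n)
    +-homo ℤ.-[1+ m ] (ℤ.+ n)    = trans (⊖-homo n (suc m)) (+-comm _ _)
    +-homo ℤ.-[1+ m ] ℤ.-[1+ n ] = begin
      - (suc (suc (m ℕ.+ n)) · 1#)  ≡⟨ ≡.cong (λ k → - (suc k · 1#)) (≡.sym (ℕ.+-suc m n)) ⟩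
      - ((suc m ℕ.+ suc n) · 1#)  ≈⟨ -‿cong (×-homo-+ 1# (suc m) (suc n)) ⟩
      - (suc m · 1# + suc n · 1#)  ≈⟨ -‿+-comm _ _ ⟨
      - (suc m · 1#) - suc n · 1#  ∎

    pos-homo : ∀ n → fromℤ (Sign.+ ℤ.◃ n) ≈ n · 1#
    pos-homo zero    = refl
    pos-homo (suc n) = refl

    neg-homo : ∀ n → fromℤ (Sign.- ℤ.◃ n) ≈ - (n · 1#)
    neg-homo zero    = sym -0#≈0#
    neg-homo (suc n) = refl

    *-homo : ∀ i j → fromℤ (i ℤ.* j) ≈ fromℤ i * fromℤ j
    *-homo (ℤ.+ m)    (ℤ.+ n)    = trans (pos-homo (m ℕ.* n)) (×1-homo-* m n)
    *-homo (ℤ.+ m)    ℤ.-[1+ n ] = trans (neg-homo (m ℕ.* suc n))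
      (trans (-‿cong (×1-homo-* m (suc n))) (-‿distribʳ-* _ _))
    *-homo ℤ.-[1+ m ] (ℤ.+ n)    = trans (neg-homo (suc m ℕ.* n))
      (trans (-‿cong (×1-homo-* (suc m) n)) (-‿distribˡ-* _ _))
    *-homo ℤ.-[1+ m ] ℤ.-[1+ n ] = begin
      (suc m ℕ.* suc n) · 1#  ≈⟨ ×1-homo-* (suc m) (suc n) ⟩
      a * b  ≈⟨ -‿involutive _ ⟨
      - - (a * b)  ≈⟨ -‿cong (-‿distribˡ-* a b) ⟩
      - (- a * b)  ≈⟨ -‿distribʳ-* (- a) b ⟩
      - a * - b  ∎
      where
      a = suc m · 1#
      b = suc n · 1#

    neg : ∀ i → fromℤ (ℤ.- i) ≈ - fromℤ i
    neg (ℤ.+ zero)    = sym -0#≈0#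
    neg (ℤ.+ (suc n)) = refl
    neg ℤ.-[1+ n ]    = sym (-‿involutive _)

    morphism : ℤ.+-*-rawRing -Raw-AlmostCommutative⟶ fromCommutativeRing R
    morphism = record
      { ⟦_⟧    = fromℤ
      ; +-homo = +-homo
      ; *-homo = *-homo
      ; -‿homo = neg
      ; 0-homo = refl
      ; 1-homo = refl
      }

    _≟_ : ∀ i j → Maybe (fromℤ i ≈ fromℤ j)
    i ≟ j with i ℤ.≟ j
    ... | yes ≡.refl = just refl
    ... | no  _      = nothing

  open RingSolver ℤ.+-*-rawRing (fromCommutativeRing R) morphism _≟_
    using (normalise; _≟N_; ⟦_⟧N-cong; correct; var; ⟦_⟧; ⟦_⟧↓)
  open RingSolver ℤ.+-*-rawRing (fromCommutativeRing R) morphism _≟_ public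
    using (_:+_; _:*_; _:-_; :-_; con; Polynomial)
  open Reflection setoid var ⟦_⟧ ⟦_⟧↓ correct using (close; prove)

  -- The constants 0 and 1 in solver terms.
  :0 :1 : ∀ {n} → Polynomial n
  :0 = con (ℤ.+ 0)
  :1 = con (ℤ.+ 1)

  infix 4 _:=_
  _:=_ : ∀ {n} → Polynomial n → Polynomial n → Polynomial n × Polynomial n
  _:=_ = _,_

  -- Integer normal forms are compared by evaluation, which is much cheaper than comparing
  -- their values in R.
  solve : ∀ n (f : N-ary n (Polynomial n) (Polynomial n × Polynomial n))
    {_ : T (is-just (normalise (proj₁ (close n f)) ≟N normalise (proj₂ (close n f))))} →
    Eq n _≈_ (curryⁿ ⟦ proj₁ (close n f) ⟧) (curryⁿ ⟦ proj₂ (close n f) ⟧)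
  solve n f {equal} = curryⁿ-cong _≈_ ⟦ p ⟧ ⟦ q ⟧ λ ρ →
      prove ρ p q (⟦ witness (normalise p ≟N normalise q) equal ⟧N-cong ρ)
    where
    p = proj₁ (close n f)
    q = proj₂ (close n f)
    witness : ∀ {a} {A : Set a} (x : Maybe A) → T (is-just x) → A
    witness (just x) _ = x

-- Derivations, differential ideals and leading terms

module DifferentialAlgebra {c ℓ : Level} (R : CommutativeRing c ℓ) where

  open CommutativeRing R hiding (zero) public
  open SemiringMult semiring using () renaming (_×_ to _·_) public
  open SemiringExp semiring using (_^_; ^-congˡ) public
  open SemiringDivisibility semiring
    using (_∣_; _,_; ∣-respʳ; ∣-respˡ; ∣-refl; _∣0) public
  open SemiringSum semiring using (sum; sum-cong-≋; ∑-distrib-+; ∑-comm; *-distribˡ-sum; *-distribʳ-sum) public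
  open CommutativeSemiringExp commutativeSemiring using (^-distrib-*) public
  open IntegerSolver R public
  open SetoidReasoning setoid public
  open RingProperties ring using (-0#≈0#) public

  -- The image of a natural number in R.
  ν : ℕ → Carrier
  ν n = n · 1#

  -- The families s and t agree except at k, where t vanishes.
  sum-split : ∀ {n} (k : Fin n) {s t : Vector Carrier n} →
    (∀ j → j ≢ k → s j ≈ t j) → t k ≈ 0# → sum s ≈ s k + sum t
  sum-split zero {s} {t} s≈t tₖ≈0 = +-congˡ (begin
    sum (λ j → s (suc j))  ≈⟨ sum-cong-≋ (λ j → s≈t (suc j) λ ()) ⟩
    sum (λ j → t (suc j))  ≈⟨ +-identityˡ _ ⟨
    0# + sum (λ j → t (suc j))  ≈⟨ +-congʳ tₖ≈0 ⟨
    sum t  ∎)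
  sum-split (suc k) {s} {t} s≈t tₖ≈0 = begin
    s zero + sum (λ j → s (suc j))
      ≈⟨ +-cong (s≈t zero λ ()) (sum-split k (λ j j≢k → s≈t (suc j) (j≢k ∘ Fin.suc-injective)) tₖ≈0) ⟩
    t zero + (s (suc k) + sum (λ j → t (suc j)))
      ≈⟨ solve 3 (λ a b c → a :+ (b :+ c) := b :+ (a :+ c)) (t zero) (s (suc k)) _ ⟩
    s (suc k) + sum t ∎

  sum-0 : ∀ n → sum {n} (λ _ → 0#) ≈ 0#
  sum-0 zero    = refl
  sum-0 (suc n) = trans (+-identityˡ _) (sum-0 n)

  sum-single : ∀ {n} (k : Fin n) {s : Vector Carrier n} → (∀ j → j ≢ k → s j ≈ 0#) → sum s ≈ s k
  sum-single {n} k {s} s≈0 = begin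
    sum s  ≈⟨ sum-split k {s} {λ _ → 0#} s≈0 refl ⟩
    s k + sum {n} (λ _ → 0#)  ≈⟨ +-congˡ (sum-0 n) ⟩
    s k + 0#  ≈⟨ +-identityʳ _ ⟩
    s k  ∎

  sum-assoc : ∀ {m n} (a : Vector Carrier m) (b : Fin m → Fin n → Carrier) (f : Vector Carrier n) →
    sum (λ i → a i * sum (λ k → b i k * f k)) ≈ sum (λ k → sum (λ i → a i * b i k) * f k)
  sum-assoc a b f = begin
    sum (λ i → a i * sum (λ k → b i k * f k))  ≈⟨ sum-cong-≋ (λ i → *-distribˡ-sum (a i) (λ k → b i k * f k)) ⟩
    sum (λ i → sum (λ k → a i * (b i k * f k)))  ≈⟨ ∑-comm (λ i k → a i * (b i k * f k)) ⟩
    sum (λ k → sum (λ i → a i * (b i k * f k)))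
      ≈⟨ sum-cong-≋ (λ k → trans (sum-cong-≋ λ i → sym (*-assoc (a i) (b i k) (f k)))
           (sym (*-distribʳ-sum (f k) (λ i → a i * b i k)))) ⟩
    sum (λ k → sum (λ i → a i * b i k) * f k)  ∎

  -- A derivation over the integers: linearity over a field of constants is not part of the data,
  -- but every derivation kills the natural numbers and their inverses.
  record Derivation : Set (c ⊔ ℓ) where
    field
      act     : Carrier → Carrier
      cong    : ∀ {f g} → f ≈ g → act f ≈ act g
      +-homo  : ∀ f g → act (f + g) ≈ act f + act g
      leibniz : ∀ f g → act (f * g) ≈ act f * g + f * act g

    0-homo : act 0# ≈ 0#
    0-homo = begin
      act 0#  ≈⟨ solve 1 (λ a → a := (a :+ a) :- a) _ ⟩
      act 0# + act 0# - act 0#  ≈⟨ +-congʳ (+-homo 0# 0#) ⟨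
      act (0# + 0#) - act 0#  ≈⟨ +-congʳ (cong (+-identityʳ 0#)) ⟩
      act 0# - act 0#  ≈⟨ -‿inverseʳ _ ⟩
      0#  ∎

    1-homo : act 1# ≈ 0#
    1-homo = begin
      act 1#  ≈⟨ solve 1 (λ a → a := (a :* :1 :+ :1 :* a) :- a) _ ⟩
      (act 1# * 1# + 1# * act 1#) - act 1#  ≈⟨ +-congʳ (leibniz 1# 1#) ⟨
      act (1# * 1#) - act 1#  ≈⟨ +-congʳ (cong (*-identityʳ 1#)) ⟩
      act 1# - act 1#  ≈⟨ -‿inverseʳ _ ⟩
      0#  ∎

    -‿homo : ∀ f → act (- f) ≈ - act f
    -‿homo f = begin
      act (- f)  ≈⟨ solve 2 (λ a b → a := (a :+ b) :- b) _ (act f) ⟩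
      (act (- f) + act f) - act f  ≈⟨ +-congʳ (+-homo (- f) f) ⟨
      act (- f + f) - act f  ≈⟨ +-congʳ (trans (cong (-‿inverseˡ f)) 0-homo) ⟩
      0# - act f  ≈⟨ +-identityˡ _ ⟩
      - act f  ∎

    sub-homo : ∀ f g → act (f - g) ≈ act f - act g
    sub-homo f g = trans (+-homo f (- g)) (+-congˡ (-‿homo g))

    ν-homo : ∀ n → act (ν n) ≈ 0#
    ν-homo zero    = 0-homo
    ν-homo (suc n) = trans (+-homo 1# (ν n)) (trans (+-cong 1-homo (ν-homo n)) (+-identityʳ 0#))

    power : ∀ f n → act (f ^ suc n) ≈ ν (suc n) * (f ^ n * act f)
    power f zero = begin
      act (f * 1#)  ≈⟨ leibniz f 1# ⟩
      act f * 1# + f * act 1#  ≈⟨ +-congˡ (*-congˡ 1-homo) ⟩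
      act f * 1# + f * 0#  ≈⟨ solve 2 (λ a f → a :* :1 :+ f :* :0 := (:1 :+ :0) :* (:1 :* a)) (act f) f ⟩
      (1# + 0#) * (1# * act f)  ∎
    power f (suc n) = begin
      act (f * f ^ suc n)  ≈⟨ leibniz f (f ^ suc n) ⟩
      act f * (f * f ^ n) + f * act (f ^ suc n)  ≈⟨ +-congˡ (*-congˡ (power f n)) ⟩
      act f * (f * f ^ n) + f * (ν (suc n) * (f ^ n * act f))
        ≈⟨ solve 4 (λ a f p m → a :* (f :* p) :+ f :* (m :* (p :* a)) := (:1 :+ m) :* ((f :* p) :* a)) (act f) f (f ^ n) (ν (suc n)) ⟩
      (1# + ν (suc n)) * (f * f ^ n * act f)  ∎

    -- Scalars killed by the derivation can be moved through it.
    scalar : ∀ {a} → act a ≈ 0# → ∀ f → act (a * f) ≈ a * act f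
    scalar {a} a′≈0 f = begin
      act (a * f)  ≈⟨ leibniz a f ⟩
      act a * f + a * act f  ≈⟨ +-congʳ (trans (*-congʳ a′≈0) (zeroˡ f)) ⟩
      0# + a * act f  ≈⟨ +-identityˡ _ ⟩
      a * act f  ∎

  open Derivation public using (act)

  act-sum : ∀ δ {n} (t : Vector Carrier n) → act δ (sum t) ≈ sum λ i → act δ (t i)
  act-sum δ {zero}  t = Derivation.0-homo δ
  act-sum δ {suc n} t = trans (Derivation.+-homo δ (t zero) _) (+-congˡ (act-sum δ (t ∘ suc)))

  negation : Derivation → Derivation
  negation δ = record
    { act     = λ f → - act δ f
    ; cong    = λ f≈g → -‿cong (δ.cong f≈g)
    ; +-homo  = λ f g → trans (-‿cong (δ.+-homo f g))
                  (solve 2 (λ a b → :- (a :+ b) := :- a :+ :- b) _ _)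
    ; leibniz = λ f g → trans (-‿cong (δ.leibniz f g))
                  (solve 4 (λ a f b g → :- (a :* g :+ f :* b) := :- a :* g :+ f :* :- b) _ f _ g)
    }
    where module δ = Derivation δ

  -- The derivation Σⱼ φⱼ δⱼ.
  linearCombination : ∀ {n} → Vector Carrier n → Vector Derivation n → Derivation
  linearCombination φ δ = record
    { act     = λ f → sum λ j → φ j * act (δ j) f
    ; cong    = λ f≈g → sum-cong-≋ λ j → *-congˡ (Derivation.cong (δ j) f≈g)
    ; +-homo  = λ f g → trans
        (sum-cong-≋ λ j → trans (*-congˡ (Derivation.+-homo (δ j) f g)) (distribˡ _ _ _))
        (∑-distrib-+ (λ j → φ j * act (δ j) f) _)
    ; leibniz = λ f g → trans
        (sum-cong-≋ λ j → trans (*-congˡ (Derivation.leibniz (δ j) f g))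
          (solve 5 (λ p a f b g → p :* (a :* g :+ f :* b) := (p :* a) :* g :+ f :* (p :* b)) (φ j) (act (δ j) f) f (act (δ j) g) g))
        (trans (∑-distrib-+ (λ j → φ j * act (δ j) f * g) _)
          (+-cong (sym (*-distribʳ-sum g (λ j → φ j * act (δ j) f)))
                  (sym (*-distribˡ-sum f (λ j → φ j * act (δ j) g)))))
    }

  quotientOf : ∀ {a b} → a ∣ b → Carrier
  quotientOf (q , _) = q

  equalityOf : ∀ {a b} (a∣b : a ∣ b) → quotientOf a∣b * a ≈ b
  equalityOf (_ , eq) = eq

  ∣-resp₂ : ∀ {a a′ b b′} → a ≈ a′ → b ≈ b′ → a ∣ b → a′ ∣ b′
  ∣-resp₂ a≈a′ b≈b′ a∣b = ∣-respˡ a≈a′ (∣-respʳ b≈b′ a∣b)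

  ∣-+ : ∀ {a x y} → a ∣ x → a ∣ y → a ∣ x + y
  ∣-+ (p , p≈) (q , q≈) = p + q , trans (distribʳ _ p q) (+-cong p≈ q≈)

  ∣-*ˡ : ∀ {a x} y → a ∣ x → a ∣ y * x
  ∣-*ˡ y (p , p≈) = y * p , trans (*-assoc y p _) (*-congˡ p≈)

  ∣-neg : ∀ {a x} → a ∣ x → a ∣ - x
  ∣-neg {a} (p , p≈) = - p , trans (solve 2 (λ p a → :- p :* a := :- (p :* a)) p a) (-‿cong p≈)

  ∣-- : ∀ {a x y} → a ∣ x → a ∣ y → a ∣ x - y
  ∣-- a∣x a∣y = ∣-+ a∣x (∣-neg a∣y)

  ^-∣ : ∀ a {m n} → m ℕ.≤ n → a ^ m ∣ a ^ n
  ^-∣ a {n = n} ℕ.z≤n = a ^ n , *-identityʳ _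
  ^-∣ a {suc m} {suc n} (ℕ.s≤s m≤n) with ^-∣ a m≤n
  ... | q , q≈ = q , trans (solve 3 (λ q a p → q :* (a :* p) := a :* (q :* p)) q a (a ^ m)) (*-congˡ q≈)

  ∣-trans : ∀ {a b x} → a ∣ b → b ∣ x → a ∣ x
  ∣-trans (p , p≈) (q , q≈) = q * p , trans (*-assoc q p _) (trans (*-congˡ p≈) q≈)

  ∣^-weaken : ∀ {a x m n} → m ℕ.≤ n → a ^ n ∣ x → a ^ m ∣ x
  ∣^-weaken {a} m≤n = ∣-trans (^-∣ a m≤n)

  -- An invertible factor can be added to both sides of a divisibility by a power, or removed.
  module _ {a a⁻¹ : Carrier} (inverse : a⁻¹ * a ≈ 1#) where

    private
      inverse-^ : ∀ n → a⁻¹ ^ n * a ^ n ≈ 1#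
      inverse-^ n = trans (sym (^-distrib-* a⁻¹ a n)) (1^n n)
        where
        1^n : ∀ n → (a⁻¹ * a) ^ n ≈ 1#
        1^n zero    = refl
        1^n (suc n) = trans (*-cong inverse (1^n n)) (*-identityˡ 1#)

    ∣-scale : ∀ {α f} n → α ^ n ∣ f → (a * α) ^ n ∣ a * f
    ∣-scale {α} {f} n (q , q≈) = a * q * a⁻¹ ^ n , (begin
      a * q * a⁻¹ ^ n * (a * α) ^ n  ≈⟨ *-congˡ (^-distrib-* a α n) ⟩
      a * q * a⁻¹ ^ n * (a ^ n * α ^ n)  ≈⟨ solve 5 (λ a q u v p → a :* q :* u :* (v :* p) := (u :* v) :* (a :* (q :* p))) a q (a⁻¹ ^ n) (a ^ n) (α ^ n) ⟩
      (a⁻¹ ^ n * a ^ n) * (a * (q * α ^ n))  ≈⟨ trans (*-cong (inverse-^ n) (*-congˡ q≈)) (*-identityˡ _) ⟩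
      a * f  ∎)

    ∣-unscale : ∀ {α f} n → (a * α) ^ n ∣ a * f → α ^ n ∣ f
    ∣-unscale {α} {f} n (q , q≈) = a⁻¹ * (q * a ^ n) , (begin
      a⁻¹ * (q * a ^ n) * α ^ n  ≈⟨ solve 4 (λ u q v p → u :* (q :* v) :* p := u :* (q :* (v :* p))) a⁻¹ q (a ^ n) (α ^ n) ⟩
      a⁻¹ * (q * (a ^ n * α ^ n))  ≈⟨ *-congˡ (trans (*-congˡ (sym (^-distrib-* a α n))) q≈) ⟩
      a⁻¹ * (a * f)  ≈⟨ trans (sym (*-assoc _ _ _)) (trans (*-congʳ inverse) (*-identityˡ f)) ⟩
      f  ∎)

  -- An ideal, given as a predicate, that is stable under a derivation.
  record IsDifferentialIdeal {i} (δ : Derivation) (I : Carrier → Set i) : Set (c ⊔ ℓ ⊔ i) where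
    field
      resp   : ∀ {f g} → f ≈ g → I f → I g
      zero∈  : I 0#
      +-closed : ∀ {f g} → I f → I g → I (f + g)
      *-closed : ∀ f {g} → I g → I (f * g)
      stable   : ∀ {f} → I f → I (act δ f)

    neg-closed : ∀ {f} → I f → I (- f)
    neg-closed {f} If = resp (solve 1 (λ f → :- :1 :* f := :- f) f) (*-closed (- 1#) If)

    minus-closed : ∀ {f g} → I f → I g → I (f - g)
    minus-closed If Ig = +-closed If (neg-closed Ig)

  zeroIdeal : ∀ δ → IsDifferentialIdeal δ (_≈ 0#)
  zeroIdeal δ = record
    { resp     = λ f≈g f≈0 → trans (sym f≈g) f≈0
    ; zero∈    = refl
    ; +-closed = λ f≈0 g≈0 → trans (+-cong f≈0 g≈0) (+-identityʳ 0#)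
    ; *-closed = λ f g≈0 → trans (*-congˡ g≈0) (zeroʳ f)
    ; stable   = λ f≈0 → trans (Derivation.cong δ f≈0) (Derivation.0-homo δ)
    }

  principal : ∀ δ {α} → act δ α ≈ 0# → IsDifferentialIdeal δ (α ∣_)
  principal δ {α} δα≈0 = record
    { resp     = ∣-respʳ
    ; zero∈    = α ∣0
    ; +-closed = ∣-+
    ; *-closed = λ f → ∣-*ˡ f
    ; stable   = λ { {f} (q , q≈) → act δ q , (begin
        act δ q * α  ≈⟨ +-identityʳ _ ⟨
        act δ q * α + 0#  ≈⟨ +-congˡ (trans (*-congˡ δα≈0) (zeroʳ q)) ⟨
        act δ q * α + q * act δ α  ≈⟨ Derivation.leibniz δ q α ⟨
        act δ (q * α)  ≈⟨ Derivation.cong δ q≈ ⟩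
        act δ f  ∎) }
    }

  -- The n-th iterate of a derivation.
  iterate : Derivation → ℕ → Carrier → Carrier
  iterate δ zero    f = f
  iterate δ (suc n) f = act δ (iterate δ n f)

  -- Every element is killed by some power of δ.
  LocallyNilpotent : Derivation → Set (c ⊔ ℓ)
  LocallyNilpotent δ = ∀ f → ∃[ n ] iterate δ n f ≈ 0#

  NonZeroDivisor : Carrier → Set (c ⊔ ℓ)
  NonZeroDivisor α = ∀ {f} → α * f ≈ 0# → f ≈ 0#

  cancel : ∀ {α} → NonZeroDivisor α → ∀ {f g} → α * f ≈ α * g → f ≈ g
  cancel {α} nzd {f} {g} eq = begin
    f  ≈⟨ solve 2 (λ f g → f := (f :- g) :+ g) f g ⟩
    (f - g) + g  ≈⟨ +-congʳ (nzd (begin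
      α * (f - g)  ≈⟨ solve 3 (λ a f g → a :* (f :- g) := a :* f :- a :* g) α f g ⟩
      α * f - α * g  ≈⟨ +-congʳ eq ⟩
      α * g - α * g  ≈⟨ -‿inverseʳ _ ⟩
      0#  ∎)) ⟩
    0# + g  ≈⟨ +-identityˡ g ⟩
    g  ∎

  cancel-^ : ∀ {α} → NonZeroDivisor α → ∀ n {f g} → α ^ n * f ≈ α ^ n * g → f ≈ g
  cancel-^ nzd zero    eq = trans (sym (*-identityˡ _)) (trans eq (*-identityˡ _))
  cancel-^ nzd (suc n) eq = cancel-^ nzd n (cancel nzd
    (trans (sym (*-assoc _ _ _)) (trans eq (*-assoc _ _ _))))

  -- Inverses of the positive integers.
  record Reciprocals : Set (c ⊔ ℓ) where
    field
      recip         : ℕ → Carrier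
      recip-inverse : ∀ n → recip n * ν (suc n) ≈ 1#

  -- Coordinates x with dual, locally nilpotent derivations.
  record CoordinateSystem (d : ℕ) : Set (c ⊔ ℓ) where
    field
      x         : Vector Carrier d
      ∂ˣ        : Vector Derivation d
      ∂x-same   : ∀ k → act (∂ˣ k) (x k) ≈ 1#
      ∂x-other  : ∀ {k j} → k ≢ j → act (∂ˣ k) (x j) ≈ 0#
      nilpotent : ∀ k → LocallyNilpotent (∂ˣ k)

  -- Partial derivatives, and coordinates x related to them by constant matrices L and B inverse to
  -- each other.
  record LinearCoordinates (d : ℕ) : Set (c ⊔ ℓ) where
    field
      partial        : Vector Derivation d
      x              : Vector Carrier d
      L B            : Fin d → Fin d → Carrier
      partial-x      : ∀ i k → act (partial i) (x k) ≈ L k i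
      L-const        : ∀ j k i → act (partial j) (L k i) ≈ 0#
      dual-same      : ∀ k → sum (λ i → L k i * B k i) ≈ 1#
      dual-other     : ∀ {k j} → k ≢ j → sum (λ i → L j i * B k i) ≈ 0#
      complete-same  : ∀ i → sum (λ k → B k i * L k i) ≈ 1#
      complete-other : ∀ {i j} → j ≢ i → sum (λ k → B k i * L k j) ≈ 0#
      nilpotent      : ∀ k → LocallyNilpotent (linearCombination (B k) partial)

module ℚ-Algebra {c ℓ : Level} (R : CommutativeRing c ℓ) (Q : DifferentialAlgebra.Reciprocals R) where

  open DifferentialAlgebra R
  open Reciprocals Q

  recip-const : ∀ δ n → act δ (recip n) ≈ 0#
  recip-const δ n = begin
    act δ y  ≈⟨ *-identityʳ _ ⟨
    act δ y * 1#  ≈⟨ *-congˡ (recip-inverse n) ⟨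
    act δ y * (y * m)  ≈⟨ solve 4 (λ d y m e → d :* (y :* m) := y :* (d :* m :+ y :* e) :- y :* y :* e) (act δ y) y m (act δ m) ⟩
    y * (act δ y * m + y * act δ m) - y * y * act δ m
      ≈⟨ +-cong (*-congˡ (trans (sym (leibniz y m)) (trans (cong (recip-inverse n)) 1-homo))) (-‿cong (*-congˡ (ν-homo (suc n)))) ⟩
    y * 0# - y * y * 0#  ≈⟨ solve 1 (λ y → y :* :0 :- y :* y :* :0 := :0) y ⟩
    0#  ∎
    where
    open Derivation δ hiding (act)
    y = recip n
    m = ν (suc n)

  cancel-ν : ∀ n {f g} → ν (suc n) * f ≈ g → f ≈ recip n * g
  cancel-ν n {f} {g} eq = begin
    f  ≈⟨ *-identityˡ f ⟨
    1# * f  ≈⟨ *-congʳ (recip-inverse n) ⟨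
    recip n * ν (suc n) * f  ≈⟨ *-assoc _ _ _ ⟩
    recip n * (ν (suc n) * f)  ≈⟨ *-congˡ eq ⟩
    recip n * g  ∎

  -- A linear form can be cancelled modulo an ideal stable under a locally nilpotent derivation
  -- along which the form has slope 1: applying δ repeatedly to β f ∈ I gives
  -- (n + 1) δⁿ f + β δⁿ⁺¹ f ∈ I, and one descends from δⁿ f = 0.
  module _ {i : Level} {δ : Derivation} {I : Carrier → Set i} (ideal : IsDifferentialIdeal δ I)
           (nilpotent : LocallyNilpotent δ) {β : Carrier} (δβ≈1 : act δ β ≈ 1#) where
    open IsDifferentialIdeal ideal
    open Derivation δ hiding (act)

    private
      ascend : ∀ {f} → I (β * f) → ∀ n →
               I (ν (suc n) * iterate δ n f + β * iterate δ (suc n) f)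
      ascend {f} Iβf zero = resp eq (stable Iβf)
        where
        eq : act δ (β * f) ≈ (1# + 0#) * f + β * act δ f
        eq = begin
          act δ (β * f)  ≈⟨ leibniz β f ⟩
          act δ β * f + β * act δ f  ≈⟨ +-congʳ (*-congʳ δβ≈1) ⟩
          1# * f + β * act δ f  ≈⟨ +-congʳ (*-congʳ (+-identityʳ 1#)) ⟨
          (1# + 0#) * f + β * act δ f  ∎
      ascend {f} Iβf (suc n) = resp eq (stable (ascend Iβf n))
        where
        h = iterate δ n f
        m = ν (suc n)
        eq : act δ (m * h + β * act δ h) ≈ (1# + m) * act δ h + β * act δ (act δ h)
        eq = begin
          act δ (m * h + β * act δ h)  ≈⟨ +-homo _ _ ⟩
          act δ (m * h) + act δ (β * act δ h)  ≈⟨ +-cong (scalar (ν-homo (suc n)) h) (leibniz β (act δ h)) ⟩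
          m * act δ h + (act δ β * act δ h + β * act δ (act δ h))
            ≈⟨ +-congˡ (+-congʳ (*-congʳ δβ≈1)) ⟩
          m * act δ h + (1# * act δ h + β * act δ (act δ h))
            ≈⟨ solve 4 (λ m h b k → m :* h :+ (:1 :* h :+ b :* k) := (:1 :+ m) :* h :+ b :* k) m (act δ h) β (act δ (act δ h)) ⟩
          (1# + m) * act δ h + β * act δ (act δ h)  ∎

      descend : ∀ {f} → I (β * f) → ∀ n → I (iterate δ n f) → I f
      descend Iβf zero    If = If
      descend {f} Iβf (suc n) If = descend Iβf n (resp eq
        (*-closed (recip n) (minus-closed (ascend Iβf n) (*-closed β If))))
        where
        h = iterate δ n f
        k = iterate δ (suc n) f
        eq : recip n * ((ν (suc n) * h + β * k) - β * k) ≈ h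
        eq = sym (cancel-ν n (solve 3 (λ mh b k → mh := (mh :+ b :* k) :- b :* k) (ν (suc n) * h) β k))

    cancel-mod : ∀ {f} → I (β * f) → I f
    cancel-mod {f} Iβf with nilpotent f
    ... | n , δⁿf≈0 = descend Iβf n (resp (sym δⁿf≈0) zero∈)

  nonZeroDivisor : ∀ {δ} → LocallyNilpotent δ → ∀ {β} → act δ β ≈ 1# → NonZeroDivisor β
  nonZeroDivisor {δ} nilpotent δβ≈1 = cancel-mod (zeroIdeal δ) nilpotent δβ≈1

  -- Vanishing orders along α = 0, for a derivation δ transversal to it.
  module _ {δ : Derivation} {α : Carrier} (δα≈1 : act δ α ≈ 1#) (nzd : NonZeroDivisor α) where
    open Derivation δ hiding (act)

    act-α^ : ∀ n → act δ (α ^ suc n) ≈ ν (suc n) * α ^ n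
    act-α^ n = trans (power α n) (*-congˡ (trans (*-congˡ δα≈1) (*-identityʳ _)))

    -- The coefficient h of f = h αⁿ⁺¹ satisfies (n + 1) h αⁿ ≡ δ f modulo αⁿ⁺¹, so α divides it.
    integrate : ∀ n {f} → α ∣ f → α ^ n ∣ act δ f → α ^ suc n ∣ f
    integrate zero    α∣f _ = ∣-respˡ (sym (*-identityʳ α)) α∣f
    integrate (suc n) {f} α∣f α^∣δf@(q , q≈)
      with integrate n α∣f (∣^-weaken (ℕ≤ n) α^∣δf)
      where ℕ≤ : ∀ n → n ℕ.≤ suc n
            ℕ≤ zero = ℕ.z≤n
            ℕ≤ (suc n) = ℕ.s≤s (ℕ≤ n)
    ... | h , h≈ = recip n * (q - act δ h) , (begin
      (recip n * (q - act δ h)) * (α * P)  ≈⟨ solve 4 (λ r q a p → (r :* q) :* (a :* p) := (r :* (a :* q)) :* p) (recip n) (q - act δ h) α P ⟩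
      recip n * (α * (q - act δ h)) * P  ≈⟨ *-congʳ (cancel-ν n νh≈) ⟨
      h * P  ≈⟨ h≈ ⟩
      f  ∎)
      where
      P = α ^ suc n
      νh≈ : ν (suc n) * h ≈ α * (q - act δ h)
      νh≈ = cancel-^ nzd n (begin
        α ^ n * (ν (suc n) * h)  ≈⟨ solve 4 (λ p m h r → p :* (m :* h) := (r :+ h :* (m :* p)) :- r) (α ^ n) (ν (suc n)) h (act δ h * P) ⟩
        (act δ h * P + h * (ν (suc n) * α ^ n)) - act δ h * P
          ≈⟨ +-congʳ (+-congˡ (*-congˡ (act-α^ n))) ⟨
        (act δ h * P + h * act δ P) - act δ h * P  ≈⟨ +-congʳ (leibniz h P) ⟨
        act δ (h * P) - act δ h * P  ≈⟨ +-congʳ (trans (cong h≈) (sym q≈)) ⟩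
        q * (α * α ^ n) - act δ h * (α * α ^ n)
          ≈⟨ solve 4 (λ q a p h → q :* (a :* p) :- h :* (a :* p) := p :* (a :* (q :- h))) q α (α ^ n) (act δ h) ⟩
        α ^ n * (α * (q - act δ h))  ∎)

  -- An invertible element killed by every derivation.
  record IsConstantUnit (a : Carrier) : Set (c ⊔ ℓ) where
    field
      inv      : Carrier
      inverse  : inv * a ≈ 1#
      constant : ∀ δ → act δ a ≈ 0#

  open IsConstantUnit

  1-constantUnit : IsConstantUnit 1#
  1-constantUnit = record
    { inv = 1# ; inverse = *-identityʳ 1# ; constant = Derivation.1-homo }

  ν-constantUnit : ∀ n → IsConstantUnit (ν (suc n))
  ν-constantUnit n = record
    { inv = recip n ; inverse = recip-inverse n ; constant = λ δ → Derivation.ν-homo δ (suc n) }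

  recip-constantUnit : ∀ n → IsConstantUnit (recip n)
  recip-constantUnit n = record
    { inv = ν (suc n) ; inverse = trans (*-comm _ _) (recip-inverse n)
    ; constant = λ δ → recip-const δ n }

  neg-constantUnit : ∀ {a} → IsConstantUnit a → IsConstantUnit (- a)
  neg-constantUnit {a} u = record
    { inv      = - inv u
    ; inverse  = trans (solve 2 (λ b a → :- b :* :- a := b :* a) (inv u) a) (inverse u)
    ; constant = λ δ → trans (Derivation.-‿homo δ a) (trans (-‿cong (constant u δ)) -0#≈0#)
    }

  *-constantUnit : ∀ {a b} → IsConstantUnit a → IsConstantUnit b → IsConstantUnit (a * b)
  *-constantUnit {a} {b} u v = record
    { inv      = inv u * inv v
    ; inverse  = trans (solve 4 (λ x y a b → (x :* y) :* (a :* b) := (x :* a) :* (y :* b)) (inv u) (inv v) a b)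
                   (trans (*-cong (inverse u) (inverse v)) (*-identityʳ 1#))
    ; constant = λ δ → trans (Derivation.leibniz δ a b)
                   (trans (+-cong (*-congʳ (constant u δ)) (*-congˡ (constant v δ)))
                     (solve 2 (λ a b → :0 :* b :+ a :* :0 := :0) a b))
    }

  -- f ≡ a αⁿ r modulo αⁿ⁺¹.
  infixr 4 _,_
  record LeadingTerm (α : Carrier) (n : ℕ) (a r f : Carrier) : Set (c ⊔ ℓ) where
    constructor _,_
    field
      remainder : Carrier
      expansion : f ≈ α ^ n * (a * r + α * remainder)

  leadingTerm⇒∣ : ∀ {α n a r f} → LeadingTerm α n a r f → α ^ n ∣ f
  leadingTerm⇒∣ (g , f≈) = _ , trans (*-comm _ _) (sym f≈)

  -- If δ f leads with a αⁿ r, then f leads with a αⁿ⁺¹ r / (n + 1): subtract this term from f and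
  -- apply integrate to the difference.
  leadingTerm-integrate : ∀ {δ α n a r f} → act δ α ≈ 1# → NonZeroDivisor α →
    IsConstantUnit a → α ∣ f → LeadingTerm α n a r (act δ f) →
    LeadingTerm α (suc n) (recip n * a) r f
  leadingTerm-integrate {δ} {α} {n} {a} {r} {f} δα≈1 nzd unit α∣f (g , δf≈)
    = extract (integrate {δ} δα≈1 nzd (suc n) α∣f′ α^∣δf′)
    where
    open Derivation δ hiding (act)
    b = recip n * a
    f′ = f - α ^ suc n * (b * r)
    α∣f′ : α ∣ f′
    α∣f′ = ∣-- α∣f (α ^ n * (b * r) , solve 3 (λ p x a → (p :* x) :* a := (a :* p) :* x) (α ^ n) (b * r) α)
    b′≈0 : act δ b ≈ 0#
    b′≈0 = constant (*-constantUnit (recip-constantUnit n) unit) δ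
    νb≈a : ν (suc n) * b ≈ a
    νb≈a = trans (solve 3 (λ m r a → m :* (r :* a) := (r :* m) :* a) (ν (suc n)) (recip n) a)
             (trans (*-congʳ (recip-inverse n)) (*-identityˡ a))
    α^∣δf′ : α ^ suc n ∣ act δ f′
    α^∣δf′ = g - b * act δ r , (begin
      (g - b * act δ r) * (α * α ^ n)
        ≈⟨ solve 6 (λ g b r′ α p ar → (g :- b :* r′) :* (α :* p)
              := p :* (ar :+ α :* g) :- (p :* ar :+ (α :* p) :* (b :* r′))) g b (act δ r) α (α ^ n) (a * r) ⟩
      α ^ n * (a * r + α * g) - (α ^ n * (a * r) + α ^ suc n * (b * act δ r))
        ≈⟨ +-cong (sym δf≈) (-‿cong (+-congʳ (trans (*-congˡ (*-congʳ (sym νb≈a)))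
             (solve 4 (λ p m b r → p :* ((m :* b) :* r) := (m :* p) :* (b :* r)) (α ^ n) (ν (suc n)) b r)))) ⟩
      act δ f - ((ν (suc n) * α ^ n) * (b * r) + α ^ suc n * (b * act δ r))
        ≈⟨ +-congˡ (-‿cong (+-cong (*-congʳ (act-α^ {δ} δα≈1 nzd n)) (*-congˡ (scalar b′≈0 r)))) ⟨
      act δ f - (act δ (α ^ suc n) * (b * r) + α ^ suc n * act δ (b * r))
        ≈⟨ +-congˡ (-‿cong (leibniz _ _)) ⟨
      act δ f - act δ (α ^ suc n * (b * r))
        ≈⟨ sub-homo _ _ ⟨
      act δ f′ ∎)
    extract : α ^ suc (suc n) ∣ f′ → LeadingTerm α (suc n) b r f
    extract (q , q≈) = q , (begin
      f  ≈⟨ solve 2 (λ f x → f := (f :- x) :+ x) f (α ^ suc n * (b * r)) ⟩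
      f - α ^ suc n * (b * r) + α ^ suc n * (b * r)  ≈⟨ +-congʳ q≈ ⟨
      q * (α * α ^ suc n) + α ^ suc n * (b * r)
        ≈⟨ solve 4 (λ q α p x → q :* (α :* p) :+ p :* x := p :* (x :+ α :* q)) q α (α ^ suc n) (b * r) ⟩
      α ^ suc n * (b * r + α * q)  ∎)

  -- A derivation lowers the exponent of α by at most one.
  act-∣ : ∀ δ {α} n {f} → α ^ suc n ∣ f → α ^ n ∣ act δ f
  act-∣ δ {α} n {f} (q , q≈) = act δ q * α + q * (ν (suc n) * act δ α) , (begin
    (act δ q * α + q * (ν (suc n) * act δ α)) * α ^ n
      ≈⟨ solve 6 (λ q′ α q m α′ p → (q′ :* α :+ q :* (m :* α′)) :* p := q′ :* (α :* p) :+ q :* (m :* (p :* α′))) (act δ q) α q (ν (suc n)) (act δ α) (α ^ n) ⟩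
    act δ q * (α * α ^ n) + q * (ν (suc n) * (α ^ n * act δ α))  ≈⟨ +-congˡ (*-congˡ (Derivation.power δ α n)) ⟨
    act δ q * α ^ suc n + q * act δ (α ^ suc n)  ≈⟨ Derivation.leibniz δ q _ ⟨
    act δ (q * α ^ suc n)  ≈⟨ Derivation.cong δ q≈ ⟩
    act δ f  ∎)

  -- Conversely, if f = αⁿ⁺¹ (a r + …) and δ f is still divisible by αⁿ⁺¹, then δ α vanishes on
  -- α = 0, provided that r can be cancelled modulo α.
  leadingTerm-tangent : ∀ δ {α n a r f} → NonZeroDivisor α → IsConstantUnit a →
    (∀ {h} → α ∣ r * h → α ∣ h) →
    LeadingTerm α (suc n) a r f → α ^ suc n ∣ act δ f → α ∣ act δ α
  leadingTerm-tangent δ {α} {n} {a} {r} {f} nzd unit cancel-r (g , f≈) (q , q≈) =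
    cancel-r (recip n * (inv unit * (q - act δ w)) - inv unit * (g * act δ α) , (begin
      (recip n * (inv unit * (q - act δ w)) - inv unit * (g * act δ α)) * α
        ≈⟨ solve 6 (λ r v x g d α → (r :* (v :* x) :- v :* (g :* d)) :* α
              := v :* (r :* (α :* x) :- (α :* g) :* d)) (recip n) (inv unit) (q - act δ w) g (act δ α) α ⟩
      inv unit * (recip n * (α * (q - act δ w)) - (α * g) * act δ α)
        ≈⟨ *-congˡ (+-congʳ (cancel-ν n key)) ⟨
      inv unit * (act δ α * w - (α * g) * act δ α)
        ≈⟨ solve 5 (λ v d a r αg → v :* (d :* (a :* r :+ αg) :- αg :* d) := (v :* a) :* (r :* d)) (inv unit) (act δ α) a r (α * g) ⟩
      (inv unit * a) * (r * act δ α)  ≈⟨ trans (*-congʳ (inverse unit)) (*-identityˡ _) ⟩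
      r * act δ α ∎))
    where
    open Derivation δ hiding (act)
    w = a * r + α * g
    key : ν (suc n) * (act δ α * w) ≈ α * (q - act δ w)
    key = cancel-^ nzd n (begin
      α ^ n * (ν (suc n) * (act δ α * w))
        ≈⟨ solve 5 (λ p m d w x → p :* (m :* (d :* w)) := ((m :* (p :* d)) :* w :+ x) :- x) (α ^ n) (ν (suc n)) (act δ α) w (α ^ suc n * act δ w) ⟩
      (ν (suc n) * (α ^ n * act δ α)) * w + α ^ suc n * act δ w - α ^ suc n * act δ w
        ≈⟨ +-congʳ (+-congʳ (*-congʳ (power α n))) ⟨
      act δ (α ^ suc n) * w + α ^ suc n * act δ w - α ^ suc n * act δ w
        ≈⟨ +-congʳ (trans (sym (leibniz _ w)) (trans (cong (sym f≈)) (sym q≈))) ⟩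
      q * (α * α ^ n) - α * α ^ n * act δ w
        ≈⟨ solve 4 (λ q a p w → q :* (a :* p) :- a :* p :* w := p :* (a :* (q :- w))) q α (α ^ n) (act δ w) ⟩
      α ^ n * (α * (q - act δ w)) ∎)

-- Integrals of products of linear forms

-- The number of occurrences of a letter in a word.
count : ∀ {d} → List (Fin d) → Fin d → ℕ
count []      j = 0
count (k ∷ w) j with k Fin.≟ j
... | yes _ = suc (count w j)
... | no  _ = count w j

count-same : ∀ {d} (k : Fin d) w → count (k ∷ w) k ≡ suc (count w k)
count-same k w with k Fin.≟ k
... | yes _  = ≡.refl
... | no k≢k = contradiction ≡.refl k≢k

count-other : ∀ {d} {k j : Fin d} w → k ≢ j → count (k ∷ w) j ≡ count w j
count-other {k = k} {j} w k≢j with k Fin.≟ j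
... | yes k≡j = contradiction k≡j k≢j
... | no _    = ≡.refl

count-∷ : ∀ {d} (k : Fin d) w j → count w j ℕ.≤ count (k ∷ w) j
count-∷ k w j with k Fin.≟ j
... | yes _ = ℕ.n≤1+n _
... | no  _ = ℕ.≤-refl

module Coordinates {c ℓ : Level} (R : CommutativeRing c ℓ) (Q : DifferentialAlgebra.Reciprocals R)
  {d : ℕ} (C : DifferentialAlgebra.CoordinateSystem R d) where

  open DifferentialAlgebra R
  open Reciprocals Q
  open CoordinateSystem C
  open ℚ-Algebra R Q

  -- The vertices of the simplex: the origin, and one vertex for each coordinate.
  Vertex : Set
  Vertex = Maybe (Fin d)

  -- Extension of a family of values on the coordinates by 0 at the origin.
  atVertex : Vector Carrier d → Vertex → Carrier
  atVertex f = maybe′ f 0#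

  -- The linear form of a vertex; the planes of the arrangement are u y = u z.
  u : Vertex → Carrier
  u = atVertex x

  -- The exponents of the integrand at the vertices; the exponent at the origin is 0.
  countᵛ : List (Fin d) → Vertex → ℕ
  countᵛ w = maybe′ (count w) 0

  ∂u-other : ∀ {k} y → y ≢ just k → act (∂ˣ k) (u y) ≈ 0#
  ∂u-other nothing  _     = Derivation.0-homo (∂ˣ _)
  ∂u-other (just j) y≢k   = ∂x-other λ k≡j → y≢k (≡.cong just (≡.sym k≡j))

  -- The derivation Σⱼ φⱼ ∂ⱼ.
  combine : Vector Carrier d → Derivation
  combine φ = linearCombination φ ∂ˣ

  combine-x : ∀ φ i → act (combine φ) (x i) ≈ φ i
  combine-x φ i = begin
    sum (λ j → φ j * act (∂ˣ j) (x i))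
      ≈⟨ sum-single i (λ j j≢i → trans (*-congˡ (∂x-other j≢i)) (zeroʳ _)) ⟩
    φ i * act (∂ˣ i) (x i)  ≈⟨ *-congˡ (∂x-same i) ⟩
    φ i * 1#  ≈⟨ *-identityʳ _ ⟩
    φ i  ∎

  combine-u : ∀ φ y → act (combine φ) (u y) ≈ atVertex φ y
  combine-u φ nothing  = Derivation.0-homo (combine φ)
  combine-u φ (just i) = combine-x φ i

  -- The Euler derivation Σⱼ xⱼ ∂ⱼ.
  euler : Derivation
  euler = combine x

  -- ψ w y p is the integral of tᵖ ∏ (t − xₖ), k running over the letters of w, from 0 to u y.
  ψ : List (Fin d) → Vertex → ℕ → Carrier
  ψ []      y p = recip p * u y ^ suc p
  ψ (k ∷ w) y p = ψ w y (suc p) - x k * ψ w y p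

  ψ-origin : ∀ w p → ψ w nothing p ≈ 0#
  ψ-origin []      p = solve 2 (λ r q → r :* (:0 :* q) := :0) (recip p) (0# ^ p)
  ψ-origin (k ∷ w) p = trans (+-cong (ψ-origin w (suc p)) (-‿cong (*-congˡ (ψ-origin w p))))
    (solve 1 (λ a → :0 :- a :* :0 := :0) (x k))

  act-ψ[] : ∀ δ y p → act δ (ψ [] y p) ≈ u y ^ p * act δ (u y)
  act-ψ[] δ y p = begin
    act δ (recip p * u y ^ suc p)  ≈⟨ scalar (recip-const δ p) _ ⟩
    recip p * act δ (u y ^ suc p)  ≈⟨ *-congˡ (power (u y) p) ⟩
    recip p * (ν (suc p) * (u y ^ p * act δ (u y)))  ≈⟨ cancel-ν p refl ⟨
    u y ^ p * act δ (u y)  ∎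
    where open Derivation δ hiding (act)

  -- Adding the letter k changes the exponent at j by the Kronecker delta ∂ⱼ xₖ.
  ν-count : ∀ k w j → ν (count (k ∷ w) j) ≈ act (∂ˣ j) (x k) + ν (count w j)
  ν-count k w j with k Fin.≟ j
  ... | yes ≡.refl = +-congʳ (sym (∂x-same k))
  ... | no  k≢j    = trans (sym (+-identityˡ _)) (+-congʳ (sym (∂x-other (k≢j ∘ ≡.sym))))

  -- Both sides vanish unless y is the j-th vertex.
  slope : ∀ j y → u y * act (∂ˣ j) (u y) ≈ x j * act (∂ˣ j) (u y)
  slope j nothing  = trans (*-congˡ 0′) (trans (zeroʳ _) (sym (trans (*-congˡ 0′) (zeroʳ _))))
    where 0′ = Derivation.0-homo (∂ˣ j)
  slope j (just k) with j Fin.≟ k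
  ... | yes ≡.refl = refl
  ... | no  j≢k    = trans (*-congˡ (∂x-other j≢k))
    (trans (zeroʳ _) (sym (trans (*-congˡ (∂x-other j≢k)) (zeroʳ _))))

  -- Integration by parts: the derivative of the factor (t − xⱼ)ᵃ along ∂ⱼ is −a (t − xⱼ)ᵃ⁻¹, and
  -- t (t − xⱼ)ᵃ⁻¹ = (t − xⱼ)ᵃ + xⱼ (t − xⱼ)ᵃ⁻¹.
  ψ-raise : ∀ w j y p →
    act (∂ˣ j) (ψ w y (suc p)) ≈ x j * act (∂ˣ j) (ψ w y p) - ν (count w j) * ψ w y p

  -- The effect on the partial derivatives of a further factor t − xₖ of the integrand.
  ψ-contiguity : ∀ w k j y p → act (∂ˣ j) (ψ (k ∷ w) y p) ≈
    (x j - x k) * act (∂ˣ j) (ψ w y p) - ν (count (k ∷ w) j) * ψ w y p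
  ψ-contiguity w k j y p = begin
    act δ (ψ w y (suc p) - x k * F)  ≈⟨ sub-homo _ _ ⟩
    act δ (ψ w y (suc p)) - act δ (x k * F)
      ≈⟨ +-cong (ψ-raise w j y p) (-‿cong (leibniz (x k) F)) ⟩
    x j * act δ F - a * F - (act δ (x k) * F + x k * act δ F)
      ≈⟨ solve 6 (λ xj xk F′ F a e → xj :* F′ :- a :* F :- (e :* F :+ xk :* F′)
            := (xj :- xk) :* F′ :- (e :+ a) :* F) (x j) (x k) (act δ F) F a (act δ (x k)) ⟩
    (x j - x k) * act δ F - (act δ (x k) + a) * F
      ≈⟨ +-congˡ (-‿cong (*-congʳ (ν-count k w j))) ⟨
    (x j - x k) * act δ F - ν (count (k ∷ w) j) * F  ∎
    where
    δ = ∂ˣ j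
    open Derivation δ hiding (act)
    F = ψ w y p
    a = ν (count w j)

  ψ-raise [] j y p = begin
    act (∂ˣ j) (ψ [] y (suc p))  ≈⟨ act-ψ[] (∂ˣ j) y (suc p) ⟩
    (u y * u y ^ p) * e  ≈⟨ solve 3 (λ u q e → u :* q :* e := q :* (u :* e)) (u y) (u y ^ p) e ⟩
    u y ^ p * (u y * e)  ≈⟨ *-congˡ (slope j y) ⟩
    u y ^ p * (x j * e)  ≈⟨ solve 4 (λ q x e F → q :* (x :* e) := x :* (q :* e) :- :0 :* F) (u y ^ p) (x j) e F ⟩
    x j * (u y ^ p * e) - 0# * F  ≈⟨ +-congʳ (*-congˡ (act-ψ[] (∂ˣ j) y p)) ⟨
    x j * act (∂ˣ j) (ψ [] y p) - 0# * F  ∎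
    where
    e = act (∂ˣ j) (u y)
    F = ψ [] y p
  ψ-raise (k ∷ w) j y p = begin
    act δ (ψ (k ∷ w) y (suc p))  ≈⟨ ψ-contiguity w k j y (suc p) ⟩
    (x j - x k) * act δ G - c′ * G  ≈⟨ +-cong (*-congˡ (ψ-raise w j y p)) refl ⟩
    (x j - x k) * (x j * act δ F - a * F) - c′ * G
      ≈⟨ solve 7 (λ xj xk F′ F G a c → (xj :- xk) :* (xj :* F′ :- a :* F) :- c :* G
            := xj :* ((xj :- xk) :* F′ :- c :* F) :- c :* (G :- xk :* F) :+ (xj :- xk) :* (c :- a) :* F)
           (x j) (x k) (act δ F) F G a c′ ⟩
    x j * ((x j - x k) * act δ F - c′ * F) - c′ * (G - x k * F) + (x j - x k) * (c′ - a) * F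
      ≈⟨ +-cong (+-congʳ (*-congˡ (sym (ψ-contiguity w k j y p)))) (trans (*-congʳ vanish) (zeroˡ F)) ⟩
    x j * act δ (ψ (k ∷ w) y p) - c′ * ψ (k ∷ w) y p + 0#  ≈⟨ +-identityʳ _ ⟩
    x j * act δ (ψ (k ∷ w) y p) - c′ * ψ (k ∷ w) y p  ∎
    where
    δ  = ∂ˣ j
    F  = ψ w y p
    G  = ψ w y (suc p)
    a  = ν (count w j)
    c′ = ν (count (k ∷ w) j)
    vanish : (x j - x k) * (c′ - a) ≈ 0#
    vanish = begin
      (x j - x k) * (c′ - a)  ≈⟨ *-congˡ (+-congʳ (ν-count k w j)) ⟩
      (x j - x k) * ((e + a) - a)  ≈⟨ solve 4 (λ xj xk e a → (xj :- xk) :* ((e :+ a) :- a) := xj :* e :- xk :* e) (x j) (x k) e a ⟩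
      x j * e - x k * e  ≈⟨ +-congˡ (-‿cong (slope j (just k))) ⟩
      x j * e - x j * e  ≈⟨ -‿inverseʳ _ ⟩
      0#  ∎
      where e = act δ (x k)

  -- ψ w y p is homogeneous of degree |w| + p + 1.
  ψ-euler : ∀ E → (∀ k → act E (x k) ≈ x k) → ∀ w y p →
    act E (ψ w y p) ≈ ν (suc (length w ℕ.+ p)) * ψ w y p
  ψ-euler E Ex [] y p = begin
    act E (ψ [] y p)  ≈⟨ act-ψ[] E y p ⟩
    u y ^ p * act E (u y)  ≈⟨ *-congˡ (Eu y) ⟩
    u y ^ p * u y  ≈⟨ *-comm _ _ ⟩
    u y ^ suc p  ≈⟨ *-identityˡ _ ⟨
    1# * u y ^ suc p  ≈⟨ *-congʳ (trans (*-comm _ _) (recip-inverse p)) ⟨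
    ν (suc p) * recip p * u y ^ suc p  ≈⟨ *-assoc _ _ _ ⟩
    ν (suc p) * ψ [] y p  ∎
    where
    Eu : ∀ y → act E (u y) ≈ u y
    Eu nothing  = Derivation.0-homo E
    Eu (just k) = Ex k
  ψ-euler E Ex (k ∷ w) y p = begin
    act E (G - x k * F)  ≈⟨ sub-homo G (x k * F) ⟩
    act E G - act E (x k * F)  ≈⟨ +-cong (ψ-euler E Ex w y (suc p)) (-‿cong (leibniz (x k) F)) ⟩
    ν (suc (length w ℕ.+ suc p)) * G - (act E (x k) * F + x k * act E F)
      ≈⟨ +-cong (*-congʳ (reflexive (≡.cong (λ n → ν (suc n)) (ℕ.+-suc (length w) p))))
           (-‿cong (+-cong (*-congʳ (Ex k)) (*-congˡ (ψ-euler E Ex w y p)))) ⟩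
    (1# + n) * G - (x k * F + x k * (n * F))
      ≈⟨ solve 4 (λ n G x F → (:1 :+ n) :* G :- (x :* F :+ x :* (n :* F)) := (:1 :+ n) :* (G :- x :* F)) n G (x k) F ⟩
    (1# + n) * (G - x k * F)  ∎
    where
    open Derivation E hiding (act)
    F = ψ w y p
    G = ψ w y (suc p)
    n = ν (suc (length w ℕ.+ p))

  ^-difference : ∀ a b n → a - b ∣ a ^ n - b ^ n
  ^-difference a b zero    = 0# , solve 2 (λ a b → :0 :* (a :- b) := :1 :- :1) a b
  ^-difference a b (suc n) with ^-difference a b n
  ... | q , q≈ = a ^ n + b * q , (begin
    (a ^ n + b * q) * (a - b)  ≈⟨ solve 4 (λ a b p q → (p :+ b :* q) :* (a :- b) := (a :- b) :* p :+ b :* (q :* (a :- b))) a b (a ^ n) q ⟩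
    (a - b) * a ^ n + b * (q * (a - b))  ≈⟨ +-congˡ (*-congˡ q≈) ⟩
    (a - b) * a ^ n + b * (a ^ n - b ^ n)  ≈⟨ solve 4 (λ a b p q → (a :- b) :* p :+ b :* (p :- q) := a :* p :- b :* q) a b (a ^ n) (b ^ n) ⟩
    a * a ^ n - b * b ^ n  ∎)

  leadingTerm-resp : ∀ {α n a r f g} → f ≈ g → LeadingTerm α n a r f → LeadingTerm α n a r g
  leadingTerm-resp f≈g (h , h≈) = h , trans (sym f≈g) h≈

  leadingTerm-scale : ∀ {α n a r f} b → LeadingTerm α n a r f → LeadingTerm α n (b * a) r (b * f)
  leadingTerm-scale {α} {n} {a} {r} {f} b (g , f≈) = b * g , trans (*-congˡ f≈)
    (solve 6 (λ b p a r α g → b :* (p :* (a :* r :+ α :* g)) := p :* (b :* a :* r :+ α :* (b :* g))) b (α ^ n) a r α g)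

  -- The plane α = 0 through the i-th vertex and the vertex y.
  module Plane (i : Fin d) (y : Vertex) (y≢i : y ≢ just i) where

    α : Carrier
    α = x i - u y

    ∂α-tail : act (∂ˣ i) α ≈ 1#
    ∂α-tail = begin
      act (∂ˣ i) (x i - u y)  ≈⟨ sub-homo _ _ ⟩
      act (∂ˣ i) (x i) - act (∂ˣ i) (u y)  ≈⟨ +-cong (∂x-same i) (-‿cong (∂u-other y y≢i)) ⟩
      1# - 0#  ≈⟨ solve 0 (:1 :- :0 := :1) ⟩
      1#  ∎
      where open Derivation (∂ˣ i)

    ∂α-head : ∀ {k} → y ≡ just k → act (negation (∂ˣ k)) α ≈ 1#
    ∂α-head {k} ≡.refl = begin
      - act (∂ˣ k) (x i - x k)  ≈⟨ -‿cong (sub-homo _ _) ⟩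
      - (act (∂ˣ k) (x i) - act (∂ˣ k) (x k))  ≈⟨ -‿cong (+-cong (∂x-other (λ k≡i → y≢i (≡.cong just k≡i))) (-‿cong (∂x-same k))) ⟩
      - (0# - 1#)  ≈⟨ solve 0 (:- (:0 :- :1) := :1) ⟩
      1#  ∎
      where open Derivation (∂ˣ k)

    ∂α-off : ∀ {k} → k ≢ i → y ≢ just k → act (∂ˣ k) α ≈ 0#
    ∂α-off {k} k≢i y≢k = begin
      act (∂ˣ k) (x i - u y)  ≈⟨ sub-homo _ _ ⟩
      act (∂ˣ k) (x i) - act (∂ˣ k) (u y)  ≈⟨ +-cong (∂x-other k≢i) (-‿cong (∂u-other y y≢k)) ⟩
      0# - 0#  ≈⟨ -‿inverseʳ _ ⟩
      0#  ∎
      where open Derivation (∂ˣ k)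

    α-nzd : NonZeroDivisor α
    α-nzd = nonZeroDivisor (nilpotent i) ∂α-tail

    -- The integral from u y to xᵢ.
    difference : List (Fin d) → ℕ → Carrier
    difference w p = ψ w (just i) p - ψ w y p

    α∣difference : ∀ w p → α ∣ difference w p
    α∣difference []      p = ∣-respʳ
      (solve 3 (λ r a b → r :* (a :- b) := r :* a :- r :* b) (recip p) (x i ^ suc p) (u y ^ suc p))
      (∣-*ˡ (recip p) (^-difference (x i) (u y) (suc p)))
    α∣difference (k ∷ w) p = ∣-respʳ
      (solve 5 (λ a b x c e → (a :- b) :- x :* (c :- e) := (a :- x :* c) :- (b :- x :* e)) _ _ (x k) _ _)
      (∣-- (α∣difference w (suc p)) (∣-*ˡ (x k) (α∣difference w p)))

    -- The cofactor of the power of α in ∏ (t − xₖ), at t = xᵢ and up to sign.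
    cofactor : List (Fin d) → Carrier
    cofactor []      = 1#
    cofactor (k ∷ w) with k Fin.≟ i | Maybe.≡-dec Fin._≟_ y (just k)
    ... | no _ | no _ = (x k - x i) * cofactor w
    ... | _    | _    = cofactor w

    cofactor-skip : ∀ {k} w → k ≡ i ⊎ y ≡ just k → cofactor (k ∷ w) ≡ cofactor w
    cofactor-skip {k} w skip with k Fin.≟ i | Maybe.≡-dec Fin._≟_ y (just k)
    ... | yes _  | yes _  = ≡.refl
    ... | yes _  | no _   = ≡.refl
    ... | no _   | yes _  = ≡.refl
    ... | no k≢i | no y≢k = contradiction skip λ { (inj₁ k≡i) → k≢i k≡i ; (inj₂ y≡k) → y≢k y≡k }

    cofactor-step : ∀ {k} w → k ≢ i → y ≢ just k → cofactor (k ∷ w) ≡ (x k - x i) * cofactor w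
    cofactor-step {k} w k≢i y≢k with k Fin.≟ i | Maybe.≡-dec Fin._≟_ y (just k)
    ... | yes k≡i | _       = contradiction k≡i k≢i
    ... | no _    | yes y≡k = contradiction y≡k y≢k
    ... | no _    | no _    = ≡.refl

    cofactor-cancel : ∀ w {h} → α ∣ cofactor w * h → α ∣ h
    cofactor-cancel []      α∣h = ∣-respʳ (*-identityˡ _) α∣h
    cofactor-cancel (k ∷ w) α∣h with k Fin.≟ i | Maybe.≡-dec Fin._≟_ y (just k)
    ... | yes _  | yes _  = cofactor-cancel w α∣h
    ... | yes _  | no _   = cofactor-cancel w α∣h
    ... | no _   | yes _  = cofactor-cancel w α∣h
    ... | no k≢i | no y≢k = cofactor-cancel w
      (cancel-mod (principal (∂ˣ k) (∂α-off k≢i y≢k)) (nilpotent k) slope-1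
        (∣-respʳ (*-assoc _ _ _) α∣h))
      where
      open Derivation (∂ˣ k)
      slope-1 : act (∂ˣ k) (x k - x i) ≈ 1#
      slope-1 = begin
        act (∂ˣ k) (x k - x i)  ≈⟨ sub-homo _ _ ⟩
        act (∂ˣ k) (x k) - act (∂ˣ k) (x i)  ≈⟨ +-cong (∂x-same k) (-‿cong (∂x-other k≢i)) ⟩
        1# - 0#  ≈⟨ solve 0 (:1 :- :0 := :1) ⟩
        1#  ∎

    -- The multiplicity of the plane for the exponents counted by w.
    exponent : List (Fin d) → ℕ
    exponent w = count w i ℕ.+ countᵛ w y

    exponent-[] : exponent [] ≡ 0
    exponent-[] = other y
      where
      other : ∀ y → countᵛ [] y ≡ 0
      other nothing  = ≡.refl
      other (just _) = ≡.refl

    exponent-tail : ∀ w → exponent (i ∷ w) ≡ suc (exponent w)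
    exponent-tail w = ≡.cong₂ ℕ._+_ (count-same i w) (other y y≢i)
      where
      other : ∀ y → y ≢ just i → countᵛ (i ∷ w) y ≡ countᵛ w y
      other nothing  _   = ≡.refl
      other (just k) y≢i = count-other w λ i≡k → y≢i (≡.cong just (≡.sym i≡k))

    exponent-head : ∀ {k} w → y ≡ just k → exponent (k ∷ w) ≡ suc (exponent w)
    exponent-head {k} w ≡.refl = ≡.trans
      (≡.cong₂ ℕ._+_ (count-other w λ k≡i → y≢i (≡.cong just k≡i)) (count-same k w))
      (ℕ.+-suc (count w i) (count w k))

    exponent-off : ∀ {k} w → k ≢ i → y ≢ just k → exponent (k ∷ w) ≡ exponent w
    exponent-off {k} w k≢i y≢k = ≡.cong₂ ℕ._+_ (count-other w k≢i) (other y y≢k)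
      where
      other : ∀ y → y ≢ just k → countᵛ (k ∷ w) y ≡ countᵛ w y
      other nothing  _   = ≡.refl
      other (just j) y≢k = count-other w λ k≡j → y≢k (≡.cong just (≡.sym k≡j))

    -- The factor t − xₖ of the integrand kills the boundary terms of the derivative along ∂ₖ.
    act-difference : ∀ k w p → act (∂ˣ k) (difference (k ∷ w) p) ≈ - ν (count (k ∷ w) k) * difference w p
    act-difference k w p = begin
      act (∂ˣ k) (ψ (k ∷ w) (just i) p - ψ (k ∷ w) y p)  ≈⟨ sub-homo _ _ ⟩
      act (∂ˣ k) (ψ (k ∷ w) (just i) p) - act (∂ˣ k) (ψ (k ∷ w) y p)
        ≈⟨ +-cong (ψ-contiguity w k k (just i) p) (-‿cong (ψ-contiguity w k k y p)) ⟩
      ((x k - x k) * a - n * f) - ((x k - x k) * b - n * g)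
        ≈⟨ solve 6 (λ x a b n f g → ((x :- x) :* a :- n :* f) :- ((x :- x) :* b :- n :* g)
             := :- n :* (f :- g)) (x k) a b n f g ⟩
      - n * difference w p ∎
      where
      open Derivation (∂ˣ k) using (sub-homo)
      n = ν (count (k ∷ w) k)
      f = ψ w (just i) p
      g = ψ w y p
      a = act (∂ˣ k) f
      b = act (∂ˣ k) g

    -- The leading term of all the integrals with powers tᵖ. The constant factor, which does not
    -- depend on p, is a beta value up to sign; only its being an invertible constant matters.
    record Leads (n : ℕ) (r : Carrier) (w : List (Fin d)) : Set (c ⊔ ℓ) where
      constructor leads
      field
        constantFactor : Carrier
        constantUnit   : IsConstantUnit constantFactor
        leadingTerm    : ∀ p → LeadingTerm α (suc n) constantFactor (r * x i ^ p) (difference w p)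

    leads-[] : Leads 0 1# []
    leads-[] = leads (recip 0 * 1#) (*-constantUnit (recip-constantUnit 0) 1-constantUnit)
      λ p → leadingTerm-integrate {∂ˣ i} ∂α-tail α-nzd 1-constantUnit (α∣difference [] p) (0# , base p)
      where
      base : ∀ p → act (∂ˣ i) (difference [] p) ≈ 1# * (1# * (1# * x i ^ p) + α * 0#)
      base p = begin
        act (∂ˣ i) (ψ [] (just i) p - ψ [] y p)
          ≈⟨ Derivation.sub-homo (∂ˣ i) _ _ ⟩
        act (∂ˣ i) (ψ [] (just i) p) - act (∂ˣ i) (ψ [] y p)
          ≈⟨ +-cong (act-ψ[] (∂ˣ i) (just i) p) (-‿cong (act-ψ[] (∂ˣ i) y p)) ⟩
        x i ^ p * act (∂ˣ i) (x i) - u y ^ p * act (∂ˣ i) (u y)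
          ≈⟨ +-cong (*-congˡ (∂x-same i)) (-‿cong (*-congˡ (∂u-other y y≢i))) ⟩
        x i ^ p * 1# - u y ^ p * 0#
          ≈⟨ solve 3 (λ q r α → q :* :1 :- r :* :0 := :1 :* (:1 :* (:1 :* q) :+ α :* :0)) (x i ^ p) (u y ^ p) α ⟩
        1# * (1# * (1# * x i ^ p) + α * 0#) ∎

    count-constantUnit : ∀ (k : Fin d) w → IsConstantUnit (ν (count (k ∷ w) k))
    count-constantUnit k w rewrite count-same k w = ν-constantUnit (count w k)

    leads-tail : ∀ {n r} w → Leads n r w → Leads (suc n) r (i ∷ w)
    leads-tail {n} w (leads a unit lead) =
      leads (recip (suc n) * (- m * a)) (*-constantUnit (recip-constantUnit _) unit′)
      λ p → leadingTerm-integrate {∂ˣ i} ∂α-tail α-nzd unit′ (α∣difference (i ∷ w) p)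
              (leadingTerm-resp (sym (act-difference i w p)) (leadingTerm-scale (- m) (lead p)))
      where
      m : Carrier
      m = ν (count (i ∷ w) i)
      unit′ : IsConstantUnit (- m * a)
      unit′ = *-constantUnit (neg-constantUnit (count-constantUnit i w)) unit

    leads-head : ∀ {n r} k w → y ≡ just k → Leads n r w → Leads (suc n) r (k ∷ w)
    leads-head {n} k w y≡k (leads a unit lead) =
      leads (recip (suc n) * (m * a)) (*-constantUnit (recip-constantUnit _) unit′)
      λ p → leadingTerm-integrate {negation (∂ˣ k)} (∂α-head y≡k) α-nzd unit′ (α∣difference (k ∷ w) p)
              (leadingTerm-resp (sym (neg-act p)) (leadingTerm-scale m (lead p)))
      where
      m : Carrier
      m = ν (count (k ∷ w) k)
      unit′ : IsConstantUnit (m * a)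
      unit′ = *-constantUnit (count-constantUnit k w) unit
      neg-act : ∀ p → - act (∂ˣ k) (difference (k ∷ w) p) ≈ m * difference w p
      neg-act p = trans (-‿cong (act-difference k w p)) (solve 2 (λ m f → :- (:- m :* f) := m :* f) m _)

    leads-off : ∀ {n r} k w → Leads n r w → Leads n ((x k - x i) * r) (k ∷ w)
    leads-off {n} {r} k w (leads a unit lead) =
      leads (- a) (neg-constantUnit unit) λ p → step p (lead p) (lead (suc p))
      where
      A = α ^ suc n
      step : ∀ p → LeadingTerm α (suc n) a (r * x i ^ p) (difference w p) →
             LeadingTerm α (suc n) a (r * x i ^ suc p) (difference w (suc p)) →
             LeadingTerm α (suc n) (- a) ((x k - x i) * r * x i ^ p) (difference (k ∷ w) p)
      step p (g , g≈) (h , h≈) = h - x k * g , (begin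
        difference (k ∷ w) p
          ≈⟨ solve 5 (λ a b x c e → (a :- x :* c) :- (b :- x :* e) := (a :- b) :- x :* (c :- e)) _ _ (x k) _ _ ⟩
        difference w (suc p) - x k * difference w p
          ≈⟨ +-cong h≈ (-‿cong (*-congˡ g≈)) ⟩
        A * (a * (r * (x i * x i ^ p)) + α * h) - x k * (A * (a * (r * x i ^ p) + α * g))
          ≈⟨ solve 9 (λ A a r xi X α h xk g →
               A :* (a :* (r :* (xi :* X)) :+ α :* h) :- xk :* (A :* (a :* (r :* X) :+ α :* g))
               := A :* (:- a :* ((xk :- xi) :* r :* X) :+ α :* (h :- xk :* g)))
               A a r (x i) (x i ^ p) α h (x k) g ⟩
        A * (- a * ((x k - x i) * r * x i ^ p) + α * (h - x k * g)) ∎)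

    -- A letter at an end of the path raises the order by integration; any other letter k
    -- contributes the value xᵢ − xₖ of its factor at the end, up to sign.
    difference-leads : ∀ w → Leads (exponent w) (cofactor w) w
    difference-leads [] = ≡.subst (λ n → Leads n 1# []) (≡.sym exponent-[]) leads-[]
    difference-leads (k ∷ w) = by-cases (k Fin.≟ i) (Maybe.≡-dec Fin._≟_ y (just k))
      where
      change : ∀ {n r} → exponent (k ∷ w) ≡ n → cofactor (k ∷ w) ≡ r → Leads n r (k ∷ w) →
               Leads (exponent (k ∷ w)) (cofactor (k ∷ w)) (k ∷ w)
      change ≡.refl ≡.refl l = l
      by-cases : Dec (k ≡ i) → Dec (y ≡ just k) →
                 Leads (exponent (k ∷ w)) (cofactor (k ∷ w)) (k ∷ w)
      by-cases (yes ≡.refl) _ =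
        change (exponent-tail w) (cofactor-skip w (inj₁ ≡.refl)) (leads-tail w (difference-leads w))
      by-cases (no _) (yes y≡k) =
        change (exponent-head w y≡k) (cofactor-skip w (inj₂ y≡k)) (leads-head k w y≡k (difference-leads w))
      by-cases (no k≢i) (no y≢k) =
        change (exponent-off w k≢i y≢k) (cofactor-step w k≢i y≢k) (leads-off k w (difference-leads w))

    difference-∣ : ∀ w → α ^ suc (exponent w) ∣ difference w 0
    difference-∣ w with difference-leads w
    ... | leads _ _ lead = leadingTerm⇒∣ (lead 0)

    -- A derivation that preserves the order of vanishing of the integral is tangent to the plane.
    difference-tangent : ∀ δ w → α ^ suc (exponent w) ∣ act δ (difference w 0) → α ∣ act δ α
    difference-tangent δ w α∣ with difference-leads w
    ... | leads _ unit lead = leadingTerm-tangent δ α-nzd unit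
      (λ α∣rh → cofactor-cancel w (∣-respʳ (*-congʳ (*-identityʳ _)) α∣rh)) (lead 0) α∣

  -- The values of the universal derivation on the coordinates.
  θ : List (Fin d) → Vector Carrier d
  θ w i = ψ w (just i) 0

  -- f is the vector of values on the coordinates of a derivation that is logarithmic for the
  -- multiplicities count w i on xᵢ = 0 and count w i + count w j on xᵢ = xⱼ.
  Logarithmic : List (Fin d) → Vector Carrier d → Set (c ⊔ ℓ)
  Logarithmic w f = ∀ i y → y ≢ just i →
    (x i - u y) ^ (count w i ℕ.+ countᵛ w y) ∣ f i - atVertex f y

  -- For the empty word, θ takes the value xᵢ on xᵢ, so its partial derivatives form the dual basis.
  θ[] : ∀ φ i → act (combine φ) (θ [] i) ≈ φ i
  θ[] φ i = begin
    act (combine φ) (θ [] i)  ≈⟨ act-ψ[] (combine φ) (just i) 0 ⟩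
    1# * act (combine φ) (x i)  ≈⟨ *-identityˡ _ ⟩
    act (combine φ) (x i)  ≈⟨ combine-x φ i ⟩
    φ i  ∎

  -- The coefficient of θ w, up to sign, when ψ-contiguity is applied to a combination of the partial
  -- derivatives of θ (k ∷ w).
  weight : Fin d → List (Fin d) → Vector Carrier d → Carrier
  weight k w φ = sum λ j → ν (count (k ∷ w) j) * φ j

  -- The change of basis from the partial derivatives of θ (k ∷ w) to those of θ w.
  transfer : Fin d → List (Fin d) → Vector Carrier d → Vector Carrier d
  transfer k w φ j = (x j - x k) * φ j - recip (length w ℕ.+ 0) * weight k w φ * x j

  -- By ψ-contiguity, with θ w expressed through its partial derivatives by Euler's formula.
  act-transfer : ∀ k w φ i →
    act (combine φ) (θ (k ∷ w) i) ≈ act (combine (transfer k w φ)) (θ w i)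
  act-transfer k w φ i = begin
    A  ≈⟨ solve 2 (λ a s → a := (a :+ s) :- s) A (S * F) ⟩
    (A + S * F) - S * F  ≈⟨ +-cong A+SF (-‿cong SF) ⟩
    M - h * act euler F  ≈⟨ +-congʳ B+hE ⟨
    (B + h * act euler F) - h * act euler F  ≈⟨ solve 2 (λ a s → (a :+ s) :- s := a) B (h * act euler F) ⟩
    B  ∎
    where
    F = θ w i
    A = act (combine φ) (θ (k ∷ w) i)
    B = act (combine (transfer k w φ)) F
    S = weight k w φ
    h = recip (length w ℕ.+ 0) * S
    M = sum λ j → (x j - x k) * φ j * act (∂ˣ j) F
    SF : S * F ≈ h * act euler F
    SF = begin
      S * F  ≈⟨ *-congˡ (cancel-ν (length w ℕ.+ 0) refl) ⟩
      S * (recip (length w ℕ.+ 0) * (ν (suc (length w ℕ.+ 0)) * F))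
        ≈⟨ *-congˡ (*-congˡ (ψ-euler euler (combine-x x) w (just i) 0)) ⟨
      S * (recip (length w ℕ.+ 0) * act euler F)  ≈⟨ solve 3 (λ s r e → s :* (r :* e) := r :* s :* e) S _ _ ⟩
      h * act euler F  ∎
    A+SF : A + S * F ≈ M
    A+SF = begin
      A + S * F
        ≈⟨ +-congˡ (*-distribʳ-sum F (λ j → ν (count (k ∷ w) j) * φ j)) ⟩
      A + sum (λ j → ν (count (k ∷ w) j) * φ j * F)
        ≈⟨ ∑-distrib-+ (λ j → φ j * act (∂ˣ j) (θ (k ∷ w) i)) _ ⟨
      sum (λ j → φ j * act (∂ˣ j) (θ (k ∷ w) i) + ν (count (k ∷ w) j) * φ j * F)
        ≈⟨ sum-cong-≋ (λ j → trans (+-congʳ (*-congˡ (ψ-contiguity w k j (just i) 0)))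
             (solve 5 (λ p X d n F → p :* (X :* d :- n :* F) :+ n :* p :* F := X :* p :* d) (φ j) (x j - x k) (act (∂ˣ j) F) (ν (count (k ∷ w) j)) F)) ⟩
      M ∎
    B+hE : B + h * act euler F ≈ M
    B+hE = begin
      B + h * act euler F
        ≈⟨ +-congˡ (*-distribˡ-sum h (λ j → x j * act (∂ˣ j) F)) ⟩
      B + sum (λ j → h * (x j * act (∂ˣ j) F))
        ≈⟨ ∑-distrib-+ (λ j → transfer k w φ j * act (∂ˣ j) F) _ ⟨
      sum (λ j → transfer k w φ j * act (∂ˣ j) F + h * (x j * act (∂ˣ j) F))
        ≈⟨ sum-cong-≋ (λ j → solve 4 (λ X h x d → (X :- h :* x) :* d :+ h :* (x :* d) := X :* d)
             ((x j - x k) * φ j) h (x j) (act (∂ˣ j) F)) ⟩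
      M ∎

  difference-nzd : ∀ {j k} → j ≢ k → NonZeroDivisor (x j - x k)
  difference-nzd {j} {k} j≢k = Plane.α-nzd j (just k) λ { ≡.refl → j≢k ≡.refl }

  x-nzd : ∀ k → NonZeroDivisor (x k)
  x-nzd k = nonZeroDivisor (nilpotent k) (∂x-same k)

  -- The matrix of transfer is injective, so independence is inherited letter by letter.
  partials-independent : ∀ w φ → (∀ i → act (combine φ) (θ w i) ≈ 0#) → ∀ j → φ j ≈ 0#
  partials-independent []      φ φθ≈0 j = trans (sym (θ[] φ j)) (φθ≈0 j)
  partials-independent (k ∷ w) φ φθ≈0   = conclude
    where
    h = recip (length w ℕ.+ 0) * weight k w φ
    transfer≈0 : ∀ j → transfer k w φ j ≈ 0#
    transfer≈0 = partials-independent w (transfer k w φ)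
      λ i → trans (sym (act-transfer k w φ i)) (φθ≈0 i)
    h≈0 : h ≈ 0#
    h≈0 = x-nzd k (begin
      x k * h  ≈⟨ solve 3 (λ x h p → x :* h := :- ((x :- x) :* p :- h :* x)) (x k) h (φ k) ⟩
      - transfer k w φ k  ≈⟨ -‿cong (transfer≈0 k) ⟩
      - 0#  ≈⟨ -0#≈0# ⟩
      0#  ∎)
    off : ∀ {j} → j ≢ k → φ j ≈ 0#
    off {j} j≢k = difference-nzd j≢k (begin
      (x j - x k) * φ j  ≈⟨ solve 3 (λ a h x → a := (a :- h :* x) :+ h :* x) _ h (x j) ⟩
      transfer k w φ j + h * x j  ≈⟨ +-cong (transfer≈0 j) (trans (*-congʳ h≈0) (zeroˡ _)) ⟩
      0# + 0#  ≈⟨ +-identityʳ _ ⟩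
      0#  ∎)
    weight≈0 : weight k w φ ≈ 0#
    weight≈0 = begin
      weight k w φ  ≈⟨ *-identityˡ _ ⟨
      1# * weight k w φ  ≈⟨ *-congʳ (recip-inverse n) ⟨
      recip n * ν (suc n) * weight k w φ  ≈⟨ solve 3 (λ r m s → r :* m :* s := m :* (r :* s)) _ (ν (suc n)) _ ⟩
      ν (suc n) * h  ≈⟨ trans (*-congˡ h≈0) (zeroʳ _) ⟩
      0#  ∎
      where n = length w ℕ.+ 0
    diagonal : φ k ≈ 0#
    diagonal = trans (cancel-ν (count w k) (begin
      ν (suc (count w k)) * φ k  ≈⟨ *-congʳ (reflexive (≡.cong ν (count-same k w))) ⟨
      ν (count (k ∷ w) k) * φ k  ≈⟨ sum-single k {λ j → ν (count (k ∷ w) j) * φ j} (λ j j≢k → trans (*-congˡ (off j≢k)) (zeroʳ _)) ⟨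
      weight k w φ  ≈⟨ weight≈0 ⟩
      0#  ∎)) (zeroʳ _)
    conclude : ∀ j → φ j ≈ 0#
    conclude j with j Fin.≟ k
    ... | yes ≡.refl = diagonal
    ... | no  j≢k    = off j≢k

  -- A preimage under transfer of a vector Φ tangent to the planes through the k-th vertex, where
  -- q = Φₖ / xₖ and qᵒ = (Φₖ − Φⱼ) / (xₖ − xⱼ).
  module TransferOnto (k : Fin d) (w : List (Fin d)) (Φ : Vector Carrier d)
    (q : Carrier) (q≈ : q * x k ≈ Φ k)
    (qᵒ : ∀ {j} → j ≢ k → Carrier) (qᵒ≈ : ∀ {j} (j≢k : j ≢ k) → qᵒ j≢k * (x k - x j) ≈ Φ k - Φ j)
    where

    n : ℕ
    n = length w ℕ.+ 0

    value-off : ∀ j → j ≢ k → Carrier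
    value-off j j≢k = qᵒ j≢k - q

    φ⁰ : Vector Carrier d
    φ⁰ j with j Fin.≟ k
    ... | yes _  = 0#
    ... | no j≢k = value-off j j≢k

    φ⁰-k : φ⁰ k ≈ 0#
    φ⁰-k with k Fin.≟ k
    ... | yes _  = refl
    ... | no k≢k = contradiction ≡.refl k≢k

    -- The diagonal coefficient is chosen so that the weight of φ is −(n + 1) q.
    value-k : Carrier
    value-k = recip (count w k) * (ν (suc n) * - q - weight k w φ⁰)

    φ : Vector Carrier d
    φ j with j Fin.≟ k
    ... | yes _  = value-k
    ... | no j≢k = value-off j j≢k

    φ-k : φ k ≈ value-k
    φ-k with k Fin.≟ k
    ... | yes _  = refl
    ... | no k≢k = contradiction ≡.refl k≢k

    φ-off : ∀ j → j ≢ k → φ j ≈ φ⁰ j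
    φ-off j j≢k with j Fin.≟ k
    ... | yes j≡k = contradiction j≡k j≢k
    ... | no _    = refl

    weight≈ : weight k w φ ≈ ν (suc n) * - q
    weight≈ = begin
      weight k w φ
        ≈⟨ sum-split k {λ j → ν (count (k ∷ w) j) * φ j} {λ j → ν (count (k ∷ w) j) * φ⁰ j}
             (λ j j≢k → *-congˡ (φ-off j j≢k)) (trans (*-congˡ φ⁰-k) (zeroʳ _)) ⟩
      ν (count (k ∷ w) k) * φ k + weight k w φ⁰
        ≈⟨ +-congʳ (*-cong (reflexive (≡.cong ν (count-same k w))) φ-k) ⟩
      ν (suc (count w k)) * value-k + weight k w φ⁰
        ≈⟨ solve 4 (λ m r a s → m :* (r :* (a :- s)) :+ s := (r :* m) :* (a :- s) :+ s) (ν (suc (count w k))) (recip (count w k)) _ (weight k w φ⁰) ⟩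
      (recip (count w k) * ν (suc (count w k))) * (ν (suc n) * - q - weight k w φ⁰) + weight k w φ⁰
        ≈⟨ +-congʳ (trans (*-congʳ (recip-inverse (count w k))) (*-identityˡ _)) ⟩
      (ν (suc n) * - q - weight k w φ⁰) + weight k w φ⁰
        ≈⟨ solve 2 (λ a s → (a :- s) :+ s := a) _ (weight k w φ⁰) ⟩
      ν (suc n) * - q ∎

    h≈ : recip n * weight k w φ ≈ - q
    h≈ = trans (*-congˡ weight≈) (sym (cancel-ν n refl))

    off-diagonal : ∀ j → (x j - x k) * φ j + q * x j ≈ Φ j
    off-diagonal j with j Fin.≟ k
    ... | yes ≡.refl = trans (solve 3 (λ x v q → (x :- x) :* v :+ q :* x := q :* x) (x j) value-k q) q≈
    ... | no j≢k     = begin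
      (x j - x k) * (qⱼ - q) + q * x j  ≈⟨ solve 4 (λ xj xk qj q → (xj :- xk) :* (qj :- q) :+ q :* xj := q :* xk :- qj :* (xk :- xj)) (x j) (x k) qⱼ q ⟩
      q * x k - qⱼ * (x k - x j)  ≈⟨ +-cong q≈ (-‿cong (qᵒ≈ j≢k)) ⟩
      Φ k - (Φ k - Φ j)  ≈⟨ solve 2 (λ a b → a :- (a :- b) := b) (Φ k) (Φ j) ⟩
      Φ j  ∎
      where
      qⱼ : Carrier
      qⱼ = qᵒ j≢k

    transfer≈Φ : ∀ j → transfer k w φ j ≈ Φ j
    transfer≈Φ j = begin
      (x j - x k) * φ j - recip n * weight k w φ * x j  ≈⟨ +-congˡ (-‿cong (*-congʳ h≈)) ⟩
      (x j - x k) * φ j - - q * x j  ≈⟨ solve 3 (λ a q x → a :- :- q :* x := a :+ q :* x) _ q (x j) ⟩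
      (x j - x k) * φ j + q * x j  ≈⟨ off-diagonal j ⟩
      Φ j  ∎

  -- The image of transfer contains every vector tangent to the planes through the k-th vertex.
  transfer-onto : ∀ k w Φ → x k ∣ Φ k → (∀ {j} → j ≢ k → x k - x j ∣ Φ k - Φ j) →
    ∃[ φ ] ∀ j → transfer k w φ j ≈ Φ j
  transfer-onto k w Φ (q , q≈) tangent = φ , transfer≈Φ
    where open TransferOnto k w Φ q q≈ (λ j≢k → quotientOf (tangent j≢k)) (λ j≢k → equalityOf (tangent j≢k))

  logarithmic-weaken : ∀ k w {f} → Logarithmic (k ∷ w) f → Logarithmic w f
  logarithmic-weaken k w log i y y≢i = ∣^-weaken (ℕ.+-mono-≤ (count-∷ k w i) (mono y)) (log i y y≢i)
    where
    mono : ∀ y → countᵛ w y ℕ.≤ countᵛ (k ∷ w) y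
    mono nothing  = ℕ.z≤n
    mono (just j) = count-∷ k w j

  -- If f is logarithmic for k ∷ w, its coefficients Φ with respect to the partial derivatives of θ w
  -- are tangent to the planes through the k-th vertex.
  module _ {k : Fin d} {w : List (Fin d)} {f : Vector Carrier d} (log : Logarithmic (k ∷ w) f)
           (Φ : Vector Carrier d) (Φθ≈f : ∀ i → act (combine Φ) (θ w i) ≈ f i) where

    private
      Φᵈ : Derivation
    Φᵈ = combine Φ

    tangent : ∀ y → y ≢ just k → x k - u y ∣ Φ k - atVertex Φ y
    tangent y y≢k = ∣-respʳ
      (trans (Derivation.sub-homo Φᵈ (x k) (u y)) (+-cong (combine-x Φ k) (-‿cong (combine-u Φ y))))
      (difference-tangent Φᵈ w (∣-respʳ (sym value)
        (≡.subst (λ n → α ^ n ∣ f k - atVertex f y) (exponent-tail w) (log k y y≢k))))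
      where
      open Plane k y y≢k
      at : ∀ y → act Φᵈ (ψ w y 0) ≈ atVertex f y
      at nothing  = trans (Derivation.cong Φᵈ (ψ-origin w 0)) (Derivation.0-homo Φᵈ)
      at (just i) = Φθ≈f i
      value : act Φᵈ (difference w 0) ≈ f k - atVertex f y
      value = trans (Derivation.sub-homo Φᵈ (θ w k) (ψ w y 0)) (+-cong (at (just k)) (-‿cong (at y)))

  partials-span : ∀ w f → Logarithmic w f → ∃[ φ ] ∀ i → act (combine φ) (θ w i) ≈ f i
  partials-span []      f _   = f , θ[] f
  partials-span (k ∷ w) f log = step (partials-span w f (logarithmic-weaken k w log))
    where
    step : (∃[ Φ ] ∀ i → act (combine Φ) (θ w i) ≈ f i) →
           ∃[ φ ] ∀ i → act (combine φ) (θ (k ∷ w) i) ≈ f i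
    step (Φ , Φθ≈f) = finish (transfer-onto k w Φ
        (∣-resp₂ (minus-0 (x k)) (minus-0 (Φ k)) (tangent log Φ Φθ≈f nothing λ ()))
        (λ j≢k → tangent log Φ Φθ≈f (just _) λ { ≡.refl → j≢k ≡.refl }))
      where
      minus-0 : ∀ a → a - 0# ≈ a
      minus-0 = solve 1 (λ a → a :- :0 := a)
      finish : (∃[ φ ] ∀ j → transfer k w φ j ≈ Φ j) →
               ∃[ φ ] ∀ i → act (combine φ) (θ (k ∷ w) i) ≈ f i
      finish (φ , transfer≈Φ) = φ , λ i → begin
        act (combine φ) (θ (k ∷ w) i)  ≈⟨ act-transfer k w φ i ⟩
        act (combine (transfer k w φ)) (θ w i)  ≈⟨ sum-cong-≋ (λ j → *-congʳ (transfer≈Φ j)) ⟩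
        act (combine Φ) (θ w i)  ≈⟨ Φθ≈f i ⟩
        f i  ∎

-- Vanishing along a flat of codimension two

-- The degree of a word in the letters of which each k has degree ω k.
degree : ∀ {d} → (Fin d → ℕ) → List (Fin d) → ℕ
degree ω []      = 0
degree ω (k ∷ W) = ω k ℕ.+ degree ω W

degree-++ : ∀ {d} (ω : Fin d → ℕ) V W → degree ω (V ++ W) ≡ degree ω V ℕ.+ degree ω W
degree-++ ω []      W = ≡.refl
degree-++ ω (k ∷ V) W = ≡.trans (≡.cong (ω k ℕ.+_) (degree-++ ω V W)) (≡.sym (ℕ.+-assoc (ω k) _ _))

degree-replicate : ∀ {d} (ω : Fin d → ℕ) n k → degree ω (replicate n k) ≡ n ℕ.* ω k
degree-replicate ω zero    k = ≡.refl
degree-replicate ω (suc n) k = ≡.cong (ω k ℕ.+_) (degree-replicate ω n k)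

-- The degree function counting the occurrences of the letter i.
indicator : ∀ {d} → Fin d → Fin d → ℕ
indicator i k with k Fin.≟ i
... | yes _ = 1
... | no  _ = 0

indicator-same : ∀ {d} (i : Fin d) → indicator i i ≡ 1
indicator-same i with i Fin.≟ i
... | yes _  = ≡.refl
... | no i≢i = contradiction ≡.refl i≢i

indicator-other : ∀ {d} {i k : Fin d} → k ≢ i → indicator i k ≡ 0
indicator-other {i = i} {k} k≢i with k Fin.≟ i
... | yes k≡i = contradiction k≡i k≢i
... | no _    = ≡.refl

module Necessity {c ℓ : Level} (R : CommutativeRing c ℓ) (Q : DifferentialAlgebra.Reciprocals R)
  {d : ℕ} (C : DifferentialAlgebra.CoordinateSystem R d) where

  open DifferentialAlgebra R
  open Reciprocals Q
  open CoordinateSystem C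
  open ℚ-Algebra R Q
  open Coordinates R Q C using (combine)

  -- The differential operator of a word; its first letter acts first.
  ∂* : List (Fin d) → Carrier → Carrier
  ∂* []      f = f
  ∂* (k ∷ W) f = ∂* W (act (∂ˣ k) f)

  ∂*-cong : ∀ W {f g} → f ≈ g → ∂* W f ≈ ∂* W g
  ∂*-cong []      f≈g = f≈g
  ∂*-cong (k ∷ W) f≈g = ∂*-cong W (Derivation.cong (∂ˣ k) f≈g)

  ∂*-+ : ∀ W f g → ∂* W (f + g) ≈ ∂* W f + ∂* W g
  ∂*-+ []      f g = refl
  ∂*-+ (k ∷ W) f g = trans (∂*-cong W (Derivation.+-homo (∂ˣ k) f g)) (∂*-+ W _ _)

  ∂*-sub : ∀ W f g → ∂* W (f - g) ≈ ∂* W f - ∂* W g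
  ∂*-sub []      f g = refl
  ∂*-sub (k ∷ W) f g = trans (∂*-cong W (Derivation.sub-homo (∂ˣ k) f g)) (∂*-sub W _ _)

  ∂*-++ : ∀ V W f → ∂* (V ++ W) f ≡ ∂* W (∂* V f)
  ∂*-++ []      W f = ≡.refl
  ∂*-++ (k ∷ V) W f = ∂*-++ V W _

  -- Only the letters of positive degree lower the exponent of β.
  ∂*-∣ : ∀ {β} (ω : Fin d → ℕ) → (∀ k → ω k ≡ 0 → act (∂ˣ k) β ≈ 0#) →
    ∀ W n {f} → β ^ (degree ω W ℕ.+ n) ∣ f → β ^ n ∣ ∂* W f
  ∂*-∣ ω ∂β≈0 []      n β^∣f = β^∣f
  ∂*-∣ {β} ω ∂β≈0 (k ∷ W) n {f} β^∣f = ∂*-∣ ω ∂β≈0 W n (lower (ω k) ≡.refl β^∣f)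
    where
    N = degree ω W ℕ.+ n
    ∂β^≈0 : act (∂ˣ k) β ≈ 0# → ∀ N → act (∂ˣ k) (β ^ N) ≈ 0#
    ∂β^≈0 _   zero    = Derivation.1-homo (∂ˣ k)
    ∂β^≈0 β′≈0 (suc N) = trans (Derivation.power (∂ˣ k) β N)
      (trans (*-congˡ (trans (*-congˡ β′≈0) (zeroʳ _))) (zeroʳ _))
    lower : ∀ e → ω k ≡ e → β ^ (e ℕ.+ degree ω W ℕ.+ n) ∣ f → β ^ N ∣ act (∂ˣ k) f
    lower zero    ωk≡0 = IsDifferentialIdeal.stable (principal (∂ˣ k) (∂β^≈0 (∂β≈0 k ωk≡0) N))
    lower (suc e) _ β^∣f = act-∣ (∂ˣ k) N (∣^-weaken
      (ℕ.s≤s (ℕ.+-monoˡ-≤ n (ℕ.m≤n+m (degree ω W) e))) β^∣f)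

  -- n derivatives of xⁿ g along x leave n! g modulo x.
  record TopDerivative (k : Fin d) (n : ℕ) (g : Carrier) : Set (c ⊔ ℓ) where
    field
      factor       : Carrier
      constantUnit : IsConstantUnit factor
      remainder    : Carrier
      expansion    : ∂* (replicate n k) (x k ^ n * g) ≈ factor * g + x k * remainder

  topDerivative : ∀ k n g → TopDerivative k n g
  topDerivative k zero    g = record
    { factor = 1# ; constantUnit = 1-constantUnit ; remainder = 0#
    ; expansion = solve 2 (λ g x → :1 :* g := :1 :* g :+ x :* :0) g (x k) }
  topDerivative k (suc n) g = record
    { factor       = factor * ν (suc n)
    ; constantUnit = *-constantUnit constantUnit (ν-constantUnit n)
    ; remainder    = factor * act (∂ˣ k) g + remainder
    ; expansion    = begin
        ∂* (replicate n k) (act (∂ˣ k) (x k ^ suc n * g))  ≈⟨ ∂*-cong (replicate n k) derivative ⟩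
        ∂* (replicate n k) (x k ^ n * h)  ≈⟨ expansion ⟩
        factor * (ν (suc n) * g + x k * act (∂ˣ k) g) + x k * remainder
          ≈⟨ solve 6 (λ f m g x g′ r → f :* (m :* g :+ x :* g′) :+ x :* r := f :* m :* g :+ x :* (f :* g′ :+ r))
               factor (ν (suc n)) g (x k) (act (∂ˣ k) g) remainder ⟩
        factor * ν (suc n) * g + x k * (factor * act (∂ˣ k) g + remainder) ∎
    }
    where
    h : Carrier
    h = ν (suc n) * g + x k * act (∂ˣ k) g
    open TopDerivative (topDerivative k n h)
    derivative : act (∂ˣ k) (x k ^ suc n * g) ≈ x k ^ n * h
    derivative = begin
      act (∂ˣ k) (x k ^ suc n * g)  ≈⟨ Derivation.leibniz (∂ˣ k) _ g ⟩
      act (∂ˣ k) (x k ^ suc n) * g + x k ^ suc n * act (∂ˣ k) g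
        ≈⟨ +-congʳ (*-congʳ (trans (Derivation.power (∂ˣ k) (x k) n) (*-congˡ (*-congˡ (∂x-same k))))) ⟩
      ν (suc n) * (x k ^ n * 1#) * g + x k * x k ^ n * act (∂ˣ k) g
        ≈⟨ solve 5 (λ m p g x g′ → m :* (p :* :1) :* g :+ x :* p :* g′ := p :* (m :* g :+ x :* g′))
             (ν (suc n)) (x k ^ n) g (x k) (act (∂ˣ k) g) ⟩
      x k ^ n * (ν (suc n) * g + x k * act (∂ˣ k) g) ∎

  module Flat {i j k : Fin d} (i≢j : i ≢ j) (k≢i : k ≢ i) (k≢j : k ≢ j) where

    -- The ideal of the flat xᵢ = xⱼ = 0.
    I : Carrier → Set (c ⊔ ℓ)
    I f = ∃[ a ] ∃[ b ] a * x i + b * x j ≈ f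

    I-ideal : IsDifferentialIdeal (∂ˣ k) I
    I-ideal = record
      { resp     = λ { f≈g (a , b , ≈f) → a , b , trans ≈f f≈g }
      ; zero∈    = 0# , 0# , solve 2 (λ x y → :0 :* x :+ :0 :* y := :0) (x i) (x j)
      ; +-closed = λ { (a , b , ≈f) (a′ , b′ , ≈g) → a + a′ , b + b′ , trans
          (solve 6 (λ a b a′ b′ x y → (a :+ a′) :* x :+ (b :+ b′) :* y := (a :* x :+ b :* y) :+ (a′ :* x :+ b′ :* y))
            a b a′ b′ (x i) (x j)) (+-cong ≈f ≈g) }
      ; *-closed = λ { f (a , b , ≈g) → f * a , f * b , trans
          (solve 5 (λ f a b x y → f :* a :* x :+ f :* b :* y := f :* (a :* x :+ b :* y)) f a b (x i) (x j))
          (*-congˡ ≈g) }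
      ; stable   = λ { (a , b , ≈f) → act (∂ˣ k) a , act (∂ˣ k) b , trans (sym (stable a b)) (Derivation.cong (∂ˣ k) ≈f) }
      }
      where
      open Derivation (∂ˣ k) using (leibniz; +-homo)
      stable : ∀ a b → act (∂ˣ k) (a * x i + b * x j) ≈ act (∂ˣ k) a * x i + act (∂ˣ k) b * x j
      stable a b = begin
        act (∂ˣ k) (a * x i + b * x j)  ≈⟨ +-homo _ _ ⟩
        act (∂ˣ k) (a * x i) + act (∂ˣ k) (b * x j)  ≈⟨ +-cong (leibniz a (x i)) (leibniz b (x j)) ⟩
        (act (∂ˣ k) a * x i + a * act (∂ˣ k) (x i)) + (act (∂ˣ k) b * x j + b * act (∂ˣ k) (x j))
          ≈⟨ +-cong (+-congˡ (*-congˡ (∂x-other k≢i))) (+-congˡ (*-congˡ (∂x-other k≢j))) ⟩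
        (act (∂ˣ k) a * x i + a * 0#) + (act (∂ˣ k) b * x j + b * 0#)
          ≈⟨ solve 6 (λ a′ x a b′ y b → (a′ :* x :+ a :* :0) :+ (b′ :* y :+ b :* :0) := a′ :* x :+ b′ :* y)
               (act (∂ˣ k) a) (x i) a (act (∂ˣ k) b) (x j) b ⟩
        act (∂ˣ k) a * x i + act (∂ˣ k) b * x j  ∎

    open IsDifferentialIdeal I-ideal

    xᵢ∣⇒I : ∀ {f} → x i ∣ f → I f
    xᵢ∣⇒I (q , q≈) = q , 0# , trans (trans (+-congˡ (zeroˡ _)) (+-identityʳ _)) q≈

    xⱼ∣⇒I : ∀ {f} → x j ∣ f → I f
    xⱼ∣⇒I (q , q≈) = 0# , q , trans (trans (+-congʳ (zeroˡ _)) (+-identityˡ _)) q≈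

    xᵢ-xⱼ∣⇒I : ∀ {f} → x i - x j ∣ f → I f
    xᵢ-xⱼ∣⇒I (q , q≈) = q , - q , trans
      (solve 3 (λ q x y → q :* x :+ :- q :* y := q :* (x :- y)) q (x i) (x j)) q≈

    ωᵢ ωⱼ ω : Fin d → ℕ
    ωᵢ   = indicator i
    ωⱼ   = indicator j
    ω k′ = ωᵢ k′ ℕ.+ ωⱼ k′

    degree-ω : ∀ W → degree ω W ≡ degree ωᵢ W ℕ.+ degree ωⱼ W
    degree-ω []      = ≡.refl
    degree-ω (l ∷ W) = ≡.trans (≡.cong (ω l ℕ.+_) (degree-ω W))
      (ℕ+-interchange (ωᵢ l) (ωⱼ l) (degree ωᵢ W) (degree ωⱼ W))
      where
      open CommutativeSemigroupProperties ℕ.+-commutativeSemigroup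
        using () renaming (interchange to ℕ+-interchange)

    ∂-indicator : ∀ i l → indicator i l ≡ 0 → act (∂ˣ l) (x i) ≈ 0#
    ∂-indicator i l ≡0 with l Fin.≟ i
    ∂-indicator i l () | yes _
    ... | no l≢i = ∂x-other l≢i

    ∂-ω : ∀ l → ω l ≡ 0 → act (∂ˣ l) (x i - x j) ≈ 0#
    ∂-ω l ω≡0 = trans (Derivation.sub-homo (∂ˣ l) _ _)
      (trans (+-cong (∂-indicator i l (ℕ.m+n≡0⇒m≡0 (ωᵢ l) ω≡0))
                     (-‿cong (∂-indicator j l (ℕ.m+n≡0⇒n≡0 (ωᵢ l) ω≡0))))
             (-‿inverseʳ 0#))

    ∂*-∣₁ : ∀ {β} (ω : Fin d → ℕ) → (∀ k → ω k ≡ 0 → act (∂ˣ k) β ≈ 0#) →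
      ∀ {m} W {f} → degree ω W ℕ.≤ m → β ^ suc m ∣ f → β ∣ ∂* W f
    ∂*-∣₁ ω ∂β≈0 {m} W deg≤ β^∣f = ∣-respˡ (*-identityʳ _) (∂*-∣ ω ∂β≈0 W 1
      (∣^-weaken (ℕ.≤-trans (ℕ.≤-reflexive (ℕ.+-comm (degree ω W) 1)) (ℕ.s≤s deg≤)) β^∣f))

    -- f vanishes on the flat together with its derivatives of degree at most n.
    Flatness : ℕ → Carrier → Set (c ⊔ ℓ)
    Flatness n f = ∀ W → degree ω W ℕ.≤ n → I (∂* W f)

    -- An operator of degree at most a + b + 1 has degree at most a in ∂ᵢ or at most b in ∂ⱼ.
    flat-value : ∀ a b {n f g} → a ℕ.+ b ℕ.< n →
      x i ^ suc a ∣ f → x j ^ suc b ∣ g → (x i - x j) ^ suc n ∣ f - g → Flatness (suc (a ℕ.+ b)) f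
    flat-value a b {n} {f} {g} a+b<n xᵢ∣ xⱼ∣ xᵢ-xⱼ∣ W deg≤ with ℕ.≤-<-connex (degree ωᵢ W) a
    ... | inj₁ degᵢ≤a = xᵢ∣⇒I (∂*-∣₁ ωᵢ (∂-indicator i) W degᵢ≤a xᵢ∣)
    ... | inj₂ a<degᵢ = resp (begin
            (∂* W f - ∂* W g) + ∂* W g  ≈⟨ solve 2 (λ f g → (f :- g) :+ g := f) _ _ ⟩
            ∂* W f  ∎)
          (+-closed
            (xᵢ-xⱼ∣⇒I (∣-respʳ (∂*-sub W f g) (∂*-∣₁ ω ∂-ω W (ℕ.≤-trans deg≤ a+b<n) xᵢ-xⱼ∣)))
            (xⱼ∣⇒I (∂*-∣₁ ωⱼ (∂-indicator j) W degⱼ≤b xⱼ∣)))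
      where
      degⱼ≤b : degree ωⱼ W ℕ.≤ b
      degⱼ≤b = ℕ.+-cancelˡ-≤ (suc a) _ _ (ℕ.≤-trans (ℕ.+-monoˡ-≤ _ a<degᵢ)
        (ℕ.≤-trans (ℕ.≤-reflexive (≡.sym (degree-ω W))) deg≤))

    ω≤1 : ∀ l → ω l ℕ.≤ 1
    ω≤1 l with l Fin.≟ i | l Fin.≟ j
    ... | yes ≡.refl | yes i≡j = contradiction i≡j i≢j
    ... | yes _      | no _    = ℕ.≤-refl
    ... | no _       | yes _   = ℕ.≤-refl
    ... | no _       | no _    = ℕ.z≤n

    flat-act : ∀ {n f} l → Flatness (suc n) f → Flatness n (act (∂ˣ l) f)
    flat-act l flat W deg≤ = flat (l ∷ W) (ℕ.+-mono-≤ (ω≤1 l) deg≤)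

    flat-* : ∀ {n f} g → Flatness n f → Flatness n (g * f)
    flat-* g flat W deg≤ = product W g λ V V≤W → flat V (ℕ.≤-trans V≤W deg≤)
      where
      product : ∀ W g {f} → (∀ V → degree ω V ℕ.≤ degree ω W → I (∂* V f)) → I (∂* W (g * f))
      product []      g flat = *-closed g (flat [] ℕ.z≤n)
      product (l ∷ W) g {f} flat = resp (sym (trans (∂*-cong W (Derivation.leibniz (∂ˣ l) g f)) (∂*-+ W _ _)))
        (+-closed (product W (act (∂ˣ l) g) λ V V≤W → flat V (ℕ.≤-trans V≤W (ℕ.m≤n+m _ (ω l))))
                  (product W g λ V V≤W → flat (l ∷ V) (ℕ.+-monoʳ-≤ (ω l) V≤W)))

    flat-sum : ∀ {n m} (f : Vector Carrier m) → (∀ l → Flatness n (f l)) → Flatness n (sum f)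
    flat-sum {m = zero}  f flat W deg≤ = resp (sym (∂*-0 W)) zero∈
      where
      ∂*-0 : ∀ W → ∂* W 0# ≈ 0#
      ∂*-0 []      = refl
      ∂*-0 (l ∷ W) = trans (∂*-cong W (Derivation.0-homo (∂ˣ l))) (∂*-0 W)
    flat-sum {m = suc m} f flat W deg≤ = resp (sym (∂*-+ W _ _))
      (+-closed (flat zero W deg≤) (flat-sum (λ l → f (suc l)) (λ l → flat (suc l)) W deg≤))

    flat-combine : ∀ {n f} φ → Flatness (suc n) f → Flatness n (act (combine φ) f)
    flat-combine φ flat = flat-sum _ λ l → flat-* (φ l) (flat-act l flat)

    unit-cancel : ∀ {a f} → IsConstantUnit a → I (a * f) → I f
    unit-cancel {a} {f} unit If = resp
      (trans (sym (*-assoc _ _ _)) (trans (*-congʳ (IsConstantUnit.inverse unit)) (*-identityˡ f)))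
      (*-closed (IsConstantUnit.inv unit) If)

    -- xⱼᵇ xᵢᵃ g does not vanish to an order above a + b along the flat unless g vanishes on it.
    flat-monomial : ∀ a b g → Flatness (a ℕ.+ b) (x j ^ b * (x i ^ a * g)) → I g
    flat-monomial a b g flat = unit-cancel S.constantUnit (unit-cancel T.constantUnit
        (resp (solve 4 (λ v x y z → ((v :+ x) :+ y) :- y :- x := v) (T.factor * (S.factor * g)) (x i * T.remainder) q 0#)
          (minus-closed (minus-closed (resp value (flat W (ℕ.≤-reflexive deg))) Iq)
            (xᵢ∣⇒I (T.remainder , *-comm _ _)))))
      where
      W = replicate b j ++ replicate a i
      module S = TopDerivative (topDerivative j b (x i ^ a * g))
      module T = TopDerivative (topDerivative i a (S.factor * g))
      q : Carrier
      q = ∂* (replicate a i) (x j * S.remainder)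
      deg-single : ∀ n l → ω l ≡ 1 → degree ω (replicate n l) ≡ n
      deg-single n l ω≡1 = ≡.trans (degree-replicate ω n l) (≡.trans (≡.cong (n ℕ.*_) ω≡1) (ℕ.*-identityʳ n))
      ωi≡1 : ω i ≡ 1
      ωi≡1 = ≡.cong₂ ℕ._+_ (indicator-same i) (indicator-other i≢j)
      ωj≡1 : ω j ≡ 1
      ωj≡1 = ≡.cong₂ ℕ._+_ (indicator-other (i≢j ∘ ≡.sym)) (indicator-same j)
      deg : degree ω W ≡ a ℕ.+ b
      deg = ≡.trans (degree-++ ω (replicate b j) (replicate a i))
        (≡.trans (≡.cong₂ ℕ._+_ (deg-single b j ωj≡1) (deg-single a i ωi≡1)) (ℕ.+-comm b a))
      degⱼ : degree ωⱼ (replicate a i) ≡ 0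
      degⱼ = ≡.trans (degree-replicate ωⱼ a i) (≡.trans (≡.cong (a ℕ.*_) (indicator-other i≢j)) (ℕ.*-zeroʳ a))
      Iq : I q
      Iq = xⱼ∣⇒I (∂*-∣₁ ωⱼ (∂-indicator j) (replicate a i) (ℕ.≤-reflexive degⱼ)
        (S.remainder , trans (*-congˡ (*-identityʳ _)) (*-comm _ _)))
      value : ∂* W (x j ^ b * (x i ^ a * g)) ≈ T.factor * (S.factor * g) + x i * T.remainder + q
      value = begin
        ∂* W (x j ^ b * (x i ^ a * g))
          ≡⟨ ∂*-++ (replicate b j) (replicate a i) _ ⟩
        ∂* (replicate a i) (∂* (replicate b j) (x j ^ b * (x i ^ a * g)))
          ≈⟨ ∂*-cong (replicate a i) S.expansion ⟩
        ∂* (replicate a i) (S.factor * (x i ^ a * g) + x j * S.remainder)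
          ≈⟨ ∂*-+ (replicate a i) _ _ ⟩
        ∂* (replicate a i) (S.factor * (x i ^ a * g)) + q
          ≈⟨ +-congʳ (∂*-cong (replicate a i) (solve 3 (λ s p g → s :* (p :* g) := p :* (s :* g)) S.factor (x i ^ a) g)) ⟩
        ∂* (replicate a i) (x i ^ a * (S.factor * g)) + q
          ≈⟨ +-congʳ T.expansion ⟩
        T.factor * (S.factor * g) + x i * T.remainder + q ∎

    power-cancel : ∀ {β} → act (∂ˣ k) β ≈ 1# → ∀ n {f} → I (β ^ n * f) → I f
    power-cancel ∂β≈1 zero    If = resp (*-identityˡ _) If
    power-cancel ∂β≈1 (suc n) If = power-cancel ∂β≈1 n
      (cancel-mod I-ideal (nilpotent k) ∂β≈1 (resp (*-assoc _ _ _) If))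

    slope-k : ∀ {l} → k ≢ l → act (∂ˣ k) (x k - x l) ≈ 1#
    slope-k {l} k≢l = begin
      act (∂ˣ k) (x k - x l)  ≈⟨ Derivation.sub-homo (∂ˣ k) _ _ ⟩
      act (∂ˣ k) (x k) - act (∂ˣ k) (x l)  ≈⟨ +-cong (∂x-same k) (-‿cong (∂x-other k≢l)) ⟩
      1# - 0#  ≈⟨ solve 0 (:1 :- :0 := :1) ⟩
      1#  ∎

    -- If the exponent on xᵢ = xⱼ were too large, the derivation with values f and g on xᵢ and xⱼ
    -- would vanish along the flat to too high an order for xⱼᵇ xᵢᵃ (xₖ − xᵢ)ᵖ (xₖ − xⱼ)ᵠ to be
    -- a combination of its derivatives.
    obstruction : ∀ {a b n f g} p q φ → a ℕ.+ b ℕ.< n →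
      x i ^ suc a ∣ f → x j ^ suc b ∣ g → (x i - x j) ^ suc n ∣ f - g →
      act (combine φ) f ≈ x j ^ b * (x i ^ a * ((x k - x i) ^ p * (x k - x j) ^ q)) →
      I 1#
    obstruction {a} {b} p q φ a+b<n xᵢ∣ xⱼ∣ xᵢ-xⱼ∣ eq =
      power-cancel (slope-k k≢j) q (resp (sym (*-identityʳ _))
        (power-cancel (slope-k k≢i) p (flat-monomial a b _ λ W deg≤ →
          resp (∂*-cong W eq) (flat-combine φ (flat-value a b a+b<n xᵢ∣ xⱼ∣ xᵢ-xⱼ∣) W deg≤))))

-- Logarithmic derivations in linear coordinates

count-++ : ∀ {d} (V W : List (Fin d)) i → count (V ++ W) i ≡ count V i ℕ.+ count W i
count-++ []      W i = ≡.refl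
count-++ (k ∷ V) W i with k Fin.≟ i
... | yes _ = ≡.cong suc (count-++ V W i)
... | no  _ = count-++ V W i

count-replicate-same : ∀ {d} n (k : Fin d) → count (replicate n k) k ≡ n
count-replicate-same zero    k = ≡.refl
count-replicate-same (suc n) k = ≡.trans (count-same k (replicate n k)) (≡.cong suc (count-replicate-same n k))

count-replicate-other : ∀ {d} n {k i : Fin d} → k ≢ i → count (replicate n k) i ≡ 0
count-replicate-other zero    k≢i = ≡.refl
count-replicate-other (suc n) k≢i = ≡.trans (count-other (replicate n _) k≢i) (count-replicate-other n k≢i)

count-map-zero : ∀ {d} (w : List (Fin d)) → count (List.map suc w) zero ≡ 0
count-map-zero []      = ≡.refl
count-map-zero (k ∷ w) = ≡.trans (count-other {k = suc k} {zero} (List.map suc w) λ ()) (count-map-zero w)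

count-map-suc : ∀ {d} (w : List (Fin d)) i → count (List.map suc w) (suc i) ≡ count w i
count-map-suc []      i = ≡.refl
count-map-suc (k ∷ w) i = by-cases (k Fin.≟ i)
  where
  by-cases : Dec (k ≡ i) → count (List.map suc (k ∷ w)) (suc i) ≡ count (k ∷ w) i
  by-cases (yes ≡.refl) = ≡.trans (count-same (suc k) (List.map suc w))
    (≡.trans (≡.cong suc (count-map-suc w k)) (≡.sym (count-same k w)))
  by-cases (no k≢i) = ≡.trans (count-other (List.map suc w) (k≢i ∘ Fin.suc-injective))
    (≡.trans (count-map-suc w i) (≡.sym (count-other w k≢i)))

-- A word with prescribed numbers of letters.
word : ∀ {d} → (Fin d → ℕ) → List (Fin d)
word {zero}  a = []
word {suc d} a = replicate (a zero) zero ++ List.map suc (word (a ∘ suc))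

count-word : ∀ {d} (a : Fin d → ℕ) i → count (word a) i ≡ a i
count-word a zero = ≡.trans (count-++ (replicate (a zero) zero) _ zero)
  (≡.trans (≡.cong₂ ℕ._+_ (count-replicate-same (a zero) zero) (count-map-zero (word (a ∘ suc)))) (ℕ.+-identityʳ _))
count-word a (suc i) = ≡.trans (count-++ (replicate (a zero) zero) _ (suc i))
  (≡.trans (≡.cong₂ ℕ._+_ (count-replicate-other (a zero) λ ()) (count-map-suc (word (a ∘ suc)) i)) (count-word (a ∘ suc) i))

-- Derivations written in the partial derivatives, and their values on the coordinates x.
module VectorFields {c ℓ : Level} (R : CommutativeRing c ℓ) (Q : DifferentialAlgebra.Reciprocals R)
  {d : ℕ} (C : DifferentialAlgebra.LinearCoordinates R d) where

  open DifferentialAlgebra R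
  open Reciprocals Q
  open LinearCoordinates C
  open ℚ-Algebra R Q

  -- The derivation Σᵢ θᵢ ∂ᵢ in the partial derivatives.
  vectorField : Vector Carrier d → Derivation
  vectorField θ = linearCombination θ partial

  -- Entrywise application of Σᵢ φᵢ ∂ᵢ.
  nabla : Vector Carrier d → Vector Carrier d → Vector Carrier d
  nabla φ θ i = act (vectorField φ) (θ i)

  -- The derivations dual to the coordinates x.
  ∂ˣ : Vector Derivation d
  ∂ˣ k = vectorField (B k)

  -- The values of a derivation on the coordinates x.
  value : Vector Carrier d → Vector Carrier d
  value θ k = act (vectorField θ) (x k)

  value-sum : ∀ θ k → value θ k ≈ sum λ i → L k i * θ i
  value-sum θ k = sum-cong-≋ λ i → trans (*-congˡ (partial-x i k)) (*-comm _ _)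

  -- The derivation with prescribed values on the coordinates x.
  fromValues : Vector Carrier d → Vector Carrier d
  fromValues f i = sum λ k → B k i * f k

  ∂x-same : ∀ k → act (∂ˣ k) (x k) ≈ 1#
  ∂x-same k = trans (value-sum (B k) k) (dual-same k)

  ∂x-other : ∀ {k j} → k ≢ j → act (∂ˣ k) (x j) ≈ 0#
  ∂x-other {k} {j} k≢j = trans (value-sum (B k) j) (dual-other k≢j)

  coordinateSystem : CoordinateSystem d
  coordinateSystem = record
    { x = x ; ∂ˣ = ∂ˣ ; ∂x-same = ∂x-same ; ∂x-other = ∂x-other ; nilpotent = nilpotent }

  open Coordinates R Q coordinateSystem public
  open Necessity R Q coordinateSystem public using (module Flat)

  value-fromValues : ∀ f k → value (fromValues f) k ≈ f k
  value-fromValues f k = begin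
    value (fromValues f) k  ≈⟨ value-sum (fromValues f) k ⟩
    sum (λ i → L k i * sum (λ j → B j i * f j))  ≈⟨ sum-assoc (L k) (λ i j → B j i) f ⟩
    sum (λ j → sum (λ i → L k i * B j i) * f j)  ≈⟨ sum-single k (λ j j≢k → trans (*-congʳ (dual-other j≢k)) (zeroˡ _)) ⟩
    sum (λ i → L k i * B k i) * f k  ≈⟨ trans (*-congʳ (dual-same k)) (*-identityˡ _) ⟩
    f k  ∎

  fromValues-value : ∀ θ i → fromValues (value θ) i ≈ θ i
  fromValues-value θ i = begin
    sum (λ k → B k i * value θ k)  ≈⟨ sum-cong-≋ (λ k → *-congˡ (value-sum θ k)) ⟩
    sum (λ k → B k i * sum (λ j → L k j * θ j))  ≈⟨ sum-assoc (λ k → B k i) L θ ⟩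
    sum (λ j → sum (λ k → B k i * L k j) * θ j)  ≈⟨ sum-single i (λ j j≢i → trans (*-congʳ (complete-other j≢i)) (zeroˡ _)) ⟩
    sum (λ k → B k i * L k i) * θ i  ≈⟨ trans (*-congʳ (complete-same i)) (*-identityˡ _) ⟩
    θ i  ∎

  field-cong : ∀ {θ η} → (∀ i → θ i ≈ η i) → ∀ f → act (vectorField θ) f ≈ act (vectorField η) f
  field-cong θ≈η f = sum-cong-≋ λ i → *-congʳ (θ≈η i)

  field-const : ∀ θ {a} → (∀ j → act (partial j) a ≈ 0#) → act (vectorField θ) a ≈ 0#
  field-const θ a′≈0 = trans (sum-cong-≋ λ j → trans (*-congˡ (a′≈0 j)) (zeroʳ _)) (sum-0 d)

  field-fromValues : ∀ Φ f → act (vectorField (fromValues Φ)) f ≈ act (combine Φ) f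
  field-fromValues Φ f = begin
    sum (λ i → sum (λ k → B k i * Φ k) * act (partial i) f)
      ≈⟨ sum-cong-≋ (λ i → *-congʳ (sum-cong-≋ λ k → *-comm (B k i) (Φ k))) ⟩
    sum (λ i → sum (λ k → Φ k * B k i) * act (partial i) f)  ≈⟨ sum-assoc Φ B (λ i → act (partial i) f) ⟨
    sum (λ k → Φ k * act (∂ˣ k) f)  ∎

  field-value : ∀ φ f → act (vectorField φ) f ≈ act (combine (value φ)) f
  field-value φ f = trans (field-cong (λ i → sym (fromValues-value φ i)) f) (field-fromValues (value φ) f)

  value-injective : ∀ {θ η} → (∀ k → value θ k ≈ value η k) → ∀ i → θ i ≈ η i
  value-injective {θ} {η} eq i = begin
    θ i  ≈⟨ fromValues-value θ i ⟨
    fromValues (value θ) i  ≈⟨ sum-cong-≋ (λ k → *-congˡ (eq k)) ⟩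
    fromValues (value η) i  ≈⟨ fromValues-value η i ⟩
    η i  ∎

  value-nabla : ∀ φ θ k → value (nabla φ θ) k ≈ act (vectorField φ) (value θ k)
  value-nabla φ θ k = begin
    value (nabla φ θ) k  ≈⟨ value-sum (nabla φ θ) k ⟩
    sum (λ i → L k i * act (vectorField φ) (θ i))  ≈⟨ sum-cong-≋ (λ i → Derivation.scalar (vectorField φ) (killed i) (θ i)) ⟨
    sum (λ i → act (vectorField φ) (L k i * θ i))  ≈⟨ act-sum (vectorField φ) (λ i → L k i * θ i) ⟨
    act (vectorField φ) (sum λ i → L k i * θ i)  ≈⟨ Derivation.cong (vectorField φ) (value-sum θ k) ⟨
    act (vectorField φ) (value θ k)  ∎
    where
    killed : ∀ i → act (vectorField φ) (L k i) ≈ 0#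
    killed i = field-const φ λ j → L-const j k i

  -- Membership in D(A, μ), where μ k y is the multiplicity of the plane x k = u y.
  Log : (Fin d → Vertex → ℕ) → Vector Carrier d → Set (c ⊔ ℓ)
  Log μ θ = ∀ k y → y ≢ just k → (x k - u y) ^ μ k y ∣ value θ k - atVertex (value θ) y

  act-difference′ : ∀ δ f k y → act δ (f k) - atVertex (λ k → act δ (f k)) y ≈ act δ (f k - atVertex f y)
  act-difference′ δ f k nothing  = trans (+-congˡ (-‿cong (sym (Derivation.0-homo δ)))) (sym (Derivation.sub-homo δ _ _))
  act-difference′ δ f k (just j) = sym (Derivation.sub-homo δ _ _)

  atVertex-cong : ∀ {f g} → (∀ k → f k ≈ g k) → ∀ y → atVertex f y ≈ atVertex g y
  atVertex-cong f≈g nothing  = refl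
  atVertex-cong f≈g (just k) = f≈g k

  difference-cong : ∀ {f g} → (∀ k → f k ≈ g k) → ∀ k y → f k - atVertex f y ≈ g k - atVertex g y
  difference-cong f≈g k y = +-cong (f≈g k) (-‿cong (atVertex-cong f≈g y))

  log-∇ : ∀ {μ} φ θ → Log (λ k y → suc (μ k y)) θ → Log μ (nabla φ θ)
  log-∇ {μ} φ θ log k y y≢k = ∣-respʳ
    (trans (sym (act-difference′ (vectorField φ) (value θ) k y)) (sym (difference-cong (value-nabla φ θ) k y)))
    (act-∣ (vectorField φ) (μ k y) (log k y y≢k))

  nabla-cong : ∀ {φ φ′} → (∀ i → φ i ≈ φ′ i) → ∀ θ i → nabla φ θ i ≈ nabla φ′ θ i
  nabla-cong φ≈φ′ θ i = field-cong φ≈φ′ (θ i)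

  nabla-+ : ∀ φ φ′ θ i → nabla (λ j → φ j + φ′ j) θ i ≈ nabla φ θ i + nabla φ′ θ i
  nabla-+ φ φ′ θ i = trans (sum-cong-≋  λ j → distribʳ (∂ᵢ j) (φ j) (φ′ j)) (∑-distrib-+ (λ j → φ j * ∂ᵢ j) (λ j → φ′ j * ∂ᵢ j))
    where
    ∂ᵢ : Fin d → Carrier
    ∂ᵢ j = act (partial j) (θ i)

  nabla-* : ∀ f φ θ i → nabla (λ j → f * φ j) θ i ≈ f * nabla φ θ i
  nabla-* f φ θ i = trans (sum-cong-≋  λ j → *-assoc f (φ j) (∂ᵢ j)) (sym (*-distribˡ-sum f (λ j → φ j * ∂ᵢ j)))
    where
    ∂ᵢ : Fin d → Carrier
    ∂ᵢ j = act (partial j) (θ i)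

  nabla-neg : ∀ φ θ i → nabla (λ j → - φ j) θ i ≈ - nabla φ θ i
  nabla-neg φ θ i = begin
    nabla (λ j → - φ j) θ i  ≈⟨ nabla-cong {λ j → - φ j} {λ j → - 1# * φ j} (λ j → minus (φ j)) θ i ⟩
    nabla (λ j → - 1# * φ j) θ i  ≈⟨ nabla-* (- 1#) φ θ i ⟩
    - 1# * nabla φ θ i  ≈⟨ minus (nabla φ θ i) ⟨
    - nabla φ θ i  ∎
    where
    minus : ∀ a → - a ≈ - 1# * a
    minus = solve 1 (λ a → :- a := :- :1 :* a)

  nabla-0 : ∀ θ i → nabla (λ j → 0#) θ i ≈ 0#
  nabla-0 θ i = trans (sum-cong-≋  λ j → zeroˡ (act (partial j) (θ i))) (sum-0 d)

  -- The defining form P of a plane is a constant multiple of x k - u y.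
  module _ {C C⁻¹ P : Carrier} (inverse : C⁻¹ * C ≈ 1#) (C-const : ∀ j → act (partial j) C ≈ 0#)
           {k : Fin d} {y : Vertex} (P≈ : P ≈ C * (x k - u y)) where

    plane-value : ∀ θ → act (vectorField θ) P ≈ C * (value θ k - atVertex (value θ) y)
    plane-value θ = begin
      act (vectorField θ) P  ≈⟨ Derivation.cong (vectorField θ) P≈ ⟩
      act (vectorField θ) (C * (x k - u y))  ≈⟨ Derivation.scalar (vectorField θ) (field-const θ C-const) (x k - u y) ⟩
      C * act (vectorField θ) (x k - u y)  ≈⟨ *-congˡ (act-difference′ (vectorField θ) x k y) ⟨
      C * (value θ k - atVertex (value θ) y)  ∎

    plane⇒log : ∀ n θ → P ^ n ∣ act (vectorField θ) P → (x k - u y) ^ n ∣ value θ k - atVertex (value θ) y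
    plane⇒log n θ P∣ = ∣-unscale inverse n (∣-resp₂ (^-congˡ n P≈) (plane-value θ) P∣)

    log⇒plane : ∀ n θ → (x k - u y) ^ n ∣ value θ k - atVertex (value θ) y → P ^ n ∣ act (vectorField θ) P
    log⇒plane n θ α∣ = ∣-resp₂ (^-congˡ n (sym P≈)) (sym (plane-value θ)) (∣-scale inverse n α∣)

  -- The universal derivation for multiplicities satisfying the equalities.
  module Sufficiency (μ : Fin d → Vertex → ℕ)
    (equalities : ∀ {i j} → i ≢ j → μ i (just j) ≡ μ i nothing ℕ.+ μ j nothing) where

    -- The integrand has the exponents of the planes x k = 0.
    w : List (Fin d)
    w = word λ k → μ k nothing

    universal : Vector Carrier d
    universal = fromValues (θ w)

    value-universal : ∀ k → value universal k ≈ θ w k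
    value-universal = value-fromValues (θ w)

    exponent≡μ : ∀ k y → y ≢ just k → count w k ℕ.+ countᵛ w y ≡ μ k y
    exponent≡μ k nothing  _   = ≡.trans (ℕ.+-identityʳ _) (count-word (λ k → μ k nothing) k)
    exponent≡μ k (just j) y≢k = ≡.trans
      (≡.cong₂ ℕ._+_ (count-word (λ k → μ k nothing) k) (count-word (λ k → μ k nothing) j))
      (≡.sym (equalities λ { ≡.refl → y≢k ≡.refl }))

    θ-vertex : ∀ y → ψ w y 0 ≈ atVertex (θ w) y
    θ-vertex nothing  = ψ-origin w 0
    θ-vertex (just k) = refl

    log-universal : Log (λ k y → suc (μ k y)) universal
    log-universal k y y≢k = ∣-respʳ
      (trans (+-congˡ (-‿cong (θ-vertex y))) (sym (difference-cong value-universal k y)))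
      (≡.subst (λ n → (x k - u y) ^ suc n ∣ ψ w (just k) 0 - ψ w y 0) (exponent≡μ k y y≢k)
        (Plane.difference-∣ k y y≢k w))

    value-nabla-universal : ∀ φ k → value (nabla φ universal) k ≈ act (combine (value φ)) (θ w k)
    value-nabla-universal φ k = trans (value-nabla φ universal k)
      (trans (Derivation.cong (vectorField φ) (value-universal k)) (field-value φ (θ w k)))

    universal-injective : ∀ φ → (∀ i → nabla φ universal i ≈ 0#) → ∀ i → φ i ≈ 0#
    universal-injective φ ∇≈0 i = begin
      φ i  ≈⟨ fromValues-value φ i ⟨
      sum (λ k → B k i * value φ k)
        ≈⟨ sum-cong-≋ (λ k → trans (*-congˡ (partials-independent w (value φ) zero-values k)) (zeroʳ _)) ⟩
      sum {d} (λ k → 0#)  ≈⟨ sum-0 d ⟩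
      0#  ∎
      where
      zero-values : ∀ k → act (combine (value φ)) (θ w k) ≈ 0#
      zero-values k = trans (sym (value-nabla-universal φ k)) (trans (value-sum _ k)
        (trans (sum-cong-≋ λ i → trans (*-congˡ (∇≈0 i)) (zeroʳ _)) (sum-0 d)))

    universal-surjective : ∀ η → Log μ η → ∃[ φ ] ∀ i → nabla φ universal i ≈ η i
    universal-surjective η log =
      let Φ , Φθ≈ = partials-span w (value η) λ k y y≢k →
                      ≡.subst (λ n → (x k - u y) ^ n ∣ value η k - atVertex (value η) y) (≡.sym (exponent≡μ k y y≢k)) (log k y y≢k)
      in fromValues Φ , value-injective λ k → begin
        value (nabla (fromValues Φ) universal) k  ≈⟨ value-nabla (fromValues Φ) universal k ⟩
        act (vectorField (fromValues Φ)) (value universal k)  ≈⟨ field-fromValues Φ (value universal k) ⟩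
        act (combine Φ) (value universal k)  ≈⟨ Derivation.cong (combine Φ) (value-universal k) ⟩
        act (combine Φ) (θ w k)  ≈⟨ Φθ≈ k ⟩
        value η k  ∎

    universal-cancel : ∀ φ φ′ → (∀ i → nabla φ universal i ≈ nabla φ′ universal i) → ∀ i → φ i ≈ φ′ i
    universal-cancel φ φ′ eq i = begin
      φ i  ≈⟨ solve 2 (λ a b → a := (a :- b) :+ b) (φ i) (φ′ i) ⟩
      (φ i - φ′ i) + φ′ i  ≈⟨ +-congʳ (universal-injective (λ j → φ j - φ′ j) difference≈0 i) ⟩
      0# + φ′ i  ≈⟨ +-identityˡ (φ′ i) ⟩
      φ′ i  ∎
      where
      difference≈0 : ∀ j → nabla (λ j → φ j - φ′ j) universal j ≈ 0#
      difference≈0 j = trans (nabla-+ φ (λ j → - φ′ j) universal j)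
        (trans (+-cong (eq j) (nabla-neg φ′ universal j)) (-‿inverseʳ (nabla φ′ universal j)))

    universal-nonzero : ¬ 1# ≈ 0# → Fin d → ¬ (∀ i → universal i ≈ 0#)
    universal-nonzero 1≉0 i universal≈0 = 1≉0 (universal-injective (λ _ → 1#)
      (λ i → trans (Derivation.cong (vectorField λ _ → 1#) (universal≈0 i)) (Derivation.0-homo (vectorField λ _ → 1#))) i)

    universalDegree : ℕ
    universalDegree = suc (length w ℕ.+ 0)

    -- The values of the universal derivation on linear forms are eigenvectors of the Euler
    -- derivation, that is, homogeneous.
    module _ (E : Derivation) (Ex : ∀ k → act E (x k) ≈ x k) (EB : ∀ k i → act E (B k i) ≈ 0#) where

      eigen-sum : ∀ {n} (a f : Vector Carrier n) → (∀ i → act E (a i) ≈ 0#) →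
        (∀ i → act E (f i) ≈ ν universalDegree * f i) →
        act E (sum λ i → a i * f i) ≈ ν universalDegree * sum λ i → a i * f i
      eigen-sum a f Ea Ef = begin
        act E (sum λ i → a i * f i)  ≈⟨ act-sum E (λ i → a i * f i) ⟩
        sum (λ i → act E (a i * f i))  ≈⟨ sum-cong-≋ (λ i → Derivation.scalar E (Ea i) (f i)) ⟩
        sum (λ i → a i * act E (f i))
          ≈⟨ sum-cong-≋ (λ i → trans (*-congˡ (Ef i)) (solve 3 (λ a b c → a :* (b :* c) := b :* (a :* c)) (a i) (ν universalDegree) (f i))) ⟩
        sum (λ i → ν universalDegree * (a i * f i))  ≈⟨ *-distribˡ-sum (ν universalDegree) (λ i → a i * f i) ⟨
        ν universalDegree * sum (λ i → a i * f i)  ∎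

      universal-eigen : ∀ a → (∀ i → act E (a i) ≈ 0#) → ∀ {f} → f ≈ sum (λ i → a i * universal i) →
        act E f ≈ ν universalDegree * f
      universal-eigen a Ea {f} f≈ = begin
        act E f  ≈⟨ Derivation.cong E f≈ ⟩
        act E (sum λ i → a i * universal i)  ≈⟨ eigen-sum a universal Ea (λ i →
          eigen-sum (λ k → B k i) (θ w) (λ k → EB k i) λ k → ψ-euler E Ex w (just k) 0) ⟩
        ν universalDegree * sum (λ i → a i * universal i)  ≈⟨ *-congˡ f≈ ⟨
        ν universalDegree * f  ∎

  -- If the exponent of xᵢ = xⱼ exceeds the sum of those of xᵢ = 0 and xⱼ = 0, then the derivation
  -- with value G on xᵢ and xⱼ and 0 on xₖ is logarithmic. It is not in the image of φ ↦ ∇_φ θ when θ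
  -- is logarithmic for μ + 1, unless xᵢ and xⱼ generate the unit ideal.
  module Obstruction {i j k : Fin d} (i≢j : i ≢ j) (k≢i : k ≢ i) (k≢j : k ≢ j)
    (exhaust : ∀ l → l ≢ k → l ≡ i ⊎ l ≡ j) (μ : Fin d → Vertex → ℕ) where

    open Flat i≢j k≢i k≢j using (I; obstruction)

    a b p q : ℕ
    a = μ i nothing
    b = μ j nothing
    p = μ k (just i) ℕ.+ μ i (just k)
    q = μ k (just j) ℕ.+ μ j (just k)

    -- The factors at k make the derivation logarithmic for the planes through the k-th vertex;
    -- any exponents that are large enough serve.
    G : Carrier
    G = x j ^ b * (x i ^ a * ((x k - x i) ^ p * (x k - x j) ^ q))

    f : Vector Carrier d
    f l with l Fin.≟ k
    ... | yes _ = 0#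
    ... | no  _ = G

    f-k : f k ≈ 0#
    f-k with k Fin.≟ k
    ... | yes _  = refl
    ... | no k≢k = contradiction ≡.refl k≢k

    f-off : ∀ {l} → l ≢ k → f l ≈ G
    f-off {l} l≢k with l Fin.≟ k
    ... | yes l≡k = contradiction l≡k l≢k
    ... | no _    = refl

    xᵢ∣G : x i ^ a ∣ G
    xᵢ∣G = ∣-*ˡ _ (r , *-comm _ _)
      where r = (x k - x i) ^ p * (x k - x j) ^ q

    xⱼ∣G : x j ^ b ∣ G
    xⱼ∣G = _ , *-comm _ _

    xₖ-xᵢ∣G : (x k - x i) ^ p ∣ G
    xₖ-xᵢ∣G = ∣-*ˡ _ (∣-*ˡ _ (_ , *-comm _ _))

    xₖ-xⱼ∣G : (x k - x j) ^ q ∣ G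
    xₖ-xⱼ∣G = ∣-*ˡ _ (∣-*ˡ _ (∣-*ˡ _ ∣-refl))

    xₖ-x∣G : ∀ {l n} → l ≢ k → n ℕ.≤ μ k (just l) ℕ.+ μ l (just k) → (x k - x l) ^ n ∣ G
    xₖ-x∣G {l} l≢k n≤ with exhaust l l≢k
    ... | inj₁ ≡.refl = ∣^-weaken n≤ xₖ-xᵢ∣G
    ... | inj₂ ≡.refl = ∣^-weaken n≤ xₖ-xⱼ∣G

    neg-^-∣ : ∀ {α β f} n → β ≈ - α → α ^ n ∣ f → β ^ n ∣ f
    neg-^-∣ {α} {β} {f} n β≈-α α∣f = ∣-resp₂
      (^-congˡ n (trans (solve 1 (λ a → :- :1 :* a := :- a) α) (sym β≈-α)))
      (solve 1 (λ f → :- :1 :* (:- :1 :* f) := f) f)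
      (∣-scale { - 1#} { - 1#} (solve 0 (:- :1 :* :- :1 := :1)) n (∣-*ˡ (- 1#) α∣f))

    minus-0 : ∀ a → a ≈ a - 0#
    minus-0 = solve 1 (λ a → a := a :- :0)

    f-log : ∀ l y → y ≢ just l → (x l - u y) ^ μ l y ∣ f l - atVertex f y
    f-log l y y≢l = by-cases (l Fin.≟ k) y y≢l
      where
      by-cases : Dec (l ≡ k) → ∀ y → y ≢ just l → (x l - u y) ^ μ l y ∣ f l - atVertex f y
      by-cases (yes ≡.refl) nothing    _   = ∣-respʳ (trans (minus-0 0#) (+-congʳ (sym f-k))) (_ ∣0)
      by-cases (yes ≡.refl) (just l′) y≢k  = ∣-respʳ
        (trans (sym (+-identityˡ _)) (+-cong (sym f-k) (-‿cong (sym (f-off l′≢k)))))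
        (∣-neg (xₖ-x∣G l′≢k (ℕ.m≤m+n (μ k (just l′)) _)))
        where
        l′≢k : l′ ≢ k
        l′≢k ≡.refl = y≢k ≡.refl
      by-cases (no l≢k) nothing _ with exhaust l l≢k
      ... | inj₁ ≡.refl = ∣-resp₂ (^-congˡ a (minus-0 (x i))) (trans (sym (f-off l≢k)) (minus-0 (f i))) xᵢ∣G
      ... | inj₂ ≡.refl = ∣-resp₂ (^-congˡ b (minus-0 (x j))) (trans (sym (f-off l≢k)) (minus-0 (f j))) xⱼ∣G
      by-cases (no l≢k) (just l′) _ = off (l′ Fin.≟ k)
        where
        off : Dec (l′ ≡ k) → (x l - x l′) ^ μ l (just l′) ∣ f l - f l′
        off (yes ≡.refl) = ∣-respʳ (trans (minus-0 G) (+-cong (sym (f-off l≢k)) (-‿cong (sym f-k))))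
          (neg-^-∣ (μ l (just k)) (solve 2 (λ a b → a :- b := :- (b :- a)) (x l) (x k)) (xₖ-x∣G l≢k (ℕ.m≤n+m (μ l (just k)) _)))
        off (no l′≢k) = ∣-respʳ (trans (sym (-‿inverseʳ G)) (+-cong (sym (f-off l≢k)) (-‿cong (sym (f-off l′≢k))))) (_ ∣0)

    log-fromValues : Log μ (fromValues f)
    log-fromValues l y y≢l = ∣-respʳ (sym (difference-cong (value-fromValues f) l y)) (f-log l y y≢l)

    not-surjective : ∀ θ → Log (λ k y → suc (μ k y)) θ → a ℕ.+ b ℕ.< μ i (just j) →
      (∀ η → Log μ η → ∃[ φ ] ∀ l → nabla φ θ l ≈ η l) → I 1#
    not-surjective θ log a+b<n surjective = not-image (surjective (fromValues f) log-fromValues)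
      where
      not-image : (∃[ φ ] ∀ l → nabla φ θ l ≈ fromValues f l) → I 1#
      not-image (φ , ∇≈) = obstruction {a} {b} p q (value φ) a+b<n
          (∣-resp₂ (^-congˡ (suc a) (sym (minus-0 (x i)))) (sym (minus-0 _)) (log i nothing λ ()))
          (∣-resp₂ (^-congˡ (suc b) (sym (minus-0 (x j)))) (sym (minus-0 _)) (log j nothing λ ()))
          (log i (just j) λ { ≡.refl → i≢j ≡.refl })
          (begin
            act (combine (value φ)) (value θ i)  ≈⟨ field-value φ (value θ i) ⟨
            act (vectorField φ) (value θ i)  ≈⟨ value-nabla φ θ i ⟨
            value (nabla φ θ) i  ≈⟨ field-cong ∇≈ (x i) ⟩
            value (fromValues f) i  ≈⟨ value-fromValues f i ⟩
            f i  ≈⟨ f-off (k≢i ∘ ≡.sym) ⟩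
            G  ∎)

-- The polynomial ring

-- The exponent vector of the i-th variable.
unitAt : ∀ {d} → Fin d → Vec ℕ d
unitAt {d} i = Vec.replicate d 0 [ i ]%= suc

-- Product of monomials.
_⊕_ : ∀ {d} → Vec ℕ d → Vec ℕ d → Vec ℕ d
_⊕_ = Vec.zipWith ℕ._+_

-- The exponent vector of the monomial 1.
𝟎 : ∀ {d} → Vec ℕ d
𝟎 {d} = Vec.replicate d 0

⊕-identityˡ : ∀ {d} (e : Vec ℕ d) → 𝟎 ⊕ e ≡ e
⊕-identityˡ = Vec.zipWith-identityˡ ℕ.+-identityˡ

⊕-comm : ∀ {d} (e f : Vec ℕ d) → e ⊕ f ≡ f ⊕ e
⊕-comm = Vec.zipWith-comm ℕ.+-comm

⊕-assoc : ∀ {d} (e f g : Vec ℕ d) → (e ⊕ f) ⊕ g ≡ e ⊕ (f ⊕ g)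
⊕-assoc = Vec.zipWith-assoc ℕ.+-assoc

lookup-⊕ : ∀ {d} (e f : Vec ℕ d) i → Vec.lookup (e ⊕ f) i ≡ Vec.lookup e i ℕ.+ Vec.lookup f i
lookup-⊕ e f i = Vec.lookup-zipWith ℕ._+_ i e f

-- The truncated decrement is harmless on exponents that are nonzero.
pred-⊕ˡ : ∀ {d} (e f : Vec ℕ d) i {n} → Vec.lookup e i ≡ suc n → (e ⊕ f) [ i ]%= pred ≡ (e [ i ]%= pred) ⊕ f
pred-⊕ˡ (suc m ∷ e) (n ∷ f) zero    ≡.refl = ≡.refl
pred-⊕ˡ (m ∷ e)     (n ∷ f) (suc i) eq     = ≡.cong (m ℕ.+ n ∷_) (pred-⊕ˡ e f i eq)

pred-⊕ʳ : ∀ {d} (e f : Vec ℕ d) i {n} → Vec.lookup f i ≡ suc n → (e ⊕ f) [ i ]%= pred ≡ e ⊕ (f [ i ]%= pred)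
pred-⊕ʳ e f i eq = ≡.trans (≡.cong (_[ i ]%= pred) (⊕-comm e f))
  (≡.trans (pred-⊕ˡ f e i eq) (⊕-comm _ e))

unit-⊕-pred : ∀ {d} (e : Vec ℕ d) i {n} → Vec.lookup e i ≡ suc n → unitAt i ⊕ (e [ i ]%= pred) ≡ e
unit-⊕-pred (suc m ∷ e) zero    ≡.refl = ≡.cong (suc m ∷_) (⊕-identityˡ e)
unit-⊕-pred (m ∷ e)     (suc i) eq     = ≡.cong (m ∷_) (unit-⊕-pred e i eq)

sum-pred : ∀ {d} (e : Vec ℕ d) i {n} → Vec.lookup e i ≡ suc n → suc (Vec.sum (e [ i ]%= pred)) ≡ Vec.sum e
sum-pred (suc m ∷ e) zero    ≡.refl = ≡.refl
sum-pred (m ∷ e)     (suc i) eq     = ≡.trans (≡.sym (ℕ.+-suc m _)) (≡.cong (m ℕ.+_) (sum-pred e i eq))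

lookup-unit-same : ∀ {d} (i : Fin d) → Vec.lookup (unitAt i) i ≡ 1
lookup-unit-same i = ≡.trans (Vec.lookup∘updateAt i (Vec.replicate _ 0)) (≡.cong suc (Vec.lookup-replicate i 0))

lookup-unit-other : ∀ {d} {i j : Fin d} → j ≢ i → Vec.lookup (unitAt i) j ≡ 0
lookup-unit-other {i = i} {j} j≢i =
  ≡.trans (Vec.lookup∘updateAt′ j i j≢i (Vec.replicate _ 0)) (Vec.lookup-replicate j 0)

pred-unit : ∀ {d} (i : Fin d) → unitAt i [ i ]%= pred ≡ 𝟎
pred-unit zero    = ≡.refl
pred-unit (suc i) = ≡.cong (0 ∷_) (pred-unit i)

⊕-unit≢𝟎 : ∀ {d} (e : Vec ℕ d) i → e ⊕ unitAt i ≢ 𝟎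
⊕-unit≢𝟎 (m ∷ e) zero    eq = case ≡.trans (≡.sym (ℕ.+-comm m 1)) (≡.cong Vec.head eq) of λ ()
⊕-unit≢𝟎 (m ∷ e) (suc i) eq = ⊕-unit≢𝟎 e i (≡.cong Vec.tail eq)

module Polynomials {c ℓ : Level} (K : Field c ℓ) (d : ℕ) where

  open DifferentialAlgebra (Field.commutativeRing K)

  P : Set c
  P = Poly K d

  Functional : Set c
  Functional = Vec ℕ d → Carrier

  -- Equality of coefficients, as a record so that both sides can be inferred from the type.
  infix 4 _≋_
  record _≋_ (p q : P) : Set ℓ where
    constructor mk≋
    field
      coefficients : _≈ᴾ_ K p q

  open _≋_ public

  open RawRing (polyRing K d) using ()
    renaming (_+_ to _⊞_; _*_ to _⊠_; -_ to ⊟_; 0# to 𝟘; 1# to 𝟙)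

  -- The value on p of the linear functional with value F e on the monomial e.
  ⟪_⟫ : Functional → P → Carrier
  ⟪ F ⟫ []            = 0#
  ⟪ F ⟫ ((e , a) ∷ p) = a * F e + ⟪ F ⟫ p

  -- The coefficient functional of the monomial e.
  at : Vec ℕ d → Functional
  at e f = if does (Vec.≡-dec ℕ._≟_ f e) then 1# else 0#

  at-same : ∀ e → at e e ≈ 1#
  at-same e with Vec.≡-dec ℕ._≟_ e e
  ... | yes _  = refl
  ... | no e≢e = contradiction ≡.refl e≢e

  at-other : ∀ {e f} → f ≢ e → at e f ≈ 0#
  at-other {e} {f} f≢e with Vec.≡-dec ℕ._≟_ f e
  ... | yes f≡e = contradiction f≡e f≢e
  ... | no _    = refl

  ⟪⟫-at : ∀ p e → ⟪ at e ⟫ p ≈ coeff K p e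
  ⟪⟫-at []            e = refl
  ⟪⟫-at ((f , a) ∷ p) e with does (Vec.≡-dec ℕ._≟_ f e)
  ... | true  = +-cong (*-identityʳ a) (⟪⟫-at p e)
  ... | false = trans (+-cong (zeroʳ a) (⟪⟫-at p e)) (+-identityˡ _)

  ⟪⟫-functional : ∀ {F G} → (∀ e → F e ≈ G e) → ∀ p → ⟪ F ⟫ p ≈ ⟪ G ⟫ p
  ⟪⟫-functional F≈G []            = refl
  ⟪⟫-functional F≈G ((e , a) ∷ p) = +-cong (*-congˡ (F≈G e)) (⟪⟫-functional F≈G p)

  ⟪⟫-functional-+ : ∀ F G p → ⟪ (λ e → F e + G e) ⟫ p ≈ ⟪ F ⟫ p + ⟪ G ⟫ p
  ⟪⟫-functional-+ F G []            = sym (+-identityʳ 0#)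
  ⟪⟫-functional-+ F G ((e , a) ∷ p) = trans (+-congˡ (⟪⟫-functional-+ F G p))
    (solve 5 (λ a f g x y → a :* (f :+ g) :+ (x :+ y) := (a :* f :+ x) :+ (a :* g :+ y)) a (F e) (G e) _ _)

  ⟪⟫-functional-* : ∀ b F p → ⟪ (λ e → b * F e) ⟫ p ≈ b * ⟪ F ⟫ p
  ⟪⟫-functional-* b F []            = sym (zeroʳ b)
  ⟪⟫-functional-* b F ((e , a) ∷ p) = trans (+-congˡ (⟪⟫-functional-* b F p))
    (solve 4 (λ a b f x → a :* (b :* f) :+ b :* x := b :* (a :* f :+ x)) a b (F e) _)

  ⟪⟫-functional-0 : ∀ p → ⟪ (λ _ → 0#) ⟫ p ≈ 0#
  ⟪⟫-functional-0 []            = refl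
  ⟪⟫-functional-0 ((e , a) ∷ p) = trans (+-cong (zeroʳ a) (⟪⟫-functional-0 p)) (+-identityʳ 0#)

  ⟪⟫-swap : ∀ (G : Vec ℕ d → Vec ℕ d → Carrier) p q →
    ⟪ (λ e → ⟪ (λ f → G e f) ⟫ q) ⟫ p ≈ ⟪ (λ f → ⟪ (λ e → G e f) ⟫ p) ⟫ q
  ⟪⟫-swap G []            q = sym (⟪⟫-functional-0 q)
  ⟪⟫-swap G ((e , a) ∷ p) q = begin
    a * ⟪ G e ⟫ q + ⟪ (λ e → ⟪ G e ⟫ q) ⟫ p  ≈⟨ +-cong (sym (⟪⟫-functional-* a (G e) q)) (⟪⟫-swap G p q) ⟩
    ⟪ (λ f → a * G e f) ⟫ q + ⟪ (λ f → ⟪ (λ e → G e f) ⟫ p) ⟫ q  ≈⟨ ⟪⟫-functional-+ _ _ q ⟨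
    ⟪ (λ f → a * G e f + ⟪ (λ e → G e f) ⟫ p) ⟫ q  ∎

  ⟪⟫-+ : ∀ F p q → ⟪ F ⟫ (p ⊞ q) ≈ ⟪ F ⟫ p + ⟪ F ⟫ q
  ⟪⟫-+ F []            q = sym (+-identityˡ _)
  ⟪⟫-+ F ((e , a) ∷ p) q = trans (+-congˡ (⟪⟫-+ F p q)) (sym (+-assoc _ _ _))

  ⟪⟫-neg : ∀ F p → ⟪ F ⟫ (⊟ p) ≈ - ⟪ F ⟫ p
  ⟪⟫-neg F []            = sym -0#≈0#
  ⟪⟫-neg F ((e , a) ∷ p) = trans (+-congˡ (⟪⟫-neg F p))
    (solve 3 (λ a f x → :- a :* f :+ :- x := :- (a :* f :+ x)) a (F e) _)

  ⟪⟫-* : ∀ F p q → ⟪ F ⟫ (p ⊠ q) ≈ ⟪ (λ e → ⟪ (λ f → F (e ⊕ f)) ⟫ q) ⟫ p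
  ⟪⟫-* F []            q = refl
  ⟪⟫-* F ((e , a) ∷ p) q = trans (⟪⟫-+ F (List.map ((e , a) *ᵀ′_) q) (p ⊠ q))
    (+-cong (term q) (⟪⟫-* F p q))
    where
    _*ᵀ′_ = _*ᵀ_ K
    term : ∀ q → ⟪ F ⟫ (List.map ((e , a) *ᵀ′_) q) ≈ a * ⟪ (λ f → F (e ⊕ f)) ⟫ q
    term []            = sym (zeroʳ a)
    term ((f , b) ∷ q) = trans (+-congˡ (term q))
      (solve 4 (λ a b f x → a :* b :* f :+ a :* x := a :* (b :* f :+ x)) a b (F (e ⊕ f)) _)

  -- A functional depends on the collected coefficients only: the terms with the monomial of the
  -- first term are gathered, and the rest is shorter.

  -- The terms of p with a monomial other than e.
  without : Vec ℕ d → P → P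
  without e []            = []
  without e ((f , a) ∷ p) with Vec.≡-dec ℕ._≟_ f e
  ... | yes _ = without e p
  ... | no  _ = (f , a) ∷ without e p

  without-length : ∀ e p → length (without e p) ℕ.≤ length p
  without-length e []            = ℕ.z≤n
  without-length e ((f , a) ∷ p) with Vec.≡-dec ℕ._≟_ f e
  ... | yes _ = ℕ.m≤n⇒m≤1+n (without-length e p)
  ... | no  _ = ℕ.s≤s (without-length e p)

  without-⟪⟫ : ∀ F e p → ⟪ F ⟫ p ≈ coeff K p e * F e + ⟪ F ⟫ (without e p)
  without-⟪⟫ F e []            = solve 1 (λ f → :0 := :0 :* f :+ :0) (F e)
  without-⟪⟫ F e ((f , a) ∷ p) with Vec.≡-dec ℕ._≟_ f e
  ... | yes ≡.refl = trans (+-congˡ (without-⟪⟫ F e p))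
    (solve 4 (λ a f x y → a :* f :+ (x :* f :+ y) := (a :+ x) :* f :+ y) a (F e) (coeff K p e) _)
  ... | no  _      = trans (+-congˡ (without-⟪⟫ F e p))
    (solve 3 (λ a x y → a :+ (x :+ y) := x :+ (a :+ y)) _ _ _)

  without-zero : ∀ e p → (∀ f → coeff K p f ≈ 0#) → ∀ f → coeff K (without e p) f ≈ 0#
  without-zero e p p≈0 f with Vec.≡-dec ℕ._≟_ f e
  ... | yes ≡.refl = absent p
    where
    absent : ∀ p → coeff K (without f p) f ≈ 0#
    absent []            = refl
    absent ((g , a) ∷ p) with Vec.≡-dec ℕ._≟_ g f in eq
    ... | yes _ = absent p
    ... | no  _ rewrite eq = absent p
  ... | no f≢e = begin
    coeff K (without e p) f  ≈⟨ ⟪⟫-at (without e p) f ⟨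
    ⟪ at f ⟫ (without e p)  ≈⟨ solve 1 (λ x → x := :0 :* :0 :+ x) _ ⟩
    0# * 0# + ⟪ at f ⟫ (without e p)  ≈⟨ +-congʳ (*-cong (p≈0 e) (at-other (f≢e ∘ ≡.sym))) ⟨
    coeff K p e * at f e + ⟪ at f ⟫ (without e p)  ≈⟨ without-⟪⟫ (at f) e p ⟨
    ⟪ at f ⟫ p  ≈⟨ ⟪⟫-at p f ⟩
    coeff K p f  ≈⟨ p≈0 f ⟩
    0#  ∎

  ⟪⟫-zero : ∀ F p → (∀ e → coeff K p e ≈ 0#) → ⟪ F ⟫ p ≈ 0#
  ⟪⟫-zero F p = bounded (length p) p ℕ.≤-refl
    where
    bounded : ∀ n p → length p ℕ.≤ n → (∀ e → coeff K p e ≈ 0#) → ⟪ F ⟫ p ≈ 0#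
    bounded n       []               _           _   = refl
    bounded (suc n) ((e , a) ∷ p) (ℕ.s≤s len≤n) p≈0 = begin
      ⟪ F ⟫ q  ≈⟨ without-⟪⟫ F e q ⟩
      coeff K q e * F e + ⟪ F ⟫ (without e q)  ≈⟨ +-cong (trans (*-congʳ (p≈0 e)) (zeroˡ _))
                                                         (bounded n (without e q) shorter (without-zero e q p≈0)) ⟩
      0# + 0#  ≈⟨ +-identityʳ 0# ⟩
      0#  ∎
      where
      q : P
      q = (e , a) ∷ p
      shorter : length (without e q) ℕ.≤ n
      shorter with Vec.≡-dec ℕ._≟_ e e
      ... | yes _  = ℕ.≤-trans (without-length e p) len≤n
      ... | no e≢e = contradiction ≡.refl e≢e

  ⟪⟫-cong : ∀ F {p q} → p ≋ q → ⟪ F ⟫ p ≈ ⟪ F ⟫ q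
  ⟪⟫-cong F {p} {q} p≋q = begin
    ⟪ F ⟫ p  ≈⟨ solve 2 (λ x y → x := (x :+ :- y) :+ y) _ (⟪ F ⟫ q) ⟩
    (⟪ F ⟫ p + - ⟪ F ⟫ q) + ⟪ F ⟫ q  ≈⟨ +-congʳ (trans (sym (difference F)) (⟪⟫-zero F (p ⊞ (⊟ q)) zero-coeff)) ⟩
    0# + ⟪ F ⟫ q  ≈⟨ +-identityˡ _ ⟩
    ⟪ F ⟫ q  ∎
    where
    difference : ∀ F → ⟪ F ⟫ (p ⊞ (⊟ q)) ≈ ⟪ F ⟫ p + - ⟪ F ⟫ q
    difference F = trans (⟪⟫-+ F p (⊟ q)) (+-congˡ (⟪⟫-neg F q))
    zero-coeff : ∀ e → coeff K (p ⊞ (⊟ q)) e ≈ 0#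
    zero-coeff e = begin
      coeff K (p ⊞ (⊟ q)) e  ≈⟨ ⟪⟫-at (p ⊞ (⊟ q)) e ⟨
      ⟪ at e ⟫ (p ⊞ (⊟ q))  ≈⟨ difference (at e) ⟩
      ⟪ at e ⟫ p + - ⟪ at e ⟫ q  ≈⟨ +-cong (trans (⟪⟫-at p e) (coefficients p≋q e)) (-‿cong (⟪⟫-at q e)) ⟩
      coeff K q e + - coeff K q e  ≈⟨ -‿inverseʳ _ ⟩
      0#  ∎

  ⟪⟫-ext : ∀ {p q} → (∀ F → ⟪ F ⟫ p ≈ ⟪ F ⟫ q) → p ≋ q
  ⟪⟫-ext {p} {q} eq = mk≋ λ e → trans (sym (⟪⟫-at p e)) (trans (eq (at e)) (⟪⟫-at q e))

  private
    shift : Functional → Vec ℕ d → Functional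
    shift F e f = F (e ⊕ f)

    cong-⊕ : ∀ (F : Functional) {e f} → e ≡ f → F e ≈ F f
    cong-⊕ F ≡.refl = refl

    ⊠-cong : ∀ {p p′ q q′} → p ≋ p′ → q ≋ q′ → p ⊠ q ≋ p′ ⊠ q′
    ⊠-cong {p} {p′} {q} {q′} p≋p′ q≋q′ = ⟪⟫-ext λ F → begin
      ⟪ F ⟫ (p ⊠ q)  ≈⟨ ⟪⟫-* F p q ⟩
      ⟪ (λ e → ⟪ shift F e ⟫ q) ⟫ p  ≈⟨ ⟪⟫-cong _ p≋p′ ⟩
      ⟪ (λ e → ⟪ shift F e ⟫ q) ⟫ p′  ≈⟨ ⟪⟫-functional (λ e → ⟪⟫-cong (shift F e) q≋q′) p′ ⟩
      ⟪ (λ e → ⟪ shift F e ⟫ q′) ⟫ p′  ≈⟨ ⟪⟫-* F p′ q′ ⟨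
      ⟪ F ⟫ (p′ ⊠ q′)  ∎

    ⊠-comm : ∀ p q → p ⊠ q ≋ q ⊠ p
    ⊠-comm p q = ⟪⟫-ext λ F → begin
      ⟪ F ⟫ (p ⊠ q)  ≈⟨ ⟪⟫-* F p q ⟩
      ⟪ (λ e → ⟪ (λ f → F (e ⊕ f)) ⟫ q) ⟫ p  ≈⟨ ⟪⟫-swap (λ e f → F (e ⊕ f)) p q ⟩
      ⟪ (λ f → ⟪ (λ e → F (e ⊕ f)) ⟫ p) ⟫ q  ≈⟨ ⟪⟫-functional (λ f → ⟪⟫-functional (λ e → cong-⊕ F (⊕-comm e f)) p) q ⟩
      ⟪ (λ f → ⟪ (λ e → F (f ⊕ e)) ⟫ p) ⟫ q  ≈⟨ ⟪⟫-* F q p ⟨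
      ⟪ F ⟫ (q ⊠ p)  ∎

    ⊠-assoc : ∀ p q r → (p ⊠ q) ⊠ r ≋ p ⊠ (q ⊠ r)
    ⊠-assoc p q r = ⟪⟫-ext λ F → begin
      ⟪ F ⟫ ((p ⊠ q) ⊠ r)  ≈⟨ ⟪⟫-* F (p ⊠ q) r ⟩
      ⟪ (λ e → ⟪ shift F e ⟫ r) ⟫ (p ⊠ q)  ≈⟨ ⟪⟫-* _ p q ⟩
      ⟪ (λ e → ⟪ (λ f → ⟪ (λ g → F ((e ⊕ f) ⊕ g)) ⟫ r) ⟫ q) ⟫ p
        ≈⟨ ⟪⟫-functional (λ e → ⟪⟫-functional (λ f → ⟪⟫-functional (λ g → cong-⊕ F (⊕-assoc e f g)) r) q) p ⟩
      ⟪ (λ e → ⟪ (λ f → ⟪ (λ g → F (e ⊕ (f ⊕ g))) ⟫ r) ⟫ q) ⟫ p  ≈⟨ ⟪⟫-functional (λ e → ⟪⟫-* (shift F e) q r) p ⟨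
      ⟪ (λ e → ⟪ shift F e ⟫ (q ⊠ r)) ⟫ p  ≈⟨ ⟪⟫-* F p (q ⊠ r) ⟨
      ⟪ F ⟫ (p ⊠ (q ⊠ r))  ∎

    ⊠-identityˡ : ∀ p → 𝟙 ⊠ p ≋ p
    ⊠-identityˡ p = ⟪⟫-ext λ F → begin
      ⟪ F ⟫ (𝟙 ⊠ p)  ≈⟨ ⟪⟫-* F 𝟙 p ⟩
      1# * ⟪ shift F 𝟎 ⟫ p + 0#  ≈⟨ solve 1 (λ x → :1 :* x :+ :0 := x) _ ⟩
      ⟪ shift F 𝟎 ⟫ p  ≈⟨ ⟪⟫-functional (λ e → cong-⊕ F (⊕-identityˡ e)) p ⟩
      ⟪ F ⟫ p  ∎

    ⊠-distribˡ : ∀ p q r → p ⊠ (q ⊞ r) ≋ (p ⊠ q) ⊞ (p ⊠ r)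
    ⊠-distribˡ p q r = ⟪⟫-ext λ F → begin
      ⟪ F ⟫ (p ⊠ (q ⊞ r))  ≈⟨ ⟪⟫-* F p (q ⊞ r) ⟩
      ⟪ (λ e → ⟪ shift F e ⟫ (q ⊞ r)) ⟫ p  ≈⟨ ⟪⟫-functional (λ e → ⟪⟫-+ (shift F e) q r) p ⟩
      ⟪ (λ e → ⟪ shift F e ⟫ q + ⟪ shift F e ⟫ r) ⟫ p  ≈⟨ ⟪⟫-functional-+ _ _ p ⟩
      ⟪ (λ e → ⟪ shift F e ⟫ q) ⟫ p + ⟪ (λ e → ⟪ shift F e ⟫ r) ⟫ p ≈⟨ +-cong (⟪⟫-* F p q) (⟪⟫-* F p r) ⟨
      ⟪ F ⟫ (p ⊠ q) + ⟪ F ⟫ (p ⊠ r)  ≈⟨ ⟪⟫-+ F (p ⊠ q) (p ⊠ r) ⟨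
      ⟪ F ⟫ ((p ⊠ q) ⊞ (p ⊠ r))  ∎

    trans′ : ∀ {p q r} → p ≋ q → q ≋ r → p ≋ r
    trans′ p≋q q≋r = mk≋ λ e → trans (coefficients p≋q e) (coefficients q≋r e)

    ⊞-cong : ∀ {p p′ q q′} → p ≋ p′ → q ≋ q′ → p ⊞ q ≋ p′ ⊞ q′
    ⊞-cong {p} {p′} {q} {q′} p≋p′ q≋q′ = ⟪⟫-ext λ F →
      trans (⟪⟫-+ F p q) (trans (+-cong (⟪⟫-cong F p≋p′) (⟪⟫-cong F q≋q′)) (sym (⟪⟫-+ F p′ q′)))

    ⊞-comm : ∀ p q → p ⊞ q ≋ q ⊞ p
    ⊞-comm p q = ⟪⟫-ext λ F → trans (⟪⟫-+ F p q) (trans (+-comm _ _) (sym (⟪⟫-+ F q p)))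

    ⊞-assoc : ∀ p q r → (p ⊞ q) ⊞ r ≋ p ⊞ (q ⊞ r)
    ⊞-assoc p q r = ⟪⟫-ext λ F → begin
      ⟪ F ⟫ ((p ⊞ q) ⊞ r)  ≈⟨ trans (⟪⟫-+ F (p ⊞ q) r) (+-congʳ (⟪⟫-+ F p q)) ⟩
      (⟪ F ⟫ p + ⟪ F ⟫ q) + ⟪ F ⟫ r  ≈⟨ +-assoc _ _ _ ⟩
      ⟪ F ⟫ p + (⟪ F ⟫ q + ⟪ F ⟫ r)  ≈⟨ trans (⟪⟫-+ F p (q ⊞ r)) (+-congˡ (⟪⟫-+ F q r)) ⟨
      ⟪ F ⟫ (p ⊞ (q ⊞ r))  ∎

    ⊟-cong : ∀ {p q} → p ≋ q → ⊟ p ≋ ⊟ q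
    ⊟-cong {p} {q} p≋q = ⟪⟫-ext λ F → trans (⟪⟫-neg F p) (trans (-‿cong (⟪⟫-cong F p≋q)) (sym (⟪⟫-neg F q)))

    ⊞-inverseʳ : ∀ p → p ⊞ (⊟ p) ≋ 𝟘
    ⊞-inverseʳ p = ⟪⟫-ext λ F → trans (⟪⟫-+ F p (⊟ p)) (trans (+-congˡ (⟪⟫-neg F p)) (-‿inverseʳ _))

  polynomials-isCommutativeRing : IsCommutativeRing _≋_ _⊞_ _⊠_ ⊟_ 𝟘 𝟙
  polynomials-isCommutativeRing = record
    { isRing = record
      { +-isAbelianGroup = record
        { isGroup = record
          { isMonoid = record
            { isSemigroup = record
              { isMagma = record
                { isEquivalence = record
                  { refl  = mk≋ λ e → refl
                  ; sym   = λ p≋q → mk≋ λ e → sym (coefficients p≋q e)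
                  ; trans = trans′
                  }
                ; ∙-cong = ⊞-cong
                }
              ; assoc = ⊞-assoc
              }
            ; identity = (λ p → mk≋ λ e → refl) , λ p → trans′ (⊞-comm p 𝟘) (mk≋ λ e → refl)
            }
          ; inverse = (λ p → trans′ (⊞-comm (⊟ p) p) (⊞-inverseʳ p)) , ⊞-inverseʳ
          ; ⁻¹-cong = ⊟-cong
          }
        ; comm = ⊞-comm
        }
      ; *-cong = ⊠-cong
      ; *-assoc = ⊠-assoc
      ; *-identity = ⊠-identityˡ , λ p → trans′ (⊠-comm p 𝟙) (⊠-identityˡ p)
      ; distrib = ⊠-distribˡ , λ p q r → trans′
          (⊠-comm (q ⊞ r) p)
          (trans′ (⊠-distribˡ p q r)
            (⊞-cong (⊠-comm p q) (⊠-comm p r)))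
      }
    ; *-comm = ⊠-comm
    }

  polynomials : CommutativeRing c ℓ
  polynomials = record { isCommutativeRing = polynomials-isCommutativeRing }

  module S = DifferentialAlgebra polynomials

  open SemiringMult semiring using (×-assoc-*; ×-congʳ; ×-homo-+)

  ·≈ν* : ∀ n a → n · a ≈ ν n * a
  ·≈ν* n a = sym (trans (×-assoc-* n 1# a) (×-congʳ n (*-identityˡ a)))

  -- The transpose of ∂ᵢ.
  derived : Fin d → Functional → Functional
  derived i F e = ν (Vec.lookup e i) * F (e [ i ]%= pred)

  ⟪⟫-∂ : ∀ F i p → ⟪ F ⟫ (∂ K i p) ≈ ⟪ derived i F ⟫ p
  ⟪⟫-∂ F i []            = refl
  ⟪⟫-∂ F i ((e , a) ∷ p) = +-cong
    (trans (*-congʳ (·≈ν* (Vec.lookup e i) a))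
      (solve 3 (λ n a f → n :* a :* f := a :* (n :* f)) (ν (Vec.lookup e i)) a _))
    (⟪⟫-∂ F i p)

  private
    ∂-cong : ∀ i {p q} → p ≋ q → ∂ K i p ≋ ∂ K i q
    ∂-cong i {p} {q} p≋q = ⟪⟫-ext λ F → trans (⟪⟫-∂ F i p) (trans (⟪⟫-cong _ p≋q) (sym (⟪⟫-∂ F i q)))

    ∂-+ : ∀ i p q → ∂ K i (p ⊞ q) ≋ ∂ K i p ⊞ ∂ K i q
    ∂-+ i p q = ⟪⟫-ext λ F → begin
      ⟪ F ⟫ (∂ K i (p ⊞ q))  ≈⟨ ⟪⟫-∂ F i (p ⊞ q) ⟩
      ⟪ derived i F ⟫ (p ⊞ q)  ≈⟨ ⟪⟫-+ _ p q ⟩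
      ⟪ derived i F ⟫ p + ⟪ derived i F ⟫ q  ≈⟨ +-cong (⟪⟫-∂ F i p) (⟪⟫-∂ F i q) ⟨
      ⟪ F ⟫ (∂ K i p) + ⟪ F ⟫ (∂ K i q)  ≈⟨ ⟪⟫-+ F (∂ K i p) (∂ K i q) ⟨
      ⟪ F ⟫ (∂ K i p ⊞ ∂ K i q)  ∎

    unless-0 : ∀ n {x y : Carrier} → (∀ {m} → n ≡ suc m → x ≡ y) → ν n * x ≈ ν n * y
    unless-0 zero    _  = trans (zeroˡ _) (sym (zeroˡ _))
    unless-0 (suc n) eq = *-congˡ (reflexive (eq ≡.refl))

    derived-⊕ : ∀ F i e f → derived i F (e ⊕ f) ≈
      ν (Vec.lookup e i) * F ((e [ i ]%= pred) ⊕ f) + ν (Vec.lookup f i) * F (e ⊕ (f [ i ]%= pred))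
    derived-⊕ F i e f = begin
      ν (Vec.lookup (e ⊕ f) i) * G  ≈⟨ *-congʳ (reflexive (≡.cong ν (lookup-⊕ e f i))) ⟩
      ν (m ℕ.+ n) * G  ≈⟨ *-congʳ (×-homo-+ 1# m n) ⟩
      (ν m + ν n) * G  ≈⟨ distribʳ G (ν m) (ν n) ⟩
      ν m * G + ν n * G  ≈⟨ +-cong (unless-0 m λ m≡ → ≡.cong F (pred-⊕ˡ e f i m≡))
                                                                 (unless-0 n λ n≡ → ≡.cong F (pred-⊕ʳ e f i n≡)) ⟩
      ν m * F ((e [ i ]%= pred) ⊕ f) + ν n * F (e ⊕ (f [ i ]%= pred)) ∎
      where
      m = Vec.lookup e i
      n = Vec.lookup f i
      G = F ((e ⊕ f) [ i ]%= pred)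

    ∂-leibniz : ∀ i p q → ∂ K i (p ⊠ q) ≋ (∂ K i p ⊠ q) ⊞ (p ⊠ ∂ K i q)
    ∂-leibniz i p q = ⟪⟫-ext λ F → begin
      ⟪ F ⟫ (∂ K i (p ⊠ q))  ≈⟨ ⟪⟫-∂ F i (p ⊠ q) ⟩
      ⟪ derived i F ⟫ (p ⊠ q)  ≈⟨ ⟪⟫-* _ p q ⟩
      ⟪ (λ e → ⟪ (λ f → derived i F (e ⊕ f)) ⟫ q) ⟫ p
        ≈⟨ ⟪⟫-functional (λ e → trans (⟪⟫-functional (derived-⊕ F i e) q) (⟪⟫-functional-+ _ _ q)) p ⟩
      ⟪ (λ e → ⟪ (λ f → ν (Vec.lookup e i) * F ((e [ i ]%= pred) ⊕ f)) ⟫ q + ⟪ derived i (λ f → F (e ⊕ f)) ⟫ q) ⟫ p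
        ≈⟨ ⟪⟫-functional-+ _ _ p ⟩
      ⟪ (λ e → ⟪ (λ f → ν (Vec.lookup e i) * F ((e [ i ]%= pred) ⊕ f)) ⟫ q) ⟫ p + ⟪ (λ e → ⟪ derived i (λ f → F (e ⊕ f)) ⟫ q) ⟫ p
        ≈⟨ +-cong (⟪⟫-functional (λ e → ⟪⟫-functional-* _ _ q) p) (⟪⟫-functional (λ e → sym (⟪⟫-∂ _ i q)) p) ⟩
      ⟪ derived i (λ e → ⟪ (λ f → F (e ⊕ f)) ⟫ q) ⟫ p + ⟪ (λ e → ⟪ (λ f → F (e ⊕ f)) ⟫ (∂ K i q)) ⟫ p
        ≈⟨ +-cong (trans (⟪⟫-* F (∂ K i p) q) (⟪⟫-∂ _ i p)) (⟪⟫-* F p (∂ K i q)) ⟨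
      ⟪ F ⟫ (∂ K i p ⊠ q) + ⟪ F ⟫ (p ⊠ ∂ K i q)  ≈⟨ ⟪⟫-+ F (∂ K i p ⊠ q) (p ⊠ ∂ K i q) ⟨
      ⟪ F ⟫ ((∂ K i p ⊠ q) ⊞ (p ⊠ ∂ K i q))  ∎

  -- The partial derivative with respect to the i-th variable.
  partial : Fin d → S.Derivation
  partial i = record
    { act     = ∂ K i
    ; cong    = ∂-cong i
    ; +-homo  = ∂-+ i
    ; leibniz = ∂-leibniz i
    }

  -- Constant polynomials.
  const : Carrier → P
  const a = (𝟎 , a) ∷ []

  ⟪⟫-const : ∀ F a → ⟪ F ⟫ (const a) ≈ a * F 𝟎
  ⟪⟫-const F a = +-identityʳ _

  ⟪⟫-const-* : ∀ F a p → ⟪ F ⟫ (const a ⊠ p) ≈ a * ⟪ F ⟫ p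
  ⟪⟫-const-* F a p = trans (⟪⟫-* F (const a) p) (trans (+-identityʳ _)
    (*-congˡ (⟪⟫-functional (λ e → reflexive (≡.cong F (⊕-identityˡ e))) p)))

  const-cong : ∀ {a b} → a ≈ b → const a ≋ const b
  const-cong {a} {b} a≈b = ⟪⟫-ext λ F → +-congʳ (*-congʳ a≈b)

  const-+ : ∀ a b → const (a + b) ≋ const a ⊞ const b
  const-+ a b = ⟪⟫-ext λ F → solve 3 (λ a b f → (a :+ b) :* f :+ :0 := a :* f :+ (b :* f :+ :0)) a b (F 𝟎)

  const-* : ∀ a b → const (a * b) ≋ const a ⊠ const b
  const-* a b = ⟪⟫-ext λ F → trans (⟪⟫-const F (a * b)) (sym (trans (⟪⟫-const-* F a (const b))
    (trans (*-congˡ (⟪⟫-const F b)) (sym (*-assoc a b _)))))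

  const-0 : const 0# ≋ 𝟘
  const-0 = ⟪⟫-ext λ F → trans (⟪⟫-const F 0#) (zeroˡ _)

  const-ν : ∀ n → S.ν n ≋ const (ν n)
  const-ν zero    = S.sym const-0
  const-ν (suc n) = S.trans (S.+-congˡ (const-ν n)) (S.sym (const-+ 1# (ν n)))

  const-injective : ∀ {a b} → const a ≋ const b → a ≈ b
  const-injective {a} {b} eq = begin
    a  ≈⟨ *-identityʳ a ⟨
    a * 1#  ≈⟨ ⟪⟫-const (λ _ → 1#) a ⟨
    ⟪ (λ _ → 1#) ⟫ (const a)  ≈⟨ ⟪⟫-cong (λ _ → 1#) eq ⟩
    ⟪ (λ _ → 1#) ⟫ (const b)  ≈⟨ ⟪⟫-const (λ _ → 1#) b ⟩
    b * 1#  ≈⟨ *-identityʳ b ⟩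
    b  ∎

  ⟪⟫-sum : ∀ F {n} (t : Vector P n) → ⟪ F ⟫ (S.sum t) ≈ sum λ i → ⟪ F ⟫ (t i)
  ⟪⟫-sum F {zero}  t = refl
  ⟪⟫-sum F {suc n} t = trans (⟪⟫-+ F (t zero) _) (+-congˡ (⟪⟫-sum F (t ∘ suc)))

  const-sum : ∀ {n} (a : Vector Carrier n) → const (sum a) ≋ S.sum (const ∘ a)
  const-sum {zero}  a = const-0
  const-sum {suc n} a = S.trans (const-+ (a zero) _) (S.+-congˡ (const-sum (a ∘ suc)))

  ⟪⟫-form : ∀ F (α : Vector Carrier d) → ⟪ F ⟫ (toPoly K α) ≈ sum λ i → α i * F (unitAt i)
  ⟪⟫-form F α = tabulated unitAt α
    where
    tabulated : ∀ {n} (g : Fin n → Vec ℕ d) (α : Vector Carrier n) →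
      ⟪ F ⟫ (List.tabulate λ i → g i , α i) ≈ sum λ i → α i * F (g i)
    tabulated {zero}  g α = refl
    tabulated {suc n} g α = +-congˡ (tabulated (g ∘ suc) (α ∘ suc))

  form-cong : ∀ {α β : Vector Carrier d} → (∀ i → α i ≈ β i) → toPoly K α ≋ toPoly K β
  form-cong {α} {β} α≈β = ⟪⟫-ext λ F → trans (⟪⟫-form F α)
    (trans (sum-cong-≋ λ i → *-congʳ (α≈β i)) (sym (⟪⟫-form F β)))

  form-scale : ∀ a (α : Vector Carrier d) → toPoly K (λ i → a * α i) ≋ const a ⊠ toPoly K α
  form-scale a α = ⟪⟫-ext λ F → begin
    ⟪ F ⟫ (toPoly K λ i → a * α i)  ≈⟨ ⟪⟫-form F _ ⟩
    sum (λ i → a * α i * F (unitAt i))  ≈⟨ sum-cong-≋ (λ i → *-assoc a (α i) _) ⟩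
    sum (λ i → a * (α i * F (unitAt i)))  ≈⟨ *-distribˡ-sum a (λ i → α i * F (unitAt i)) ⟨
    a * sum (λ i → α i * F (unitAt i))  ≈⟨ *-congˡ (⟪⟫-form F α) ⟨
    a * ⟪ F ⟫ (toPoly K α)  ≈⟨ ⟪⟫-const-* F a (toPoly K α) ⟨
    ⟪ F ⟫ (const a ⊠ toPoly K α)  ∎

  form-+ : ∀ (α β : Vector Carrier d) → toPoly K (λ i → α i + β i) ≋ toPoly K α ⊞ toPoly K β
  form-+ α β = ⟪⟫-ext λ F → begin
    ⟪ F ⟫ (toPoly K λ i → α i + β i)  ≈⟨ ⟪⟫-form F _ ⟩
    sum (λ i → (α i + β i) * F (unitAt i))  ≈⟨ sum-cong-≋ (λ i → distribʳ _ (α i) (β i)) ⟩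
    sum (λ i → α i * F (unitAt i) + β i * F (unitAt i))  ≈⟨ ∑-distrib-+ (λ i → α i * F (unitAt i)) _ ⟩
    sum (λ i → α i * F (unitAt i)) + sum (λ i → β i * F (unitAt i))  ≈⟨ +-cong (⟪⟫-form F α) (⟪⟫-form F β) ⟨
    ⟪ F ⟫ (toPoly K α) + ⟪ F ⟫ (toPoly K β)  ≈⟨ ⟪⟫-+ F (toPoly K α) (toPoly K β) ⟨
    ⟪ F ⟫ (toPoly K α ⊞ toPoly K β)  ∎

  form-zero : ∀ {α : Vector Carrier d} → (∀ i → α i ≈ 0#) → toPoly K α ≋ 𝟘
  form-zero {α} α≈0 = ⟪⟫-ext λ F → trans (⟪⟫-form F α)
    (trans (sum-cong-≋ λ i → trans (*-congʳ (α≈0 i)) (zeroˡ _)) (sum-0 d))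

  form-neg : ∀ (α : Vector Carrier d) → toPoly K (λ i → - α i) ≋ S.- toPoly K α
  form-neg α = ⟪⟫-ext λ F → begin
    ⟪ F ⟫ (toPoly K λ i → - α i)  ≈⟨ ⟪⟫-form F _ ⟩
    sum (λ i → - α i * F (unitAt i))  ≈⟨ sum-cong-≋ (λ i → solve 2 (λ a f → :- a :* f := :- :1 :* (a :* f)) (α i) (F (unitAt i))) ⟩
    sum (λ i → - 1# * (α i * F (unitAt i)))  ≈⟨ *-distribˡ-sum (- 1#) (λ i → α i * F (unitAt i)) ⟨
    - 1# * sum (λ i → α i * F (unitAt i))  ≈⟨ *-congˡ (⟪⟫-form F α) ⟨
    - 1# * ⟪ F ⟫ (toPoly K α)  ≈⟨ solve 1 (λ a → :- :1 :* a := :- a) _ ⟩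
    - ⟪ F ⟫ (toPoly K α)  ≈⟨ ⟪⟫-neg F (toPoly K α) ⟨
    ⟪ F ⟫ (S.- toPoly K α)  ∎

  form-sub : ∀ (α β : Vector Carrier d) → toPoly K (λ i → α i - β i) ≋ toPoly K α S.- toPoly K β
  form-sub α β = S.trans (form-+ α (λ i → - β i))
    (S.+-cong {toPoly K α} {toPoly K α} {toPoly K (λ i → - β i)} {S.- toPoly K β} S.refl (form-neg β))

  ∂-const : ∀ i a → ∂ K i (const a) ≋ 𝟘
  ∂-const i a = ⟪⟫-ext λ F → trans (⟪⟫-∂ F i (const a)) (trans (⟪⟫-const (derived i F) a)
    (trans (*-congˡ (trans (*-congʳ (reflexive (≡.cong ν (Vec.lookup-replicate i 0)))) (zeroˡ _))) (zeroʳ a)))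

  ∂-form : ∀ i α → ∂ K i (toPoly K α) ≋ const (α i)
  ∂-form i α = ⟪⟫-ext λ F → begin
    ⟪ F ⟫ (∂ K i (toPoly K α))  ≈⟨ ⟪⟫-∂ F i (toPoly K α) ⟩
    ⟪ derived i F ⟫ (toPoly K α)  ≈⟨ ⟪⟫-form (derived i F) α ⟩
    sum (λ j → α j * derived i F (unitAt j))  ≈⟨ sum-single i (λ j j≢i → trans (*-congˡ (trans
      (*-congʳ (reflexive (≡.cong ν (lookup-unit-other (j≢i ∘ ≡.sym))))) (zeroˡ _))) (zeroʳ _)) ⟩
    α i * derived i F (unitAt i)
      ≈⟨ *-congˡ (*-cong (reflexive (≡.cong ν (lookup-unit-same i))) (reflexive (≡.cong F (pred-unit i)))) ⟩
    α i * ((1# + 0#) * F 𝟎)  ≈⟨ solve 2 (λ a f → a :* ((:1 :+ :0) :* f) := a :* f) (α i) (F 𝟎) ⟩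
    α i * F 𝟎  ≈⟨ ⟪⟫-const F (α i) ⟨
    ⟪ F ⟫ (const (α i))  ∎

  apply-form : ∀ (θ : Der K d) α → apply K θ (toPoly K α) ≋ S.sum λ i → const (α i) ⊠ θ i
  apply-form θ α = S.sum-cong-≋ λ i → S.trans (S.*-congˡ {x = θ i} (∂-form i α)) (S.*-comm (θ i) (const (α i)))

  -- The derivative along a vector.
  along : Vector Carrier d → S.Derivation
  along v = S.linearCombination (const ∘ v) partial

  -- All functionals supported in degrees at least n vanish on p, that is, p has degree below n.
  DegreeBelow : ℕ → P → Set (c ⊔ ℓ)
  DegreeBelow n p = ∀ F → (∀ e → Vec.sum e ℕ.< n → F e ≈ 0#) → ⟪ F ⟫ p ≈ 0#

  degreeBound : ∀ p → ∃[ n ] DegreeBelow n p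
  degreeBound []            = 0 , λ F _ → refl
  degreeBound ((e , a) ∷ p) with degreeBound p
  ... | n , p<n = suc (Vec.sum e) ℕ.+ n , λ F F≈0 → trans
    (+-cong (trans (*-congˡ (F≈0 e (ℕ.m≤m+n _ n))) (zeroʳ a))
            (p<n F λ f f<n → F≈0 f (ℕ.≤-trans f<n (ℕ.m≤n+m n _))))
    (+-identityʳ 0#)

  along-degree : ∀ v n p → DegreeBelow (suc n) p → DegreeBelow n (S.act (along v) p)
  along-degree v n p p<1+n F F≈0 = begin
    ⟪ F ⟫ (S.sum λ i → const (v i) ⊠ ∂ K i p)  ≈⟨ ⟪⟫-sum F (λ i → const (v i) ⊠ ∂ K i p) ⟩
    sum (λ i → ⟪ F ⟫ (const (v i) ⊠ ∂ K i p))  ≈⟨ sum-cong-≋ (λ i → ⟪⟫-const-* F (v i) (∂ K i p)) ⟩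
    sum (λ i → v i * ⟪ F ⟫ (∂ K i p))  ≈⟨ sum-cong-≋ (λ i → trans (*-congˡ (vanish i)) (zeroʳ _)) ⟩
    sum {d} (λ i → 0#)  ≈⟨ sum-0 d ⟩
    0#  ∎
    where
    derived≈0 : ∀ i e m → Vec.lookup e i ≡ m → Vec.sum e ℕ.< suc n → derived i F e ≈ 0#
    derived≈0 i e zero    eq _ = trans (*-congʳ (reflexive (≡.cong ν eq))) (zeroˡ _)
    derived≈0 i e (suc m) eq (ℕ.s≤s e≤n) = trans (*-congˡ (F≈0 _
      (ℕ.≤-trans (ℕ.≤-reflexive (sum-pred e i eq)) e≤n))) (zeroʳ _)
    vanish : ∀ i → ⟪ F ⟫ (∂ K i p) ≈ 0#
    vanish i = trans (⟪⟫-∂ F i p) (p<1+n (derived i F) λ e → derived≈0 i e _ ≡.refl)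

  iterate-degree : ∀ v p m k → DegreeBelow (m ℕ.+ k) p → DegreeBelow k (S.iterate (along v) m p)
  iterate-degree v p zero    k p<k = p<k
  iterate-degree v p (suc m) k p<k = along-degree v k (S.iterate (along v) m p)
    (iterate-degree v p m (suc k) (≡.subst (λ l → DegreeBelow l p) (≡.sym (ℕ.+-suc m k)) p<k))

  degreeBelow-0 : ∀ {p} → DegreeBelow 0 p → p ≋ 𝟘
  degreeBelow-0 p<0 = ⟪⟫-ext λ F → p<0 F λ _ ()

  along-nilpotent : ∀ v → S.LocallyNilpotent (along v)
  along-nilpotent v p = let n , p<n = degreeBound p in
    n , degreeBelow-0 (iterate-degree v p n 0 (≡.subst (λ m → DegreeBelow m p) (≡.sym (ℕ.+-identityʳ n)) p<n))

  -- The derivation Σᵢ Xᵢ ∂ᵢ, where Xᵢ are the variables.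
  eulerField : S.Derivation
  eulerField = S.linearCombination (λ i → (unitAt i , 1#) ∷ []) partial

  ⟪⟫-euler : ∀ F p → ⟪ F ⟫ (S.act eulerField p) ≈ ⟪ (λ e → ν (Vec.sum e) * F e) ⟫ p
  ⟪⟫-euler F p = begin
    ⟪ F ⟫ (S.act eulerField p)  ≈⟨ ⟪⟫-sum F (λ i → x i ⊠ ∂ K i p) ⟩
    sum (λ i → ⟪ F ⟫ (x i ⊠ ∂ K i p))  ≈⟨ sum-cong-≋ term ⟩
    sum (λ i → ⟪ (λ e → ν (Vec.lookup e i) * F e) ⟫ p)  ≈⟨ collect d (λ i e → ν (Vec.lookup e i) * F e) ⟨
    ⟪ (λ e → sum λ i → ν (Vec.lookup e i) * F e) ⟫ p  ≈⟨ ⟪⟫-functional (λ e → trans (sym (*-distribʳ-sum {d} (F e) (λ i → ν (Vec.lookup e i)))) (*-congʳ (total-degree e))) p ⟩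
    ⟪ (λ e → ν (Vec.sum e) * F e) ⟫ p  ∎
    where
    x : Fin d → P
    x i = (unitAt i , 1#) ∷ []
    term : ∀ i → ⟪ F ⟫ (x i ⊠ ∂ K i p) ≈ ⟪ (λ e → ν (Vec.lookup e i) * F e) ⟫ p
    term i = begin
      ⟪ F ⟫ (x i ⊠ ∂ K i p)  ≈⟨ ⟪⟫-* F (x i) (∂ K i p) ⟩
      1# * ⟪ (λ f → F (unitAt i ⊕ f)) ⟫ (∂ K i p) + 0#  ≈⟨ solve 1 (λ a → :1 :* a :+ :0 := a) _ ⟩
      ⟪ (λ f → F (unitAt i ⊕ f)) ⟫ (∂ K i p)  ≈⟨ ⟪⟫-∂ _ i p ⟩
      ⟪ derived i (λ f → F (unitAt i ⊕ f)) ⟫ p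
        ≈⟨ ⟪⟫-functional (λ e → unless-0 (Vec.lookup e i) λ eq → ≡.cong F (unit-⊕-pred e i eq)) p ⟩
      ⟪ (λ e → ν (Vec.lookup e i) * F e) ⟫ p  ∎
    collect : ∀ n (G : Fin n → Functional) → ⟪ (λ e → sum λ i → G i e) ⟫ p ≈ sum λ i → ⟪ G i ⟫ p
    collect zero    G = ⟪⟫-functional-0 p
    collect (suc n) G = trans (⟪⟫-functional-+ (G zero) _ p) (+-congˡ (collect n (G ∘ suc)))
    total-degree : ∀ {n} (e : Vec ℕ n) → sum (λ i → ν (Vec.lookup e i)) ≈ ν (Vec.sum e)
    total-degree []      = refl
    total-degree (m ∷ e) = trans (+-congˡ (total-degree e)) (sym (×-homo-+ 1# m (Vec.sum e)))

  euler-form : ∀ α → S.act eulerField (toPoly K α) ≋ toPoly K α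
  euler-form α = ⟪⟫-ext λ F → begin
    ⟪ F ⟫ (S.act eulerField (toPoly K α))  ≈⟨ ⟪⟫-euler F (toPoly K α) ⟩
    ⟪ (λ e → ν (Vec.sum e) * F e) ⟫ (toPoly K α)  ≈⟨ ⟪⟫-form _ α ⟩
    sum (λ i → α i * (ν (Vec.sum (unitAt i)) * F (unitAt i)))
      ≈⟨ sum-cong-≋ {d} (λ i → *-congˡ (trans (*-congʳ (trans (reflexive (≡.cong ν (sum-unit i))) (+-identityʳ 1#))) (*-identityˡ _))) ⟩
    sum (λ i → α i * F (unitAt i))  ≈⟨ ⟪⟫-form F α ⟨
    ⟪ F ⟫ (toPoly K α)  ∎
    where
    sum-zero : ∀ n → Vec.sum (Vec.replicate n 0) ≡ 0
    sum-zero zero    = ≡.refl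
    sum-zero (suc n) = sum-zero n
    sum-unit : ∀ {n} (i : Fin n) → Vec.sum (unitAt i) ≡ 1
    sum-unit {suc n} zero    = ≡.cong suc (sum-zero n)
    sum-unit {suc n} (suc i) = sum-unit i

  -- A linear form has no constant term.
  forms-proper : ∀ α β {p q} → ¬ (p ⊠ toPoly K α) ⊞ (q ⊠ toPoly K β) ≋ 𝟙
  forms-proper α β {p} {q} eq = Field.1≉0 K (begin
    1#  ≈⟨ solve 0 (:1 := :1 :* :1 :+ :0) ⟩
    1# * 1# + 0#  ≈⟨ +-congʳ (*-congˡ (at-same 𝟎)) ⟨
    ⟪ at 𝟎 ⟫ 𝟙  ≈⟨ ⟪⟫-cong (at 𝟎) eq ⟨
    ⟪ at 𝟎 ⟫ ((p ⊠ toPoly K α) ⊞ (q ⊠ toPoly K β))  ≈⟨ ⟪⟫-+ (at 𝟎) (p ⊠ toPoly K α) _ ⟩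
    ⟪ at 𝟎 ⟫ (p ⊠ toPoly K α) + ⟪ at 𝟎 ⟫ (q ⊠ toPoly K β)  ≈⟨ +-cong (multiple p α) (multiple q β) ⟩
    0# + 0#  ≈⟨ +-identityʳ 0# ⟩
    0#  ∎)
    where
    multiple : ∀ p α → ⟪ at 𝟎 ⟫ (p ⊠ toPoly K α) ≈ 0#
    multiple p α = begin
      ⟪ at 𝟎 ⟫ (p ⊠ toPoly K α)  ≈⟨ ⟪⟫-* (at 𝟎) p (toPoly K α) ⟩
      ⟪ (λ e → ⟪ (λ f → at 𝟎 (e ⊕ f)) ⟫ (toPoly K α)) ⟫ p  ≈⟨ ⟪⟫-functional (λ e → trans (⟪⟫-form _ α)
        (trans (sum-cong-≋ {d} λ i → trans (*-congˡ (at-other (⊕-unit≢𝟎 e i))) (zeroʳ _)) (sum-0 d))) p ⟩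
      ⟪ (λ _ → 0#) ⟫ p  ≈⟨ ⟪⟫-functional-0 p ⟩
      0#  ∎

  module _ (characteristicZero : CharacteristicZero K) where

    private
      inverse-ν : ∀ n → ∃[ y ] ν (suc n) * y ≈ 1#
      inverse-ν n = Field.inverse K (ν (suc n)) (characteristicZero n)

    recip : ℕ → P
    recip n = const (proj₁ (inverse-ν n))

    recip-inverse : ∀ n → recip n ⊠ S.ν (suc n) ≋ 𝟙
    recip-inverse n = S.trans (S.*-cong {recip n} {recip n} {S.ν (suc n)} {const (ν (suc n))} S.refl (const-ν (suc n)))
      (S.trans (S.sym (const-* (proj₁ (inverse-ν n)) (ν (suc n))))
        (const-cong (trans (*-comm _ _) (proj₂ (inverse-ν n)))))

    reciprocals : S.Reciprocals
    reciprocals = record { recip = recip ; recip-inverse = recip-inverse }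

    ν-cancel : ∀ m n {a} → m ≢ n → ν m * a ≈ ν n * a → a ≈ 0#
    ν-cancel zero    zero    m≢n _  = contradiction ≡.refl m≢n
    ν-cancel zero    (suc n) m≢n eq = begin
      _  ≈⟨ *-identityˡ _ ⟨
      1# * _  ≈⟨ *-congʳ (trans (*-comm _ _) (proj₂ (inverse-ν n))) ⟨
      y * ν (suc n) * _  ≈⟨ trans (*-assoc y _ _) (*-congˡ (sym eq)) ⟩
      y * (0# * _)  ≈⟨ trans (*-congˡ (zeroˡ _)) (zeroʳ y) ⟩
      0#  ∎
      where y = proj₁ (inverse-ν n)
    ν-cancel (suc m) zero    m≢n eq = ν-cancel zero (suc m) (m≢n ∘ ≡.sym) (sym eq)
    ν-cancel (suc m) (suc n) {a} m≢n eq = ν-cancel m n (m≢n ∘ ≡.cong suc) (begin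
      ν m * a  ≈⟨ solve 2 (λ m a → m :* a := (:1 :+ m) :* a :- a) (ν m) a ⟩
      ν (suc m) * a - a  ≈⟨ +-congʳ eq ⟩
      ν (suc n) * a - a  ≈⟨ solve 2 (λ m a → (:1 :+ m) :* a :- a := m :* a) (ν n) a ⟩
      ν n * a  ∎)

    -- Euler's formula characterizes homogeneous polynomials in characteristic zero.
    homogeneous : ∀ k p → S.act eulerField p S.≈ S.ν k S.* p → HomogeneousPoly K k p
    homogeneous k p eq e e≢k = ν-cancel (Vec.sum e) k e≢k (begin
      ν (Vec.sum e) * coeff K p e  ≈⟨ *-congˡ (⟪⟫-at p e) ⟨
      ν (Vec.sum e) * ⟪ at e ⟫ p  ≈⟨ ⟪⟫-functional-* (ν (Vec.sum e)) (at e) p ⟨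
      ⟪ (λ f → ν (Vec.sum e) * at e f) ⟫ p  ≈⟨ ⟪⟫-functional concentrate p ⟩
      ⟪ (λ f → ν (Vec.sum f) * at e f) ⟫ p  ≈⟨ ⟪⟫-euler (at e) p ⟨
      ⟪ at e ⟫ (S.act eulerField p)  ≈⟨ ⟪⟫-cong (at e) eq ⟩
      ⟪ at e ⟫ (S.ν k ⊠ p)  ≈⟨ ⟪⟫-cong (at e) (S.*-cong {S.ν k} {const (ν k)} {p} {p} (const-ν k) S.refl) ⟩
      ⟪ at e ⟫ (const (ν k) ⊠ p)  ≈⟨ ⟪⟫-const-* (at e) (ν k) p ⟩
      ν k * ⟪ at e ⟫ p  ≈⟨ *-congˡ (⟪⟫-at p e) ⟩
      ν k * coeff K p e  ∎)
      where
      concentrate : ∀ f → ν (Vec.sum e) * at e f ≈ ν (Vec.sum f) * at e f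
      concentrate f with Vec.≡-dec ℕ._≟_ f e
      ... | yes ≡.refl = refl
      ... | no _       = trans (zeroʳ _) (sym (zeroʳ _))

-- The complete graph on four vertices

-- The planes as the edges of the complete graph on the vertices 0, 1, 2, 3, where vertex 0 stands
-- for the zero form and the others for the coordinates.
ends : Fin 6 → Fin 4 × Fin 4
ends 0F = 1F , 0F
ends 1F = 2F , 0F
ends 2F = 3F , 0F
ends 3F = 1F , 2F
ends 4F = 2F , 3F
ends 5F = 1F , 3F

-- The edge between two distinct vertices; the value on the diagonal is irrelevant.
edge : Fin 4 → Fin 4 → Fin 6
edge 0F 1F = 0F
edge 0F 2F = 1F
edge 0F 3F = 2F
edge 1F 0F = 0F
edge 1F 2F = 3F
edge 1F 3F = 5F
edge 2F 0F = 1F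
edge 2F 1F = 3F
edge 2F 3F = 4F
edge 3F 0F = 2F
edge 3F 1F = 5F
edge 3F 2F = 4F
edge _  _  = 0F

-- The transposition of the vertices 0 and v.
swap : Fin 4 → Fin 4 → Fin 4
swap v zero    = v
swap v (suc k) with suc k Fin.≟ v
... | yes _ = zero
... | no _  = suc k

-- The edges avoiding a vertex, and those at a vertex.
triangle star : Fin 4 → Subset 6
triangle v = Vec.tabulate λ H → not (does (v Fin.≟ proj₁ (ends H)) ∨ does (v Fin.≟ proj₂ (ends H)))
star v     = ⊤ ─ triangle v

-- H contains H₁ ∩ H₂: either H is one of them, or the three edges form a triangle.
Spanned : Fin 6 → Fin 6 → Fin 6 → Set
Spanned H₁ H₂ H = H ≡ H₁ ⊎ H ≡ H₂ ⊎ (∃[ a ] ∃[ b ] ∃[ c ]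
  a ≢ b × b ≢ c × a ≢ c × H₁ ≡ edge a b × H₂ ≡ edge b c × H ≡ edge a c)

spanned? : ∀ H₁ H₂ H → Dec (Spanned H₁ H₂ H)
spanned? H₁ H₂ H = H Fin.≟ H₁ ⊎-dec H Fin.≟ H₂ ⊎-dec
  Fin.any? λ a → Fin.any? λ b → Fin.any? λ c →
    ¬? (a Fin.≟ b) ×-dec ¬? (b Fin.≟ c) ×-dec ¬? (a Fin.≟ c) ×-dec
    H₁ Fin.≟ edge a b ×-dec H₂ Fin.≟ edge b c ×-dec H Fin.≟ edge a c

-- A set of vertices contains both ends of an edge, or neither.
SameSide : Subset 4 → Fin 6 → Set
SameSide B H = Vec.lookup B (proj₁ (ends H)) ≡ Vec.lookup B (proj₂ (ends H))

sameSide? : ∀ B H → Dec (SameSide B H)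
sameSide? B H = _ Bool.≟ _

-- The indicator function of a set of vertices is a point of H₁ ∩ H₂ outside H.
Separated : Fin 6 → Fin 6 → Fin 6 → Set
Separated H₁ H₂ H = ∃[ B ] SameSide B H₁ × SameSide B H₂ × ¬ SameSide B H

separated? : ∀ H₁ H₂ H → Dec (Separated H₁ H₂ H)
separated? H₁ H₂ H = anySubset? λ B → sameSide? B H₁ ×-dec sameSide? B H₂ ×-dec ¬? (sameSide? B H)

-- Finite facts are proved by evaluating a decision procedure on all cases. They are abstract so
-- that the evaluated proofs are never unfolded.
abstract
  spanned-or-separated : ∀ H₁ H₂ H → Spanned H₁ H₂ H ⊎ Separated H₁ H₂ H
  spanned-or-separated = from-yes (Fin.all? λ H₁ → Fin.all? λ H₂ → Fin.all? λ H →
    spanned? H₁ H₂ H ⊎-dec separated? H₁ H₂ H)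

-- The planes containing the intersection of two planes.
closure : Fin 6 → Fin 6 → Subset 6
closure H₁ H₂ = Vec.tabulate λ H → does (spanned? H₁ H₂ H)

∈-closure⁺ : ∀ {H₁ H₂ H} → Spanned H₁ H₂ H → H ∈ closure H₁ H₂
∈-closure⁺ {H₁} {H₂} {H} spanned = Vec.lookup⇒[]= H (closure H₁ H₂)
  (≡.trans (Vec.lookup∘tabulate (λ H → does (spanned? H₁ H₂ H)) H) (dec-true (spanned? H₁ H₂ H) spanned))

∈-closure⁻ : ∀ {H₁ H₂ H} → H ∈ closure H₁ H₂ → Spanned H₁ H₂ H
∈-closure⁻ {H₁} {H₂} {H} H∈ = witness (spanned? H₁ H₂ H)
  (≡.trans (≡.sym (Vec.lookup∘tabulate (λ H → does (spanned? H₁ H₂ H)) H)) (Vec.[]=⇒lookup H∈))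
  where
  witness : ∀ {P : Set} (P? : Dec P) → does P? ≡ true → P
  witness (yes p) _ = p

_≟ˢ_ : ∀ {n} (B C : Subset n) → Dec (B ≡ C)
_≟ˢ_ = Vec.≡-dec Bool._≟_

-- The rank two flats through an edge of star v and an edge of triangle v.
abstract
  flats : ∀ v H′ H″ → H′ ∈ star v → H″ ∈ triangle v →
    closure H′ H″ ≡ ⁅ H′ ⁆ ∪ ⁅ H″ ⁆ ⊎
    (∃[ i ] ∃[ j ] i ≢ j × H″ ≡ edge (swap v (suc i)) (swap v (suc j)) ×
      star v ∩ closure H′ H″ ≡ ⁅ edge (swap v (suc i)) v ⁆ ∪ ⁅ edge (swap v (suc j)) v ⁆)
  flats = from-yes (Fin.all? λ v → Fin.all? λ H′ → Fin.all? λ H″ →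
    H′ ∈? star v →-dec H″ ∈? triangle v →-dec
    (closure H′ H″ ≟ˢ (⁅ H′ ⁆ ∪ ⁅ H″ ⁆) ⊎-dec
     Fin.any? λ i → Fin.any? λ j → ¬? (i Fin.≟ j) ×-dec
       H″ Fin.≟ edge (swap v (suc i)) (swap v (suc j)) ×-dec
       (star v ∩ closure H′ H″) ≟ˢ (⁅ edge (swap v (suc i)) v ⁆ ∪ ⁅ edge (swap v (suc j)) v ⁆)))

-- Conversely, two distinct vertices of the triangle and the vertex v span a flat of three planes.
abstract
  triple-flats : ∀ v i j → i ≢ j →
    let H′ = edge (swap v (suc i)) v ; H″ = edge (swap v (suc i)) (swap v (suc j)) in
    H′ ∈ star v × H″ ∈ triangle v × closure H′ H″ ≢ ⁅ H′ ⁆ ∪ ⁅ H″ ⁆ ×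
    star v ∩ closure H′ H″ ≡ ⁅ H′ ⁆ ∪ ⁅ edge (swap v (suc j)) v ⁆ ×
    H′ ≢ edge (swap v (suc j)) v
  triple-flats = from-yes (Fin.all? λ v → Fin.all? λ i → Fin.all? λ j → ¬? (i Fin.≟ j) →-dec
    let H′ = edge (swap v (suc i)) v ; H″ = edge (swap v (suc i)) (swap v (suc j)) in
    H′ ∈? star v ×-dec H″ ∈? triangle v ×-dec ¬? (closure H′ H″ ≟ˢ (⁅ H′ ⁆ ∪ ⁅ H″ ⁆)) ×-dec
    (star v ∩ closure H′ H″) ≟ˢ (⁅ H′ ⁆ ∪ ⁅ edge (swap v (suc j)) v ⁆) ×-dec
    ¬? (H′ Fin.≟ edge (swap v (suc j)) v))

star-edges-distinct : ∀ v i j → i ≢ j → edge (swap v (suc i)) v ≢ edge (swap v (suc j)) v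
star-edges-distinct v i j i≢j = proj₂ (proj₂ (proj₂ (proj₂ (triple-flats v i j i≢j))))

-- The flat of two disjoint edges contains no further edge.
abstract
  disjoint-spanned : ∀ H →
    (Spanned 0F 4F H → H ≡ 0F ⊎ H ≡ 4F) × (Spanned 1F 5F H → H ≡ 1F ⊎ H ≡ 5F) ×
    (Spanned 2F 3F H → H ≡ 2F ⊎ H ≡ 3F)
  disjoint-spanned = from-yes (Fin.all? λ H →
    (spanned? 0F 4F H →-dec (H Fin.≟ 0F ⊎-dec H Fin.≟ 4F)) ×-dec
    (spanned? 1F 5F H →-dec (H Fin.≟ 1F ⊎-dec H Fin.≟ 5F)) ×-dec
    (spanned? 2F 3F H →-dec (H Fin.≟ 2F ⊎-dec H Fin.≟ 3F)))

-- A set meeting the three pairs of disjoint edges is a triangle or contains a star.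
abstract
  triangle-or-star : ∀ B → 0F ∈ B ⊎ 4F ∈ B → 1F ∈ B ⊎ 5F ∈ B → 2F ∈ B ⊎ 3F ∈ B →
    (∃[ v ] B ≡ triangle v) ⊎ (∃[ v ] star v ⊆ B)
  triangle-or-star B = decidable-stable (claim? B) λ ¬claim → from-yes (¬? (anySubset? λ B → ¬? (claim? B))) (B , ¬claim)
    where
    claim? : ∀ B → Dec (0F ∈ B ⊎ 4F ∈ B → 1F ∈ B ⊎ 5F ∈ B → 2F ∈ B ⊎ 3F ∈ B →
      (∃[ v ] B ≡ triangle v) ⊎ (∃[ v ] star v ⊆ B))
    claim? B = (0F ∈? B ⊎-dec 4F ∈? B) →-dec (1F ∈? B ⊎-dec 5F ∈? B) →-dec (2F ∈? B ⊎-dec 3F ∈? B) →-dec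
      (Fin.any? (λ v → B ≟ˢ triangle v) ⊎-dec Fin.any? (λ v → star v ⊆? B))

abstract
  swap-involutive : ∀ v x → swap v (swap v x) ≡ x
  swap-involutive = from-yes (Fin.all? λ v → Fin.all? λ x → swap v (swap v x) Fin.≟ x)

swap-injective : ∀ v {x y} → swap v x ≡ swap v y → x ≡ y
swap-injective v {x} {y} eq = ≡.trans (≡.sym (swap-involutive v x))
  (≡.trans (≡.cong (swap v) eq) (swap-involutive v y))

abstract
  ends-edge : ∀ a b → a ≢ b → ends (edge a b) ≡ (a , b) ⊎ ends (edge a b) ≡ (b , a)
  ends-edge = from-yes (Fin.all? λ a → Fin.all? λ b → ¬? (a Fin.≟ b) →-dec
    (ends (edge a b) ≟ (a , b) ⊎-dec ends (edge a b) ≟ (b , a)))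
    where
    _≟_ : (p q : Fin 4 × Fin 4) → Dec (p ≡ q)
    _≟_ = ≡-dec Fin._≟_ Fin._≟_

-- Every edge joins the image of a vertex other than 0 under the transposition to another one.
abstract
  edge-between : ∀ v H → ∃[ i ] ∃[ y ] y ≢ suc i × H ≡ edge (swap v (suc i)) (swap v y)
  edge-between = from-yes (Fin.all? λ v → Fin.all? λ H → Fin.any? λ i → Fin.any? λ y →
    ¬? (y Fin.≟ suc i) ×-dec H Fin.≟ edge (swap v (suc i)) (swap v y))

abstract
  third-index : ∀ (i j : Fin 3) → i ≢ j → ∃[ k ] k ≢ i × k ≢ j × (∀ l → l ≢ k → l ≡ i ⊎ l ≡ j)
  third-index = from-yes (Fin.all? {n = 3} λ i → Fin.all? {n = 3} λ j → ¬? (i Fin.≟ j) →-dec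
    Fin.any? {n = 3} λ k → ¬? (k Fin.≟ i) ×-dec ¬? (k Fin.≟ j) ×-dec
      Fin.all? {n = 3} λ l → ¬? (l Fin.≟ k) →-dec (l Fin.≟ i ⊎-dec l Fin.≟ j))

abstract
  star-edges : ∀ v x → x ≢ v → edge x v ∈ star v
  star-edges = from-yes (Fin.all? λ v → Fin.all? λ x → ¬? (x Fin.≟ v) →-dec edge x v ∈? star v)

module Totals {c ℓ : Level} (K : Field c ℓ) where

  total-⊥ : ∀ {n} (μ : Multiplicity K n) → total K μ ⊥ ≡ 0
  total-⊥ {zero}  μ = ≡.refl
  total-⊥ {suc n} μ = total-⊥ (μ ∘ suc)

  total-⁅⁆ : ∀ {n} (μ : Multiplicity K n) H → total K μ ⁅ H ⁆ ≡ μ H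
  total-⁅⁆ μ zero    = ≡.trans (≡.cong (μ zero ℕ.+_) (total-⊥ (μ ∘ suc))) (ℕ.+-identityʳ _)
  total-⁅⁆ μ (suc H) = total-⁅⁆ (μ ∘ suc) H

  ∪-⊥ : ∀ {n} (B : Subset n) → B ∪ ⊥ ≡ B
  ∪-⊥ = Vec.zipWith-identityʳ Bool.∨-identityʳ

  ⊥-∪ : ∀ {n} (B : Subset n) → ⊥ ∪ B ≡ B
  ⊥-∪ = Vec.zipWith-identityˡ Bool.∨-identityˡ

  total-pair : ∀ {n} (μ : Multiplicity K n) {H H′} → H ≢ H′ → total K μ (⁅ H ⁆ ∪ ⁅ H′ ⁆) ≡ μ H ℕ.+ μ H′
  total-pair μ {zero}  {zero}   H≢H′ = contradiction ≡.refl H≢H′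
  total-pair μ {zero}  {suc H′} H≢H′ = ≡.cong (μ zero ℕ.+_)
    (≡.trans (≡.cong (total K (μ ∘ suc)) (⊥-∪ ⁅ H′ ⁆)) (total-⁅⁆ (μ ∘ suc) H′))
  total-pair μ {suc H} {zero}   H≢H′ = ≡.trans (≡.cong (μ zero ℕ.+_)
    (≡.trans (≡.cong (total K (μ ∘ suc)) (∪-⊥ ⁅ H ⁆)) (total-⁅⁆ (μ ∘ suc) H))) (ℕ.+-comm (μ zero) _)
  total-pair μ {suc H} {suc H′} H≢H′ = total-pair (μ ∘ suc) (H≢H′ ∘ ≡.cong suc)

-- The geometry of the arrangement

module Geometry {c ℓ : Level} (K : Field c ℓ) (A : Arrangement K 3 6) (coxeter : IsCoxeterA₃ K A) where

  open DifferentialAlgebra (Field.commutativeRing K)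
  open Arrangement A
  open IsCoxeterA₃ coxeter

  -- The values of the four vertex forms at a point with the given coordinates.
  vertexValue : Space K 3 → Fin 4 → Carrier
  vertexValue a zero    = 0#
  vertexValue a (suc k) = a k

  -- The values of the vertex forms at a point of the space of the arrangement.
  pt : Space K 3 → Fin 4 → Carrier
  pt w = vertexValue (linearMap K g w)

  A₃-form-value : ∀ H a → eval K (A₃-form K H) a ≈
    vertexValue a (proj₁ (ends H)) - vertexValue a (proj₂ (ends H))
  A₃-form-value 0F a = solve 3 (λ a b c → :1 :* a :+ (:0 :* b :+ (:0 :* c :+ :0)) := a :- :0) (a 0F) (a 1F) (a 2F)
  A₃-form-value 1F a = solve 3 (λ a b c → :0 :* a :+ (:1 :* b :+ (:0 :* c :+ :0)) := b :- :0) (a 0F) (a 1F) (a 2F)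
  A₃-form-value 2F a = solve 3 (λ a b c → :0 :* a :+ (:0 :* b :+ (:1 :* c :+ :0)) := c :- :0) (a 0F) (a 1F) (a 2F)
  A₃-form-value 3F a = solve 3 (λ a b c → :1 :* a :+ (:- :1 :* b :+ (:0 :* c :+ :0)) := a :- b) (a 0F) (a 1F) (a 2F)
  A₃-form-value 4F a = solve 3 (λ a b c → :0 :* a :+ (:1 :* b :+ (:- :1 :* c :+ :0)) := b :- c) (a 0F) (a 1F) (a 2F)
  A₃-form-value 5F a = solve 3 (λ a b c → :1 :* a :+ (:0 :* b :+ (:- :1 :* c :+ :0)) := a :- c) (a 0F) (a 1F) (a 2F)

  a-b≈0⇒a≈b : ∀ {a b} → a - b ≈ 0# → a ≈ b
  a-b≈0⇒a≈b {a} {b} eq = begin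
    a  ≈⟨ solve 2 (λ a b → a := (a :- b) :+ b) a b ⟩
    (a - b) + b  ≈⟨ +-congʳ eq ⟩
    0# + b  ≈⟨ +-identityˡ b ⟩
    b  ∎

  a≈b⇒a-b≈0 : ∀ {a b} → a ≈ b → a - b ≈ 0#
  a≈b⇒a-b≈0 {a} {b} eq = trans (+-congʳ eq) (-‿inverseʳ b)

  on-plane⁺ : ∀ H w → pt w (proj₁ (ends H)) ≈ pt w (proj₂ (ends H)) → hyperplane H w
  on-plane⁺ H w eq = proj₂ (planes H) {w} (trans (A₃-form-value H (linearMap K g w)) (a≈b⇒a-b≈0 eq))

  on-plane⁻ : ∀ H w → hyperplane H w → pt w (proj₁ (ends H)) ≈ pt w (proj₂ (ends H))
  on-plane⁻ H w w∈H = a-b≈0⇒a≈b (trans (sym (A₃-form-value H (linearMap K g w))) (proj₁ (planes H) {w} w∈H))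

  on-edge⁺ : ∀ a b w → a ≢ b → pt w a ≈ pt w b → hyperplane (edge a b) w
  on-edge⁺ a b w a≢b eq = on-plane⁺ (edge a b) w (by (ends (edge a b)) (ends-edge a b a≢b))
    where
    by : ∀ e → e ≡ (a , b) ⊎ e ≡ (b , a) → pt w (proj₁ e) ≈ pt w (proj₂ e)
    by _ (inj₁ ≡.refl) = eq
    by _ (inj₂ ≡.refl) = sym eq

  on-edge⁻ : ∀ a b w → a ≢ b → hyperplane (edge a b) w → pt w a ≈ pt w b
  on-edge⁻ a b w a≢b w∈ = by (ends (edge a b)) (ends-edge a b a≢b) (on-plane⁻ (edge a b) w w∈)
    where
    by : ∀ e → e ≡ (a , b) ⊎ e ≡ (b , a) → pt w (proj₁ e) ≈ pt w (proj₂ e) → pt w a ≈ pt w b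
    by _ (inj₁ ≡.refl) eq = eq
    by _ (inj₂ ≡.refl) eq = sym eq

  -- The point at which the vertex forms take prescribed values, up to a common shift.
  realize : (Fin 4 → Carrier) → Space K 3
  realize p = linearMap K g⁻¹ λ k → p (suc k) - p zero

  pt-realize : ∀ p x → pt (realize p) x ≈ p x - p zero
  pt-realize p zero    = sym (-‿inverseʳ _)
  pt-realize p (suc k) = inverseʳ (λ k → p (suc k) - p zero) k

  -- H contains the intersection of H₁ and H₂.
  Contains : Fin 6 → Fin 6 → Fin 6 → Set _
  Contains H₁ H₂ H = ∀ w → hyperplane H₁ w × hyperplane H₂ w → hyperplane H w

  spanned⇒contains : ∀ {H₁ H₂ H} → Spanned H₁ H₂ H → Contains H₁ H₂ H
  spanned⇒contains (inj₁ ≡.refl) w (w∈H₁ , _) = w∈H₁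
  spanned⇒contains (inj₂ (inj₁ ≡.refl)) w (_ , w∈H₂) = w∈H₂
  spanned⇒contains (inj₂ (inj₂ (a , b , c , a≢b , b≢c , a≢c , ≡.refl , ≡.refl , ≡.refl))) w (w∈H₁ , w∈H₂) =
    on-edge⁺ a c w a≢c (trans (on-edge⁻ a b w a≢b w∈H₁) (on-edge⁻ b c w b≢c w∈H₂))

  separated⇒¬contains : ∀ {H₁ H₂ H} → Separated H₁ H₂ H → ¬ Contains H₁ H₂ H
  separated⇒¬contains {H₁} {H₂} {H} (B , same₁ , same₂ , ¬same) contains =
    distinct-values ¬same (on-plane⁻ H (realize p) (contains (realize p)
      (on-plane⁺ H₁ (realize p) (equal-values same₁) , on-plane⁺ H₂ (realize p) (equal-values same₂))))
    where
    value : Bool → Carrier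
    value b = if b then 1# else 0#
    p : Fin 4 → Carrier
    p x = value (Vec.lookup B x)
    equal-values : ∀ {x y} → Vec.lookup B x ≡ Vec.lookup B y → pt (realize p) x ≈ pt (realize p) y
    equal-values {x} {y} eq = trans (pt-realize p x)
      (trans (+-congʳ (reflexive (≡.cong value eq))) (sym (pt-realize p y)))
    values-differ : ∀ a b → a ≢ b → ¬ value a ≈ value b
    values-differ true  true  a≢b _  = a≢b ≡.refl
    values-differ true  false _   eq = Field.1≉0 K eq
    values-differ false true  _   eq = Field.1≉0 K (sym eq)
    values-differ false false a≢b _  = a≢b ≡.refl
    distinct-values : ∀ {x y} → Vec.lookup B x ≢ Vec.lookup B y → ¬ pt (realize p) x ≈ pt (realize p) y
    distinct-values {x} {y} neq eq = values-differ _ _ neq (begin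
      p x  ≈⟨ solve 2 (λ a b → a := (a :- b) :+ b) (p x) (p zero) ⟩
      (p x - p zero) + p zero  ≈⟨ +-congʳ (trans (sym (pt-realize p x)) (trans eq (pt-realize p y))) ⟩
      (p y - p zero) + p zero  ≈⟨ solve 2 (λ a b → (a :- b) :+ b := a) (p y) (p zero) ⟩
      p y  ∎)

  contains⇒spanned : ∀ {H₁ H₂ H} → Contains H₁ H₂ H → Spanned H₁ H₂ H
  contains⇒spanned {H₁} {H₂} {H} contains = by (spanned-or-separated H₁ H₂ H)
    where
    by : Spanned H₁ H₂ H ⊎ Separated H₁ H₂ H → Spanned H₁ H₂ H
    by (inj₁ spanned)   = spanned
    by (inj₂ separated) = contradiction contains (separated⇒¬contains {H₁} {H₂} {H} separated)

  closure-localization : ∀ H₁ H₂ → IsLocalization K A H₁ H₂ (closure H₁ H₂)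
  closure-localization H₁ H₂ H = mk⇔
    (λ H∈ {w} → spanned⇒contains {H₁} {H₂} {H} (∈-closure⁻ H∈) w)
    (λ contains → ∈-closure⁺ (contains⇒spanned {H₁} {H₂} {H} λ w → contains {w}))

  localization-unique : ∀ {H₁ H₂ L} → IsLocalization K A H₁ H₂ L → L ≡ closure H₁ H₂
  localization-unique {H₁} {H₂} {L} loc = ⊆-antisym
    (λ {H} H∈ → from (closure-localization H₁ H₂ H) λ {w} → to (loc H) H∈ {w})
    (λ {H} H∈ → from (loc H) λ {w} → to (closure-localization H₁ H₂ H) H∈ {w})

  -- Modularity puts one edge of each disjoint pair into B, and B cannot contain a star, since the
  -- edges of a star only have the origin in common.
  modular-coatom : ∀ {B} → HasRank K A B 2 → ModularStep K A B ⊤ → ∃[ v ] B ≡ triangle v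
  modular-coatom {B} (n , n+2≡3 , b , basis) modular = conclude
      (triangle-or-star B (meets (λ H → proj₁ (disjoint-spanned H)) λ ())
                          (meets (λ H → proj₁ (proj₂ (disjoint-spanned H))) λ ())
                          (meets (λ H → proj₂ (proj₂ (disjoint-spanned H))) λ ()))
    where
    open IsBasis basis
    meets : ∀ {H H′} → (∀ H″ → Spanned H H′ H″ → H″ ≡ H ⊎ H″ ≡ H′) → H ≢ H′ → H ∈ B ⊎ H′ ∈ B
    meets {H} {H′} disjoint H≢H′ =
      let H″ , H″∈B , contains = modular {H} {H′} ∈⊤ ∈⊤ H≢H′ in
      by H″∈B (disjoint H″ (contains⇒spanned {H} {H′} {H″} λ w → contains {w}))
      where
      by : ∀ {H″} → H″ ∈ B → H″ ≡ H ⊎ H″ ≡ H′ → H ∈ B ⊎ H′ ∈ B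
      by H″∈B (inj₁ ≡.refl) = inj₁ H″∈B
      by H″∈B (inj₂ ≡.refl) = inj₂ H″∈B
    centre-trivial : ∀ {v} → star v ⊆ B → ∀ w → centre B w → ∀ i → w i ≈ 0#
    centre-trivial {v} star⊆B w w∈ i = begin
      w i  ≈⟨ inverseˡ w i ⟨
      linearMap K g⁻¹ (linearMap K g w) i  ≈⟨ sum-cong-≋ (λ k → trans (*-congˡ {g⁻¹ i k} (trans (at-v (suc k)) (sym (at-v zero)))) (zeroʳ _)) ⟩
      sum {3} (λ k → 0#)  ≈⟨ solve 0 (:0 :+ (:0 :+ (:0 :+ :0)) := :0) ⟩
      0#  ∎
      where
      at-v : ∀ x → pt w x ≈ pt w v
      at-v x with x Fin.≟ v
      ... | yes ≡.refl = refl
      ... | no x≢v     = on-edge⁻ x v w x≢v (w∈ (edge x v) (star⊆B (star-edges v x x≢v)))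
    rank-contradiction : ∀ {n} (b : Vector (Space K 3) n) → n ℕ.+ 2 ≡ 3 →
      (∀ a → (∀ i → combination K a b i ≈ 0#) → ∀ j → a j ≈ 0#) →
      ¬ (∀ j i → b j i ≈ 0#)
    rank-contradiction {suc n} b _ independent b≈0 = Field.1≉0 K
      (independent (λ _ → 1#) (λ i → trans (sum-cong-≋ λ j → trans (*-congˡ {1#} (b≈0 j i)) (zeroʳ _)) (sum-0 (suc n))) zero)
    conclude : (∃[ v ] B ≡ triangle v) ⊎ (∃[ v ] star v ⊆ B) → ∃[ v ] B ≡ triangle v
    conclude (inj₁ triangle) = triangle
    conclude (inj₂ (v , star⊆B)) = contradiction
      (λ j i → centre-trivial {v} (λ {H} → star⊆B {H}) (b j) (member j) i) (rank-contradiction b n+2≡3 independent)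

  eval-sub : ∀ (α β : LinearForm K 3) w → eval K (λ i → α i - β i) w ≈ eval K α w - eval K β w
  eval-sub α β w = solve 9 (λ a b c a′ b′ c′ x y z →
    (a :- a′) :* x :+ ((b :- b′) :* y :+ ((c :- c′) :* z :+ :0)) :=
    (a :* x :+ (b :* y :+ (c :* z :+ :0))) :- (a′ :* x :+ (b′ :* y :+ (c′ :* z :+ :0))))
    (α 0F) (α 1F) (α 2F) (β 0F) (β 1F) (β 2F) (w 0F) (w 1F) (w 2F)

  eval-comb : ∀ (α : LinearForm K 3) (a : Vector Carrier 3) (b : Vector (Space K 3) 3) →
    eval K α (λ i → sum λ k → a k * b k i) ≈ sum λ k → a k * eval K α (b k)
  eval-comb α a b = begin
    sum (λ i → α i * sum (λ k → a k * b k i))  ≈⟨ sum-cong-≋ (λ i → *-distribˡ-sum (α i) (λ k → a k * b k i)) ⟩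
    sum (λ i → sum (λ k → α i * (a k * b k i)))  ≈⟨ ∑-comm (λ i k → α i * (a k * b k i)) ⟩
    sum (λ k → sum (λ i → α i * (a k * b k i)))
      ≈⟨ sum-cong-≋ (λ k → trans (sum-cong-≋ λ i → solve 3 (λ α a b → α :* (a :* b) := a :* (α :* b)) (α i) (a k) (b k i))
           (sym (*-distribˡ-sum (a k) (λ i → α i * b k i)))) ⟩
    sum (λ k → a k * eval K α (b k))  ∎

  eval-zero : ∀ (w : Space K 3) → eval K (λ _ → 0#) w ≈ 0#
  eval-zero w = solve 3 (λ x y z → :0 :* x :+ (:0 :* y :+ (:0 :* z :+ :0)) := :0) (w 0F) (w 1F) (w 2F)

  -- The standard basis.
  standard : Fin 3 → Fin 3 → Carrier
  standard 0F 0F = 1#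
  standard 1F 1F = 1#
  standard 2F 2F = 1#
  standard _  _  = 0#
  eval-standard : ∀ γ i → eval K γ (standard i) ≈ γ i
  eval-standard γ 0F = solve 3 (λ a b c → a :* :1 :+ (b :* :0 :+ (c :* :0 :+ :0)) := a) (γ 0F) (γ 1F) (γ 2F)
  eval-standard γ 1F = solve 3 (λ a b c → a :* :0 :+ (b :* :1 :+ (c :* :0 :+ :0)) := b) (γ 0F) (γ 1F) (γ 2F)
  eval-standard γ 2F = solve 3 (λ a b c → a :* :0 :+ (b :* :0 :+ (c :* :1 :+ :0)) := c) (γ 0F) (γ 1F) (γ 2F)

  -- Two forms with the same kernel are proportional once one of them takes the value 1.
  proportional : ∀ {α β : LinearForm K 3} {v} → eval K β v ≈ 1# →
    (∀ w → eval K β w ≈ 0# → eval K α w ≈ 0#) → ∀ i → α i ≈ eval K α v * β i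
  proportional {α} {β} {v} βv≈1 ker⊆ i = a-b≈0⇒a≈b (begin
    α i - eval K α v * β i  ≈⟨ value α ⟨
    eval K α w  ≈⟨ ker⊆ w (begin
      eval K β w  ≈⟨ value β ⟩
      β i - eval K β v * β i  ≈⟨ +-congˡ (-‿cong (trans (*-congʳ βv≈1) (*-identityˡ _))) ⟩
      β i - β i  ≈⟨ -‿inverseʳ _ ⟩
      0#  ∎) ⟩
    0#  ∎)
    where
    w : Space K 3
    w j = standard i j - β i * v j
    value : ∀ γ → eval K γ w ≈ γ i - eval K γ v * β i
    value γ = begin
      eval K γ w  ≈⟨ solve 10 (λ a b c x y z s t u e →
          a :* (x :- e :* s) :+ (b :* (y :- e :* t) :+ (c :* (z :- e :* u) :+ :0)) :=
          (a :* x :+ (b :* y :+ (c :* z :+ :0))) :- (a :* s :+ (b :* t :+ (c :* u :+ :0))) :* e)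
          (γ 0F) (γ 1F) (γ 2F) (standard i 0F) (standard i 1F) (standard i 2F) (v 0F) (v 1F) (v 2F) (β i) ⟩
      eval K γ (standard i) - eval K γ v * β i  ≈⟨ +-congʳ (eval-standard γ i) ⟩
      γ i - eval K γ v * β i  ∎

  module Frame (v : Fin 4) where

    σ : Fin 4 → Fin 4
    σ = swap v

    -- The forms u_x, with u_0 = 0.
    vertexForm : Fin 4 → LinearForm K 3
    vertexForm zero    i = 0#
    vertexForm (suc k) i = g k i

    eval-vertexForm : ∀ x w → eval K (vertexForm x) w ≈ pt w x
    eval-vertexForm zero    w = eval-zero w
    eval-vertexForm (suc k) w = refl

    -- The vertex forms after moving v to the vertex 0, by a transposition and a translation.
    form′ : Fin 4 → LinearForm K 3
    form′ x i = vertexForm (σ x) i - vertexForm v i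

    -- The coordinates centred at v.
    coord : Fin 3 → LinearForm K 3
    coord k = form′ (suc k)

    eval-form′ : ∀ x w → eval K (form′ x) w ≈ pt w (σ x) - pt w v
    eval-form′ x w = trans (eval-sub (vertexForm (σ x)) (vertexForm v) w)
      (+-cong (eval-vertexForm (σ x) w) (-‿cong (eval-vertexForm v w)))

    -- The indicator function of the k-th remaining vertex.
    δ : Fin 3 → Fin 4 → Carrier
    δ k x = if does (x Fin.≟ σ (suc k)) then 1# else 0#

    δ-same : ∀ k → δ k (σ (suc k)) ≈ 1#
    δ-same k with σ (suc k) Fin.≟ σ (suc k)
    ... | yes _ = refl
    ... | no ≢  = contradiction ≡.refl ≢

    δ-other : ∀ {k x} → x ≢ suc k → δ k (σ x) ≈ 0#
    δ-other {k} {x} x≢ with σ x Fin.≟ σ (suc k)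
    ... | yes eq = contradiction (swap-injective v eq) x≢
    ... | no _   = refl

    -- The dual basis of the coordinates.
    basis : Fin 3 → Space K 3
    basis k = realize (δ k)

    eval-basis : ∀ x k → eval K (form′ x) (basis k) ≈ δ k (σ x)
    eval-basis x k = begin
      eval K (form′ x) (basis k)  ≈⟨ eval-form′ x (basis k) ⟩
      pt (basis k) (σ x) - pt (basis k) v  ≈⟨ +-cong (pt-realize (δ k) (σ x)) (-‿cong (pt-realize (δ k) v)) ⟩
      (δ k (σ x) - δ k zero) - (δ k v - δ k zero)  ≈⟨ solve 3 (λ a b c → (a :- b) :- (c :- b) := a :- c) (δ k (σ x)) (δ k zero) (δ k v) ⟩
      δ k (σ x) - δ k v  ≈⟨ +-congˡ (-‿cong (δ-other {k} {zero} λ ())) ⟩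
      δ k (σ x) - 0#  ≈⟨ solve 1 (λ a → a :- :0 := a) (δ k (σ x)) ⟩
      δ k (σ x)  ∎

    dual-same : ∀ k → eval K (coord k) (basis k) ≈ 1#
    dual-same k = trans (eval-basis (suc k) k) (δ-same k)

    dual-other : ∀ {k j} → k ≢ j → eval K (coord j) (basis k) ≈ 0#
    dual-other {k} {j} k≢j = trans (eval-basis (suc j) k) (δ-other λ eq → k≢j (≡.sym (Fin.suc-injective eq)))

    -- A point is determined by its coordinates, so the basis spans.
    complete : ∀ w i → sum (λ k → eval K (coord k) w * basis k i) ≈ w i
    complete w i = begin
      w′ i  ≈⟨ inverseˡ w′ i ⟨
      linearMap K g⁻¹ (linearMap K g w′) i  ≈⟨ sum-cong-≋ (λ k → *-congˡ {g⁻¹ i k} (same-pt (suc k))) ⟩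
      linearMap K g⁻¹ (linearMap K g w) i  ≈⟨ inverseˡ w i ⟩
      w i  ∎
      where
      w′ : Space K 3
      w′ i = sum λ k → eval K (coord k) w * basis k i
      same-coord : ∀ j → eval K (coord j) w′ ≈ eval K (coord j) w
      same-coord j = begin
        eval K (coord j) w′  ≈⟨ eval-comb (coord j) (λ k → eval K (coord k) w) basis ⟩
        sum (λ k → eval K (coord k) w * eval K (coord j) (basis k))
          ≈⟨ sum-single j {λ k → eval K (coord k) w * eval K (coord j) (basis k)} (λ k k≢j → trans (*-congˡ (dual-other k≢j)) (zeroʳ _)) ⟩
        eval K (coord j) w * eval K (coord j) (basis j)  ≈⟨ trans (*-congˡ (dual-same j)) (*-identityʳ _) ⟩
        eval K (coord j) w  ∎
      relative : ∀ y → pt w′ (σ y) - pt w′ v ≈ pt w (σ y) - pt w v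
      relative zero    = trans (-‿inverseʳ _) (sym (-‿inverseʳ _))
      relative (suc j) = trans (sym (eval-form′ (suc j) w′)) (trans (same-coord j) (eval-form′ (suc j) w))
      relative′ : ∀ x → pt w′ x - pt w′ v ≈ pt w x - pt w v
      relative′ x = ≡.subst (λ x → pt w′ x - pt w′ v ≈ pt w x - pt w v) (swap-involutive v x) (relative (σ x))
      same-pt : ∀ x → pt w′ x ≈ pt w x
      same-pt x = begin
        pt w′ x  ≈⟨ solve 2 (λ a b → a := (a :- b) :- (:0 :- b)) (pt w′ x) (pt w′ v) ⟩
        (pt w′ x - pt w′ v) - (0# - pt w′ v)  ≈⟨ +-cong (relative′ x) (-‿cong (relative′ zero)) ⟩
        (pt w x - pt w v) - (0# - pt w v)  ≈⟨ solve 2 (λ a b → (a :- b) :- (:0 :- b) := a) (pt w x) (pt w v) ⟩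
        pt w x  ∎

    -- The plane through the k-th vertex and the vertex y, both after the transposition.
    plane : Fin 3 → Fin 4 → Fin 6
    plane k y = edge (σ (suc k)) (σ y)

    -- The defining form of a plane is a nonzero multiple of the difference of coordinates.
    record Proportional (k : Fin 3) (y : Fin 4) : Set (c ⊔ ℓ) where
      field
        factor  : Carrier
        inv     : Carrier
        inverse : inv * factor ≈ 1#
        form≈   : ∀ i → form (plane k y) i ≈ factor * (coord k i - form′ y i)

    plane-form : ∀ k y → y ≢ suc k → Proportional k y
    plane-form k y y≢k = record
      { factor = a ; inv = proj₁ a⁻¹ ; inverse = trans (*-comm _ _) (proj₂ a⁻¹) ; form≈ = α≈aβ }
      where
      α = form (plane k y)
      β : LinearForm K 3
      β i = coord k i - form′ y i
      a = eval K α (basis k)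
      β≈1 : eval K β (basis k) ≈ 1#
      β≈1 = begin
        eval K β (basis k)  ≈⟨ eval-sub (coord k) (form′ y) (basis k) ⟩
        eval K (coord k) (basis k) - eval K (form′ y) (basis k)  ≈⟨ +-cong (dual-same k) (-‿cong (trans (eval-basis y k) (δ-other y≢k))) ⟩
        1# - 0#  ≈⟨ solve 0 (:1 :- :0 := :1) ⟩
        1#  ∎
      ker⊆ : ∀ w → eval K β w ≈ 0# → eval K α w ≈ 0#
      ker⊆ w β≈0 = on-edge⁺ (σ (suc k)) (σ y) w (λ eq → y≢k (swap-injective v (≡.sym eq))) (begin
        pt w (σ (suc k))  ≈⟨ solve 3 (λ a b c → a := ((a :- c) :- (b :- c)) :+ b) _ (pt w (σ y)) (pt w v) ⟩
        ((pt w (σ (suc k)) - pt w v) - (pt w (σ y) - pt w v)) + pt w (σ y)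
          ≈⟨ +-congʳ (trans (sym (trans (eval-sub (coord k) (form′ y) w) (+-cong (eval-form′ (suc k) w) (-‿cong (eval-form′ y w))))) β≈0) ⟩
        0# + pt w (σ y)  ≈⟨ +-identityˡ _ ⟩
        pt w (σ y)  ∎)
      α≈aβ : ∀ i → α i ≈ a * β i
      α≈aβ = proportional {α} {β} {basis k} β≈1 ker⊆
      a≉0 : a ≉ 0#
      a≉0 a≈0 = nonzero (plane k y) λ i → trans (α≈aβ i) (trans (*-congʳ a≈0) (zeroˡ _))
      a⁻¹ : ∃[ b ] a * b ≈ 1#
      a⁻¹ = Field.inverse K a a≉0

-- Universal derivations and the equalities

open import Data.Nat.Base using (_+_)

-- Logarithmic derivations of the arrangement in the coordinates centred at the vertex v.
module LogarithmicDerivations {c ℓ : Level} (K : Field c ℓ) (characteristicZero : CharacteristicZero K)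
  (A : Arrangement K 3 6) (coxeter : IsCoxeterA₃ K A) (v : Fin 4) where

  module F = DifferentialAlgebra (Field.commutativeRing K)
  open Polynomials K 3 hiding (P)
  open S hiding (_+_)
  open Arrangement A
  open Geometry K A coxeter using (standard; eval-standard)
  open Geometry.Frame K A coxeter v public

  -- The coordinates as polynomials.
  x : Fin 3 → Poly K 3
  x k = toPoly K (coord k)

  private
    const-dot : ∀ (a b : Vector F.Carrier 3) →
      sum (λ i → const (a i) * const (b i)) ≈ const (F.sum λ i → a i F.* b i)
    const-dot a b = trans (sum-cong-≋ λ i → sym (const-* (a i) (b i))) (sym (const-sum λ i → a i F.* b i))

    standard-same : ∀ i → standard i i F.≈ F.1#
    standard-same 0F = F.refl
    standard-same 1F = F.refl
    standard-same 2F = F.refl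

    standard-other : ∀ {i j} → j ≢ i → standard j i F.≈ F.0#
    standard-other {0F} {0F} j≢i = contradiction ≡.refl j≢i
    standard-other {0F} {1F} _   = F.refl
    standard-other {0F} {2F} _   = F.refl
    standard-other {1F} {0F} _   = F.refl
    standard-other {1F} {1F} j≢i = contradiction ≡.refl j≢i
    standard-other {1F} {2F} _   = F.refl
    standard-other {2F} {0F} _   = F.refl
    standard-other {2F} {1F} _   = F.refl
    standard-other {2F} {2F} j≢i = contradiction ≡.refl j≢i

    dual-same′ : ∀ k → sum (λ i → const (coord k i) * const (basis k i)) ≈ 1#
    dual-same′ k = trans (const-dot (coord k) (basis k)) (const-cong (dual-same k))

    dual-other′ : ∀ {k j} → k ≢ j → sum (λ i → const (coord j i) * const (basis k i)) ≈ 0#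
    dual-other′ {k} {j} k≢j = trans (const-dot (coord j) (basis k)) (trans (const-cong (dual-other k≢j)) const-0)

    complete′ : ∀ i j → sum (λ k → const (basis k i) * const (coord k j)) ≈ const (standard j i)
    complete′ i j = trans (const-dot (λ k → basis k i) (λ k → coord k j)) (const-cong (F.trans
      (F.sum-cong-≋ λ k → F.trans (F.*-comm (basis k i) (coord k j)) (F.*-congʳ (F.sym (eval-standard (coord k) j))))
      (complete (standard j) i)))

  -- The coordinates centred at v and their dual basis, in the polynomial ring.
  linearCoordinates : LinearCoordinates 3
  linearCoordinates = record
    { partial        = partial
    ; x              = x
    ; L              = λ k i → const (coord k i)
    ; B              = λ k i → const (basis k i)
    ; partial-x      = λ i k → ∂-form i (coord k)
    ; L-const        = λ j k i → ∂-const j (coord k i)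
    ; dual-same      = dual-same′
    ; dual-other     = dual-other′
    ; complete-same  = λ i → trans (complete′ i i) (const-cong (standard-same i))
    ; complete-other = λ {i} {j} j≢i → trans (complete′ i j) (trans (const-cong (standard-other j≢i)) const-0)
    ; nilpotent      = λ k → along-nilpotent (basis k)
    }

  open VectorFields polynomials (reciprocals characteristicZero) linearCoordinates public


  -- The origin is the vertex 0.
  vertex : Vertex → Fin 4
  vertex = maybe′ suc zero

  vertex≢ : ∀ {k} y → y ≢ just k → vertex y ≢ suc k
  vertex≢ nothing  _   = λ ()
  vertex≢ (just j) y≢k = λ eq → y≢k (≡.cong just (Fin.suc-injective eq))

  toPoly-form′ : ∀ y → toPoly K (form′ (vertex y)) ≈ u y
  toPoly-form′ nothing  = form-zero λ i → F.-‿inverseʳ (vertexForm v i)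
  toPoly-form′ (just k) = refl

  plane-poly : ∀ k y (prop : Proportional k (vertex y)) →
    toPoly K (form (plane k (vertex y))) ≈ const (Proportional.factor prop) * (x k - u y)
  plane-poly k y prop = trans (form-cong {form (plane k (vertex y))} form≈) (trans (form-scale factor (λ i → coord k i F.- form′ (vertex y) i))
    (*-congˡ {const factor} (trans (form-sub (coord k) (form′ (vertex y)))
      (+-cong {x k} {x k} refl (-‿cong (toPoly-form′ y))))))
    where open Proportional prop

  inverse′ : ∀ {k y} (prop : Proportional k y) →
    const (Proportional.inv prop) * const (Proportional.factor prop) ≈ 1#
  inverse′ prop = trans (sym (const-* (Proportional.inv prop) (Proportional.factor prop)))
    (const-cong (Proportional.inverse prop))

  -- A multiplicity as a function of the two vertices of a plane.
  multiplicity : Multiplicity K 6 → Fin 3 → Vertex → ℕ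
  multiplicity m k y = m (plane k (vertex y))

  open RawSemiringDefs (RawRing.rawSemiring (polyRing K 3)) using () renaming (_∣_ to _∣ʳ_; _^_ to _^ʳ_)

  -- Powers and divisibility for the raw ring of polynomials agree with those above, whose equality
  -- is the record of equal coefficients.
  ^ʳ≡^ : ∀ p n → p ^ʳ n ≡ p ^ n
  ^ʳ≡^ p zero    = ≡.refl
  ^ʳ≡^ p (suc n) = ≡.cong (p *_) (^ʳ≡^ p n)

  ∣ʳ⇒∣ : ∀ {p n q} → p ^ʳ n ∣ʳ q → p ^ n ∣ q
  ∣ʳ⇒∣ {p} {n} (r , r≈) = ≡.subst (_∣ _) (^ʳ≡^ p n) (r , mk≋ r≈)

  ∣⇒∣ʳ : ∀ {p n q} → p ^ n ∣ q → p ^ʳ n ∣ʳ q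
  ∣⇒∣ʳ {p} {n} p∣q = raw (≡.subst (_∣ _) (≡.sym (^ʳ≡^ p n)) p∣q)
    where
    raw : ∀ {p q} → p ∣ q → p ∣ʳ q
    raw (r , mk≋ r≈) = record { quotient = r ; equality = r≈ }

  module PlaneForm (k : Fin 3) (y : Vertex) (y≢k : y ≢ just k) where
    prop : Proportional k (vertex y)
    prop = plane-form k (vertex y) (vertex≢ y y≢k)
    open Proportional prop public using (factor; inv)
    P : Poly K 3
    P = toPoly K (form (plane k (vertex y)))

    to-log : ∀ n θ → P ^ n ∣ act (vectorField θ) P → (x k - u y) ^ n ∣ value θ k - atVertex (value θ) y
    to-log = plane⇒log {const factor} {const inv} {P} (inverse′ prop) (λ j → ∂-const j factor) {k} {y} (plane-poly k y prop)

    from-log : ∀ n θ → (x k - u y) ^ n ∣ value θ k - atVertex (value θ) y → P ^ n ∣ act (vectorField θ) P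
    from-log = log⇒plane {const factor} {const inv} {P} (inverse′ prop) (λ j → ∂-const j factor) {k} {y} (plane-poly k y prop)

  D⇒Log : ∀ m {θ} → D K A m θ → Log (multiplicity m) θ
  D⇒Log m {θ} θ∈D k y y≢k = to-log n θ (∣ʳ⇒∣ {P} {n} (θ∈D (plane k (vertex y))))
    where
    open PlaneForm k y y≢k
    n : ℕ
    n = multiplicity m k y

  Log⇒D : ∀ m {θ} → Log (multiplicity m) θ → D K A m θ
  Log⇒D m {θ} log H =
    let k , y , y≢k , H≡ = edge-between v H in by k y y≢k H≡
    where
    Goal : Fin 6 → Set _
    Goal H = toPoly K (form H) ^ʳ m H ∣ʳ apply K θ (toPoly K (form H))
    at-plane : ∀ k y → y ≢ just k → Goal (plane k (vertex y))
    at-plane k y y≢k = ∣⇒∣ʳ {P} {n} (from-log n θ (log k y y≢k))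
      where
      open PlaneForm k y y≢k
      n : ℕ
      n = multiplicity m k y
    by : ∀ k y → y ≢ suc k → H ≡ plane k y → Goal H
    by k zero    _   ≡.refl = at-plane k nothing λ ()
    by k (suc j) y≢k ≡.refl = at-plane k (just j) λ { ≡.refl → y≢k ≡.refl }

  multiplicity-suc : ∀ m k y → multiplicity (λ H → m H + 1) k y ≡ suc (multiplicity m k y)
  multiplicity-suc m k y = ℕ.+-comm (multiplicity m k y) 1

  D⇒Log-suc : ∀ m {θ} → D K A (λ H → m H + 1) θ → Log (λ k y → suc (multiplicity m k y)) θ
  D⇒Log-suc m {θ} θ∈D k y y≢k = ≡.subst (λ n → (x k - u y) ^ n ∣ value θ k - atVertex (value θ) y)
    (multiplicity-suc m k y) (D⇒Log (λ H → m H + 1) {θ} θ∈D k y y≢k)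

  Log⇒D-suc : ∀ m {θ} → Log (λ k y → suc (multiplicity m k y)) θ → D K A (λ H → m H + 1) θ
  Log⇒D-suc m {θ} log = Log⇒D (λ H → m H + 1) {θ} λ k y y≢k →
    ≡.subst (λ n → (x k - u y) ^ n ∣ value θ k - atVertex (value θ) y) (≡.sym (multiplicity-suc m k y)) (log k y y≢k)


  -- The map φ ↦ ∇_φ θ is always linear, so only its injectivity is at issue.
  ∇-monomorphism : ∀ θ → (∀ φ φ′ → (∀ i → nabla φ θ i ≈ nabla φ′ θ i) → ∀ i → φ i ≈ φ′ i) →
    IsLeftModuleMonomorphism (derModule K 3) (derModule K 3) (λ φ → ∇ K φ θ)
  ∇-monomorphism θ injective = record
    { isLeftModuleHomomorphism = record
      { +ᴹ-isGroupHomomorphism = record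
        { isMonoidHomomorphism = record
          { isMagmaHomomorphism = record
            { isRelHomomorphism = record
              { cong = λ {φ} {φ′} φ≈φ′ i → coefficients (nabla-cong {φ} {φ′} (λ j → mk≋ (φ≈φ′ j)) θ i) }
            ; homo = λ φ φ′ i → coefficients (nabla-+ φ φ′ θ i)
            }
          ; ε-homo = λ i → coefficients (nabla-0 θ i)
          }
        ; ⁻¹-homo = λ φ i → coefficients (nabla-neg φ θ i)
        }
      ; *ₗ-homo = λ f φ i → coefficients (nabla-* f φ θ i)
      }
    ; injective = λ {φ} {φ′} eq i → coefficients (injective φ φ′ (λ j → mk≋ (eq j)) i)
    }

  isUniversal-intro : ∀ m θ k → ¬ (∀ i → θ i ≈ 0#) →
    (∀ α → HomogeneousPoly K k (apply K θ (toPoly K α))) →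
    Log (λ k y → suc (multiplicity m k y)) θ →
    (∀ φ φ′ → (∀ i → nabla φ θ i ≈ nabla φ′ θ i) → ∀ i → φ i ≈ φ′ i) →
    (∀ η → Log (multiplicity m) η → ∃[ φ ] ∀ i → nabla φ θ i ≈ η i) →
    IsUniversal K A m θ
  isUniversal-intro m θ k θ≉0 homogeneous log injective surjective = record
    { homogeneous  = (λ eq → θ≉0 λ i → mk≋ (eq i)) , k , λ α _ → homogeneous α
    ; logarithmic  = Log⇒D-suc m {θ} log
    ; into         = λ φ → Log⇒D m {nabla φ θ} (log-∇ {multiplicity m} φ θ log)
    ; monomorphism = ∇-monomorphism θ injective
    ; onto         = λ η η∈D → let φ , eq = surjective η (D⇒Log m {η} η∈D) in
        φ , λ i → coefficients (eq i)
    }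

  module _ (m : Multiplicity K 6)
    (equalities : ∀ {i j} → i ≢ j → multiplicity m i (just j) ≡ multiplicity m i nothing + multiplicity m j nothing)
    where

    open Sufficiency (multiplicity m) equalities

    eulerField-const : ∀ a → act eulerField (const a) ≈ 0#
    eulerField-const a = field-const (λ i → (unitAt i , F.1#) ∷ []) λ j → ∂-const j a

    form-value : LinearForm K 3 → Poly K 3
    form-value α = apply K universal (toPoly K α)

    form-value-eigen : ∀ α → act eulerField (form-value α) ≈ ν universalDegree * form-value α
    form-value-eigen α = universal-eigen eulerField (λ k → euler-form (coord k)) (λ k i → eulerField-const (basis k i))
        (λ i → const (α i)) (λ i → eulerField-const (α i)) {form-value α} (apply-form universal α)

    universal-homogeneous : ∀ α → HomogeneousPoly K universalDegree (form-value α)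
    universal-homogeneous α = homogeneous characteristicZero universalDegree (form-value α) (form-value-eigen α)

    private
      1≉0 : ¬ 1# ≈ 0#
      1≉0 1≈0 = Field.1≉0 K (const-injective (trans 1≈0 (sym const-0)))

    isUniversal : IsUniversal K A m universal
    isUniversal = isUniversal-intro m universal universalDegree (universal-nonzero 1≉0 zero)
      universal-homogeneous log-universal universal-cancel universal-surjective


  -- A universal derivation forces every multiplicity on x i = x j to be at most the sum of those on
  -- x i = 0 and x j = 0.
  necessity : ∀ m {θ} → IsUniversal K A m θ → ∀ {i j} → i ≢ j →
    ¬ multiplicity m i nothing + multiplicity m j nothing ℕ.< multiplicity m i (just j)
  necessity m {θ} isUniversal {i} {j} i≢j a+b<n =
    let k , k≢i , k≢j , exhaust = third-index i j i≢j in by k k≢i k≢j exhaust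
    where
    open IsUniversal isUniversal
    surjective : ∀ η → Log (multiplicity m) η → ∃[ φ ] ∀ l → nabla φ θ l ≈ η l
    surjective η log = let φ , eq = onto η (Log⇒D m {η} log) in φ , λ l → mk≋ (eq l)
    by : ∀ k → k ≢ i → k ≢ j → (∀ l → l ≢ k → l ≡ i ⊎ l ≡ j) → _
    by k k≢i k≢j exhaust =
      let p , q , 1∈I = Obstruction.not-surjective i≢j k≢i k≢j exhaust (multiplicity m)
                          θ (D⇒Log-suc m {θ} logarithmic) a+b<n surjective
      in forms-proper (coord i) (coord j) {p} {q} 1∈I

module _ {c ℓ : Level} (K : Field c ℓ) (characteristicZero : CharacteristicZero K)
  (A : Arrangement K 3 6) (coxeter : IsCoxeterA₃ K A) (m : Multiplicity K 6) (v : Fin 4) where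

  open Geometry K A coxeter
  open LogarithmicDerivations K characteristicZero A coxeter v
  open Totals K

  private
    μ : Multiplicity K 6
    μ H = m H + 1

  -- The truncated subtraction is exact because every value of m + 1 is positive.
  bound-value : ∀ {L H H′} → H ≢ H′ → star v ∩ L ≡ ⁅ H ⁆ ∪ ⁅ H′ ⁆ →
    bound K μ (triangle v) ⊤ L ≡ (m H + m H′) + 1
  bound-value {L} {H} {H′} H≢H′ eq = begin
    total K μ (star v ∩ L) ℕ.∸ 1  ≡⟨ ≡.cong (λ B → total K μ B ℕ.∸ 1) eq ⟩
    total K μ (⁅ H ⁆ ∪ ⁅ H′ ⁆) ℕ.∸ 1  ≡⟨ ≡.cong (ℕ._∸ 1) (total-pair μ H≢H′) ⟩
    (m H + 1 + (m H′ + 1)) ℕ.∸ 1  ≡⟨ ≡.cong (ℕ._∸ 1) (≡.sym (ℕ.+-assoc (m H + 1) (m H′) 1)) ⟩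
    (m H + 1 + m H′ + 1) ℕ.∸ 1  ≡⟨ ℕ.m+n∸n≡m (m H + 1 + m H′) 1 ⟩
    m H + 1 + m H′  ≡⟨ ℕ.+-assoc (m H) 1 (m H′) ⟩
    m H + (1 + m H′)  ≡⟨ ≡.cong (m H +_) (ℕ.+-comm 1 (m H′)) ⟩
    m H + (m H′ + 1)  ≡⟨ ≡.sym (ℕ.+-assoc (m H) (m H′) 1) ⟩
    (m H + m H′) + 1  ∎
    where open ≡.≡-Reasoning

  universal⇒equalities : SupersolvableInequalities K A μ (triangle v) ⊤ →
    (∃ λ θ → IsUniversal K A m θ) → SupersolvableEqualities K A μ (triangle v) ⊤
  universal⇒equalities inequalities (θ , isUniversal) {H′} {H″} H′∈ H″∈ L localization L≢ =
    by (inequalities {H′} {H″} H′∈ H″∈ L localization) (flats v H′ H″ H′∈ H″∈)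
    where
    L≡ : L ≡ closure H′ H″
    L≡ = localization-unique {H′} {H″} localization
    by : L ≡ ⁅ H′ ⁆ ∪ ⁅ H″ ⁆ ⊎ bound K μ (triangle v) ⊤ L ℕ.≤ μ H″ → _ → μ H″ ≡ bound K μ (triangle v) ⊤ L
    by _ (inj₁ eq) = contradiction (≡.trans L≡ eq) L≢
    by (inj₁ eq) _ = contradiction eq L≢
    by (inj₂ bound≤) (inj₂ (i , j , i≢j , ≡.refl , eq)) = ≡.trans (≡.cong (_+ 1) equality) (≡.sym bound≡)
      where
      bound≡ : bound K μ (triangle v) ⊤ L ≡ (m (plane i zero) + m (plane j zero)) + 1
      bound≡ = bound-value {L} (star-edges-distinct v i j i≢j) (≡.trans (≡.cong (star v ∩_) L≡) eq)
      equality : m (plane i (suc j)) ≡ m (plane i zero) + m (plane j zero)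
      equality = ℕ.≤-antisym (ℕ.≮⇒≥ (necessity m isUniversal i≢j))
        (ℕ.+-cancelʳ-≤ 1 _ _ (ℕ.≤-trans (ℕ.≤-reflexive (≡.sym bound≡)) bound≤))

  equalities⇒universal : SupersolvableEqualities K A μ (triangle v) ⊤ → ∃ λ θ → IsUniversal K A m θ
  equalities⇒universal equalities = _ , isUniversal m numeric
    where
    numeric : ∀ {i j} → i ≢ j → m (plane i (suc j)) ≡ m (plane i zero) + m (plane j zero)
    numeric {i} {j} i≢j =
      let H′∈ , H″∈ , closure≢ , flat , H≢ = triple-flats v i j i≢j
          H′ = plane i zero
          H″ = plane i (suc j)
      in ℕ.+-cancelʳ-≡ 1 _ _ (≡.trans
        (equalities {H′} {H″} H′∈ H″∈ (closure H′ H″) (closure-localization H′ H″) closure≢)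
        (bound-value {closure H′ H″} H≢ flat))

theorem1p6 : ∀ {c ℓ} (K : Field c ℓ) → CharacteristicZero K →
    (A : Arrangement K 3 6) → IsCoxeterA₃ K A →
    (m : Multiplicity K 6) (A₁ A₂ A₃ : Subset 6) →
    IsSupersolvableFiltration K A A₁ A₂ A₃ →
    SupersolvableInequalities K A (λ H → m H + 1) A₂ A₃ →
    (∃ λ θ → IsUniversal K A m θ) ⇔
    SupersolvableEqualities K A (λ H → m H + 1) A₂ A₃
theorem1p6 K characteristicZero A coxeter m A₁ A₂ A₃ filtration = by A₃≡A (proj₂ coatom)
  where
  open IsSupersolvableFiltration filtration
  coatom : ∃[ v ] A₂ ≡ triangle v
  coatom = Geometry.modular-coatom K A coxeter rank₂ (≡.subst (λ C → ModularStep K A A₂ C) A₃≡A modular₃)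
  by : ∀ {B C} → C ≡ ⊤ → B ≡ triangle (proj₁ coatom) →
    SupersolvableInequalities K A (λ H → m H + 1) B C →
    (∃ λ θ → IsUniversal K A m θ) ⇔ SupersolvableEqualities K A (λ H → m H + 1) B C
  by ≡.refl ≡.refl inequalities = mk⇔
    (universal⇒equalities K characteristicZero A coxeter m (proj₁ coatom) inequalities)
    (equalities⇒universal K characteristicZero A coxeter m (proj₁ coatom))
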